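{- Let $r\geq 1$, $n\geq 1$ and $1\leq k\leq rn$ be integers. Then $$E^*(\mathcal{B}^{(r)}_{n,k},z)=\sum_{\substack{(\sigma,c)\in\mathfrak{S}^{(r)}_n\\ \mathrm{fexc}(\sigma,c)=rn-k}} z^{\lceil \mathrm{fdes}(\sigma,c)/r\rceil}.$$
   Context: Ehrhart series: for $\mathcal{X}\subset\mathbb{R}^n$ (here a convex integral polytope with possibly some faces removed), $E(\mathcal{X},t)$ denotes the polynomial in $t$ such that $E(\mathcal{X},t)=\#(t\mathcal{X}\cap\mathbb{Z}^n)$ for every integer $t>0$, where $t\mathcal{X}=\{tx: x\in\mathcal{X}\}$; and $E^*(\mathcal{X},z):=(1-z)^{n+1}\sum_{t\geq 0}E(\mathcal{X},t)z^t$ (the value at $t=0$ is that of the polynomial). Multi-hypersimplices: for $1\le k<rn$, $\mathcal{B}^{(r)}_{n,k}=\{v\in[0,r]^n : k-1\leq\sum_i v_i<k\}$; for $k=rn$, $\mathcal{B}^{(r)}_{n,k}=\{v\in[0,r]^n : k-1\leq\sum_i v_i\leq k\}$. Colored permutations: $\mathfrak{S}_n^{(r)}$ is the set of pairs $(\sigma,c)$ with $\sigma\in\mathfrak{S}_n$ a permutation of $\{1,\dots,n\}$ and $c=(c_1,\dots,c_n)\in\{0,1,\dots,r-1\}^n$. Define $\mathrm{fexc}(\sigma,c)=r\cdot\#\{i\in\{1,\dots,n\}:\sigma_i>i\text{ and }c_i=0\}+\sum_{i=1}^n c_i$; $\mathrm{des}(\sigma,c)=\#\{i : 1\leq i\leq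 n-1,\ c_i>c_{i+1}\text{, or }c_i=c_{i+1}\text{ and }\sigma_i>\sigma_{i+1}\}$; $\mathrm{fdes}(\sigma,c)=r\cdot\mathrm{des}(\sigma,c)+c_n$. -}

module Defs where

open import Data.Nat as ℕ using (ℕ; zero; suc; NonZero)
import Data.Nat.Properties as ℕ
open import Data.Integer as ℤ using (ℤ)
open import Data.Rational as ℚ using (ℚ; 0ℚ; 1ℚ; ½)
import Data.Rational.Properties as ℚ
open import Data.Fin as Fin using (Fin; toℕ; inject₁)
import Data.Fin.Properties as Fin
open import Data.List as List using (List; []; _∷_; [_]; length; foldr; upTo; cartesianProduct; cartesianProductWith)
open import Data.List.Membership.Propositional using (_∈_)
import Data.List.Relation.Unary.Unique.Propositional as List
open import Data.Vec as Vec using (Vec; []; _∷_; lookup; last)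
open import Data.Vec.Functional as Vector using (Vector)
import Data.Vec.Relation.Unary.AllPairs as AllPairs
open import Data.Vec.Relation.Unary.Unique.Propositional using (Unique)
open import Data.Product using (∃; _×_; _,_)
open import Data.Sum using (_⊎_)
open import Function using (_∘_; _⇔_)
open import Level using (0ℓ)
open import Relation.Binary.PropositionalEquality using (_≡_; sym; trans; cong; cong₂; subst; module ≡-Reasoning)
open import Relation.Nullary using (Dec; yes; no; ¬?; _×-dec_; _⊎-dec_)
open import Relation.Unary using (Pred; Decidable)

fromℤ : ℤ → ℚ
fromℤ z = z ℚ./ 1

fromℕ : ℕ → ℚ
fromℕ m = fromℤ (ℤ.+ m)

------------------------------------------------------------------------
-- Real numbers, as Cauchy sequences of rationals up to _≈ᴿ_

Cauchy : (ℕ → ℚ) → Set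
Cauchy x = ∀ ε → 0ℚ ℚ.< ε → ∃ λ N → ∀ m n → N ℕ.≤ m → N ℕ.≤ n →
           ℚ.∣ x m ℚ.- x n ∣ ℚ.≤ ε

record ℝ : Set where
  constructor mkℝ
  field
    seq    : ℕ → ℚ
    cauchy : Cauchy seq

open ℝ public

infix 4 _≈ᴿ_ _≤ᴿ_ _<ᴿ_

_≈ᴿ_ _≤ᴿ_ _<ᴿ_ : ℝ → ℝ → Set
x ≈ᴿ y = ∀ ε → 0ℚ ℚ.< ε → ∃ λ N → ∀ m → N ℕ.≤ m → ℚ.∣ seq x m ℚ.- seq y m ∣ ℚ.≤ ε
x ≤ᴿ y = ∀ ε → 0ℚ ℚ.< ε → ∃ λ N → ∀ m → N ℕ.≤ m → seq x m ℚ.≤ seq y m ℚ.+ ε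
x <ᴿ y = ∃ λ ε → 0ℚ ℚ.< ε × ∃ λ N → ∀ m → N ℕ.≤ m → seq x m ℚ.+ ε ℚ.≤ seq y m

fromℚᴿ : ℚ → ℝ
fromℚᴿ q = mkℝ (λ _ → q) λ ε 0<ε → 0 , λ _ _ _ _ →
  subst (ℚ._≤ ε) (sym (cong ℚ.∣_∣ (ℚ.+-inverseʳ q))) (ℚ.<⇒≤ 0<ε)

fromℤᴿ : ℤ → ℝ
fromℤᴿ = fromℚᴿ ∘ fromℤ

fromℕᴿ : ℕ → ℝ
fromℕᴿ = fromℚᴿ ∘ fromℕ

private
  interchange : ∀ a b c d → (a ℚ.+ b) ℚ.- (c ℚ.+ d) ≡ (a ℚ.- c) ℚ.+ (b ℚ.- d)
  interchange a b c d = begin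
    (a ℚ.+ b) ℚ.- (c ℚ.+ d)              ≡⟨ cong ((a ℚ.+ b) ℚ.+_) (ℚ.neg-distrib-+ c d) ⟩
    (a ℚ.+ b) ℚ.+ (ℚ.- c ℚ.+ ℚ.- d)      ≡⟨ ℚ.+-assoc a b _ ⟩
    a ℚ.+ (b ℚ.+ (ℚ.- c ℚ.+ ℚ.- d))      ≡⟨ cong (a ℚ.+_) (sym (ℚ.+-assoc b (ℚ.- c) (ℚ.- d))) ⟩
    a ℚ.+ ((b ℚ.+ ℚ.- c) ℚ.+ ℚ.- d)      ≡⟨ cong (λ e → a ℚ.+ (e ℚ.+ ℚ.- d)) (ℚ.+-comm b (ℚ.- c)) ⟩
    a ℚ.+ ((ℚ.- c ℚ.+ b) ℚ.+ ℚ.- d)      ≡⟨ cong (a ℚ.+_) (ℚ.+-assoc (ℚ.- c) b (ℚ.- d)) ⟩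
    a ℚ.+ (ℚ.- c ℚ.+ (b ℚ.- d))          ≡⟨ sym (ℚ.+-assoc a (ℚ.- c) (b ℚ.- d)) ⟩
    (a ℚ.- c) ℚ.+ (b ℚ.- d)              ∎
    where open ≡-Reasoning

  half+half : ∀ ε → ½ ℚ.* ε ℚ.+ ½ ℚ.* ε ≡ ε
  half+half ε = trans (sym (ℚ.*-distribʳ-+ ε ½ ½)) (ℚ.*-identityˡ ε)

  half-pos : ∀ {ε} → 0ℚ ℚ.< ε → 0ℚ ℚ.< ½ ℚ.* ε
  half-pos {ε} 0<ε = subst (ℚ._< ½ ℚ.* ε) (ℚ.*-zeroʳ ½) (ℚ.*-monoʳ-<-pos ½ 0<ε)

infixl 6 _+ᴿ_

_+ᴿ_ : ℝ → ℝ → ℝ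
x +ᴿ y = mkℝ (λ m → seq x m ℚ.+ seq y m) λ ε 0<ε →
  let M  , hx = cauchy x (½ ℚ.* ε) (half-pos 0<ε)
      M′ , hy = cauchy y (½ ℚ.* ε) (half-pos 0<ε)
  in M ℕ.⊔ M′ , λ m n N≤m N≤n →
     subst (ℚ._≤ ε) (cong ℚ.∣_∣ (sym (interchange (seq x m) (seq y m) (seq x n) (seq y n))))
       (ℚ.≤-trans
         (ℚ.∣p+q∣≤∣p∣+∣q∣ (seq x m ℚ.- seq x n) (seq y m ℚ.- seq y n))
         (subst (_ ℚ.≤_) (half+half ε)
           (ℚ.+-mono-≤
             (hx m n (ℕ.m⊔n≤o⇒m≤o M M′ N≤m) (ℕ.m⊔n≤o⇒m≤o M M′ N≤n))
             (hy m n (ℕ.m⊔n≤o⇒n≤o M M′ N≤m) (ℕ.m⊔n≤o⇒n≤o M M′ N≤n)))))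

infixr 7 _·ᴿ_

-- The real number t x for a natural number t, as x + ⋯ + x.
_·ᴿ_ : ℕ → ℝ → ℝ
zero  ·ᴿ x = fromℕᴿ 0
suc t ·ᴿ x = x +ᴿ t ·ᴿ x

sumᴿ : ∀ {n} → Vector ℝ n → ℝ
sumᴿ = Vector.foldr _+ᴿ_ (fromℕᴿ 0)

------------------------------------------------------------------------
-- Lattice points and Ehrhart polynomials

Subsetᴿ : ℕ → Set₁
Subsetᴿ n = Pred (Vector ℝ n) 0ℓ

dilate : ∀ {n} → ℕ → Subsetᴿ n → Subsetᴿ n
dilate t X y = ∃ λ x → X x × (∀ i → y i ≈ᴿ t ·ᴿ x i)

LatticePoint : ∀ {n} → Subsetᴿ n → Pred (Vec ℤ n) 0ℓ
LatticePoint X w = X (λ i → fromℤᴿ (lookup w i))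

record HasCardinality {A : Set} (P : Pred A 0ℓ) (m : ℕ) : Set where
  field
    elements : List A
    unique   : List.Unique elements
    correct  : ∀ a → a ∈ elements ⇔ P a
    size     : length elements ≡ m

-- The list of coefficients, constant term first.
Polynomial : Set
Polynomial = List ℚ

eval : Polynomial → ℚ → ℚ
eval []      x = 0ℚ
eval (a ∷ p) x = a ℚ.+ x ℚ.* eval p x

IsEhrhartPolynomial : ∀ {n} → Subsetᴿ n → Polynomial → Set
IsEhrhartPolynomial X E = ∀ t → 0 ℕ.< t →
  ∃ λ m → HasCardinality (LatticePoint (dilate t X)) m × eval E (fromℕ t) ≡ fromℕ m

------------------------------------------------------------------------
-- Formal power series in z over ℚ, as coefficient functions

Series : Set
Series = ℕ → ℚ

infix  4 _≈ˢ_
infixl 7 _*ˢ_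
infixr 8 _^ˢ_

_≈ˢ_ : Series → Series → Set
f ≈ˢ g = ∀ j → f j ≡ g j

sumℚ : List ℚ → ℚ
sumℚ = foldr ℚ._+_ 0ℚ

_*ˢ_ : Series → Series → Series
(f *ˢ g) j = sumℚ (List.map (λ i → f i ℚ.* g (j ℕ.∸ i)) (upTo (suc j)))

z^ : ℕ → Series
z^ m j with j ℕ.≟ m
... | yes _ = 1ℚ
... | no  _ = 0ℚ

1-z : Series
1-z j = z^ 0 j ℚ.- z^ 1 j

_^ˢ_ : Series → ℕ → Series
f ^ˢ zero  = z^ 0
f ^ˢ suc m = f *ˢ f ^ˢ m

sumˢ : {A : Set} → List A → (A → Series) → Series
sumˢ xs f j = sumℚ (List.map (λ x → f x j) xs)

-- E*(X, z) for X ⊆ ℝⁿ with Ehrhart polynomial E.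
E* : (n : ℕ) → Polynomial → Series
E* n E = 1-z ^ˢ suc n *ˢ (λ t → eval E (fromℕ t))

------------------------------------------------------------------------
-- Multi-hypersimplices

-- The last two fields distinguish the half-open case k < rn from the
-- closed case k = rn.
record MultiHypersimplex (r n k : ℕ) (v : Vector ℝ n) : Set where
  field
    nonneg  : ∀ i → fromℕᴿ 0 ≤ᴿ v i
    bounded : ∀ i → v i ≤ᴿ fromℕᴿ r
    lower   : fromℤᴿ (ℤ.+ k ℤ.- ℤ.+ 1) ≤ᴿ sumᴿ v
    upper<  : k ℕ.< r ℕ.* n → sumᴿ v <ᴿ fromℕᴿ k
    upper≤  : k ≡ r ℕ.* n → sumᴿ v ≤ᴿ fromℕᴿ k

------------------------------------------------------------------------
-- Colored permutations

words : {A : Set} → List A → (n : ℕ) → List (Vec A n)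
words xs zero    = [ [] ]
words xs (suc n) = cartesianProductWith _∷_ xs (words xs n)

-- In one-line notation: the words σ₁ … σₙ over the n-element set Fin n
-- with pairwise distinct letters.
permutations : (n : ℕ) → List (Vec (Fin n) n)
permutations n = List.filter unique? (words (List.allFin n) n)
  where
  unique? : Decidable {A = Vec (Fin n) n} Unique
  unique? = AllPairs.allPairs? λ i j → ¬? (i Fin.≟ j)

-- Both the letters of σ and the positions are counted from 0, so that
-- comparing σᵢ with i is unaffected.
coloredPermutations : (r n : ℕ) → List (Vec (Fin n) n × Vec (Fin r) n)
coloredPermutations r n = cartesianProduct (permutations n) (words (List.allFin r) n)

module _ {r : ℕ} where

  fexc : ∀ {n} → Vec (Fin n) n × Vec (Fin r) n → ℕ
  fexc {n} (σ , c) =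
    r ℕ.* Vec.count (λ i → (i Fin.<? lookup σ i) ×-dec (toℕ (lookup c i) ℕ.≟ 0)) (Vec.allFin n)
    ℕ.+ Vec.sum (Vec.map toℕ c)

  Descent : ∀ {n} → Vec (Fin n) n × Vec (Fin r) n → (i j : Fin n) → Set
  Descent (σ , c) i j =
    lookup c j Fin.< lookup c i ⊎
    (lookup c i ≡ lookup c j × lookup σ j Fin.< lookup σ i)

  descent? : ∀ {n} (π : Vec (Fin n) n × Vec (Fin r) n) i j → Dec (Descent π i j)
  descent? (σ , c) i j =
    (lookup c j Fin.<? lookup c i) ⊎-dec
    ((lookup c i Fin.≟ lookup c j) ×-dec (lookup σ j Fin.<? lookup σ i))

  des : ∀ {n} → Vec (Fin n) n × Vec (Fin r) n → ℕ
  des {zero}  π = 0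
  des {suc m} π = Vec.count (λ i → descent? π (inject₁ i) (Fin.suc i)) (Vec.allFin m)

  -- The value for n = 0, where there is no last color, is immaterial.
  lastColor : ∀ {n} → Vec (Fin r) n → ℕ
  lastColor {zero}  _ = 0
  lastColor {suc m} c = toℕ (last c)

  fdes : ∀ {n} → Vec (Fin n) n × Vec (Fin r) n → ℕ
  fdes π@(_ , c) = r ℕ.* des π ℕ.+ lastColor c

⌈_/_⌉ : (a b : ℕ) .{{_ : NonZero b}} → ℕ
⌈ a / b ⌉ = ℤ.∣ ℚ.ceiling (ℤ.+ a ℚ./ b) ∣

coloredPermutationsWithFexc : (r n e : ℕ) → List (Vec (Fin n) n × Vec (Fin r) n)
coloredPermutationsWithFexc r n e =
  List.filter (λ π → fexc π ℕ.≟ e) (coloredPermutations r n)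

{-# OPTIONS --safe #-}
module Submission where

-- Expanding z^d / (1 − z)ⁿ⁺¹ for d = ⌈fdes(σ, c) / r⌉, the coefficient of zᵗ
-- counts the sequences t ≥ f₁ ≥ ⋯ ≥ fₙ ≥ [cₙ > 0] that decrease strictly at the
-- descents of (σ, c). Placing the letter r fᵢ − cᵢ at position σᵢ identifies
-- the triples (σ, c, f) with all words over {0, …, rt}; σ is the
-- standardization of the word, and fexc becomes a statistic of words, position
-- p being an excedance iff more smaller letters precede it than larger letters
-- follow it. On the other side, v ↦ rt − v turns the lattice points of the
-- t-th dilate into words w with prescribed ⌊(Σ w ∸ 1) / t⌋. So the two word
-- statistics have to be equidistributed. With a number s marking the
-- statistic and u marking the length, both generating series F satisfy
--   F (1 − u) ((1 − u)ᵗ − s (1 − sʳ u)ᵗ) = (1 − s) (1 − sʳ u)ᵗ.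
-- For lattice points this comes from telescoping the sum over one letter. For
-- excedances the letters are eliminated one by one: the largest letters are
-- merged into stars, words with v stars have the series b (u b)ᵛ, and each
-- elimination changes b by a Möbius transformation.

open import Defs
open import Data.Nat as ℕ using (ℕ; zero; suc; _+_; _*_; _∸_; _≤_; _<_; z≤n; s≤s; NonZero)
open import Data.Product using (∃; Σ; _×_; _,_; proj₁; proj₂)
open import Algebra.Bundles using (CommutativeRing)
open import Algebra.Structures using (IsCommutativeRing)
open import Data.Bool using (true; false; if_then_else_)
open import Data.Maybe using (Maybe; just; nothing)
open import Data.Nat.DivMod using (_/_; _%_; [m+kn]%n≡m%n; m<n⇒m%n≡m; +-distrib-/-∣ʳ; m*n/n≡m; m<n⇒m/n≡0; n/n≡1; m%n<n; m≡m%n+[m/n]*n; m/n*n≤m; /-monoˡ-≤; m<n*o⇒m/o<n)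
open import Data.Nat.Divisibility using (divides)
open import Data.Nat.ListAction using (sum)
open import Data.Fin as Fin using (Fin; toℕ; inject₁)
open import Data.Integer as ℤ using (ℤ)
open import Data.List as List using (List; []; _∷_; _++_; length)
open import Data.List.Membership.Propositional using (_∈_)
open import Data.List.Relation.Unary.Any using (here; there)
open import Data.List.Relation.Unary.All using (All; []; _∷_)
open import Data.List.Relation.Binary.Pointwise using (Pointwise; []; _∷_) renaming (refl to pointwise-refl)
open import Data.Rational as ℚ using (ℚ; 0ℚ; 1ℚ)
open import Data.Sum using (_⊎_; inj₁; inj₂)
open import Data.Vec as Vec using (Vec; []; _∷_; lookup)
open import Data.Vec.Functional using (Vector)
open import Function using (_∘_; id; _⇔_; mk⇔; Equivalence)
open import Level using (0ℓ)
open import Relation.Binary.PropositionalEquality using (_≡_; _≢_; refl; sym; trans; cong; cong₂; subst; subst₂; module ≡-Reasoning)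
open import Relation.Nullary using (_×-dec_; _⊎-dec_; Dec; does; proof; yes; no; ¬_; contradiction; ofʸ; ofⁿ)
open import Relation.Binary using (IsEquivalence; tri<; tri≈; tri>)
open import Algebra.Solver.Ring.AlmostCommutativeRing using (_-Raw-AlmostCommutative⟶_; fromCommutativeRing)
import Data.Fin.Properties as Fin
import Data.Integer.Properties as ℤ
import Data.Nat.Properties as ℕ
import Data.Rational.Properties as ℚ
import Data.List.Relation.Unary.Unique.Propositional as List
import Data.List.Relation.Unary.AllPairs as ListAllPairs
import Data.List.Relation.Unary.All as ListAll
open import Data.List.Membership.Propositional.Properties
  using (∈-∃++; ∈-map⁺; ∈-map⁻; ∈-filter⁺; ∈-filter⁻; ∈-allFin; ∈-cartesianProduct⁺; ∈-cartesianProduct⁻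
        ; ∈-cartesianProductWith⁺)
import Data.List.Relation.Unary.Unique.Propositional.Properties as Unique
open import Data.List.Relation.Binary.Permutation.Propositional using (_↭_; ↭-sym; ↭⇒↭ₛ)
import Data.List.Relation.Binary.Permutation.Propositional.Properties as ↭
import Data.List.Relation.Binary.Permutation.Setoid.Properties as SetoidPermutation
open import Data.List.Properties using (map-applyUpTo; map-tabulate; map-++; map-∘; length-map)
open import Data.Nat.ListAction.Properties using (sum-↭)
open import Relation.Binary.PropositionalEquality.Properties using () renaming (setoid to ≡-setoid)
open import Data.Nat.Solver using () renaming (module +-*-Solver to Nat)
open import Data.Vec.Properties using (lookup∘tabulate; lookup-map; tabulate∘lookup; tabulate-cong; ∷-injectiveˡ; ∷-injectiveʳ)
import Data.Vec.Relation.Unary.Unique.Propositional as VecUnique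
import Data.Vec.Relation.Unary.Unique.Propositional.Properties as VecUnique

-- Whether a letter is an excedance depends on both of its sides, so splitting off an end of a word
-- gives no recursion. Elimination works because the letter ℓ just below v stars has a simple
-- status: preceded by g letters other than ℓ, it is an excedance iff v < g. Hence ℓ weighs β in the
-- gaps 0, ..., v and α in the later ones. Lowering this threshold by one gap trades a factor 1/(1 -
-- βu) for 1/(1 - αu). Smaller letters see the added ℓ as a star, but those before one of the gaps
-- 0, ..., v have enough stars to their right to be no excedances, with or without it. Once the
-- threshold is 0, every ℓ weighs α and the words are counted by the binomial series Σ C(k, v) αᵏ⁻ᵛ
-- b (ub)ᵏ = b (ub)ᵛ / (1 - αub)ᵛ⁺¹. Altogether b becomes b′ = (1 - αu) b / ((1 - βu)(1 - αub)), for
-- all v at once, and this is affine in 1/b. An Ehrhart polynomial is constrained only at t > 0,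
-- while its value at 0 enters the series; the bound ⌈fdes / r⌉ ≤ n settles this.

-- Formal power series over a commutative ring

module PowerSeries {A : Set} (_⊕_ _⊗_ : A → A → A) (⊖_ : A → A) (0# 1# : A)
  (isCommutativeRing : IsCommutativeRing _≡_ _⊕_ _⊗_ ⊖_ 0# 1#) where

  open IsCommutativeRing isCommutativeRing
    hiding (refl; sym; trans; setoid; zero)
    renaming (+-assoc to ⊕-assoc; +-comm to ⊕-comm; +-identityˡ to ⊕-identityˡ; *-assoc to ⊗-assoc; *-comm to ⊗-comm)

  coefficientRing : CommutativeRing 0ℓ 0ℓ
  coefficientRing = record { isCommutativeRing = isCommutativeRing }

  open import Algebra.Solver.Ring.NaturalCoefficients.Default
    (CommutativeRing.commutativeSemiring coefficientRing)
    using (solve; _:+_; _:*_; _:=_)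
  open import Algebra.Properties.Ring (CommutativeRing.ring coefficientRing)
    using (-‿distribˡ-*; -0#≈0#)
  open ≡-Reasoning

  Ser : Set
  Ser = ℕ → A

  infix  4 _≈_
  infixl 6 _⊞_
  infixl 7 _⊠_

  _≈_ : Ser → Ser → Set
  f ≈ g = ∀ n → f n ≡ g n

  _⊞_ _⊠_ : Ser → Ser → Ser
  (f ⊞ g) n = f n ⊕ g n
  (f ⊠ g) zero    = f 0 ⊗ g 0
  (f ⊠ g) (suc n) = (f 0 ⊗ g (suc n)) ⊕ (f ∘ suc ⊠ g) n

  negate : Ser → Ser
  negate f n = ⊖ f n

  const : A → Ser
  const a zero    = a
  const a (suc n) = 0#

  shift : Ser → Ser
  shift f zero    = 0#
  shift f (suc n) = f n

  var : Ser
  var = shift (const 1#)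

  scale : A → Ser → Ser
  scale a f n = a ⊗ f n

  -- A coefficient of a product involves only coefficients up to its degree. This truncated
  -- congruence is what inductions on the degree use, as in `⊠-cancelˡ` and `geometric-vanishes`.
  ⊠-cong-≤ : ∀ {f f′ g g′} n → (∀ {i} → i ≤ n → f i ≡ f′ i) → (∀ {i} → i ≤ n → g i ≡ g′ i) →
             (f ⊠ g) n ≡ (f′ ⊠ g′) n
  ⊠-cong-≤ zero    p q = cong₂ _⊗_ (p z≤n) (q z≤n)
  ⊠-cong-≤ (suc n) p q = cong₂ _⊕_ (cong₂ _⊗_ (p z≤n) (q ℕ.≤-refl))
    (⊠-cong-≤ n (p ∘ s≤s) (q ∘ ℕ.m≤n⇒m≤1+n))

  ⊠-cong : ∀ {f f′ g g′} → f ≈ f′ → g ≈ g′ → f ⊠ g ≈ f′ ⊠ g′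
  ⊠-cong p q n = ⊠-cong-≤ n (λ {i} _ → p i) (λ {i} _ → q i)

  -- The definition of `_⊠_` peels the constant term off the left factor; the mirrored form is what
  -- the induction for `⊠-comm` needs.
  ⊠-sucʳ : ∀ f g n → (f ⊠ g) (suc n) ≡ (f ⊠ g ∘ suc) n ⊕ (f (suc n) ⊗ g 0)
  ⊠-sucʳ f g zero    = refl
  ⊠-sucʳ f g (suc n) = begin
    (f 0 ⊗ g (2 + n)) ⊕ (f ∘ suc ⊠ g) (suc n)                                 ≡⟨ cong (_ ⊕_) (⊠-sucʳ (f ∘ suc) g n) ⟩
    (f 0 ⊗ g (2 + n)) ⊕ ((f ∘ suc ⊠ g ∘ suc) n ⊕ (f (2 + n) ⊗ g 0))           ≡⟨ ⊕-assoc _ _ _ ⟨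
    ((f 0 ⊗ g (2 + n)) ⊕ (f ∘ suc ⊠ g ∘ suc) n) ⊕ (f (2 + n) ⊗ g 0)           ∎

  ⊠-comm : ∀ f g → f ⊠ g ≈ g ⊠ f
  ⊠-comm f g zero    = ⊗-comm _ _
  ⊠-comm f g (suc n) = begin
    (f 0 ⊗ g (suc n)) ⊕ (f ∘ suc ⊠ g) n  ≡⟨ cong₂ _⊕_ (⊗-comm _ _) (⊠-comm (f ∘ suc) g n) ⟩
    (g (suc n) ⊗ f 0) ⊕ (g ⊠ f ∘ suc) n  ≡⟨ ⊕-comm _ _ ⟩
    (g ⊠ f ∘ suc) n ⊕ (g (suc n) ⊗ f 0)  ≡⟨ ⊠-sucʳ g f n ⟨
    (g ⊠ f) (suc n)                      ∎

  ⊠-distribʳ : ∀ h f g → (f ⊞ g) ⊠ h ≈ f ⊠ h ⊞ g ⊠ h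
  ⊠-distribʳ h f g zero    = distribʳ _ _ _
  ⊠-distribʳ h f g (suc n) = trans (cong (((f 0 ⊕ g 0) ⊗ h (suc n)) ⊕_) (⊠-distribʳ h (f ∘ suc) (g ∘ suc) n))
    (solve 5 (λ a b c x y → (a :+ b) :* c :+ (x :+ y) := (a :* c :+ x) :+ (b :* c :+ y)) refl
      (f 0) (g 0) (h (suc n)) ((f ∘ suc ⊠ h) n) ((g ∘ suc ⊠ h) n))

  ⊠-distribˡ : ∀ h f g → h ⊠ (f ⊞ g) ≈ h ⊠ f ⊞ h ⊠ g
  ⊠-distribˡ h f g n = trans (⊠-comm h (f ⊞ g) n)
    (trans (⊠-distribʳ h f g n) (cong₂ _⊕_ (⊠-comm f h n) (⊠-comm g h n)))

  scale-⊠ : ∀ a f g → scale a f ⊠ g ≈ scale a (f ⊠ g)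
  scale-⊠ a f g zero    = ⊗-assoc _ _ _
  scale-⊠ a f g (suc n) = trans (cong (((a ⊗ f 0) ⊗ g (suc n)) ⊕_) (scale-⊠ a (f ∘ suc) g n))
    (solve 4 (λ a b c x → a :* b :* c :+ a :* x := a :* (b :* c :+ x)) refl a (f 0) (g (suc n)) ((f ∘ suc ⊠ g) n))

  ⊠-scale : ∀ a f g → f ⊠ scale a g ≈ scale a (f ⊠ g)
  ⊠-scale a f g n = trans (⊠-comm f (scale a g) n)
    (trans (scale-⊠ a g f n) (cong (a ⊗_) (⊠-comm g f n)))

  ⊠-zeroˡ : ∀ f → (λ _ → 0#) ⊠ f ≈ λ _ → 0#
  ⊠-zeroˡ f zero    = zeroˡ _
  ⊠-zeroˡ f (suc n) = trans (cong₂ _⊕_ (zeroˡ _) (⊠-zeroˡ f n)) (⊕-identityˡ _)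

  const-⊠ : ∀ a f → const a ⊠ f ≈ scale a f
  const-⊠ a f zero    = refl
  const-⊠ a f (suc n) = trans (cong (_ ⊕_) (⊠-zeroˡ f n)) (+-identityʳ _)

  shift-⊠ : ∀ f g → shift f ⊠ g ≈ shift (f ⊠ g)
  shift-⊠ f g zero    = zeroˡ _
  shift-⊠ f g (suc n) = trans (cong (_⊕ (f ⊠ g) n) (zeroˡ (g (suc n)))) (⊕-identityˡ _)

  ⊠-assoc : ∀ f g h → (f ⊠ g) ⊠ h ≈ f ⊠ (g ⊠ h)
  ⊠-assoc f g h zero    = ⊗-assoc _ _ _
  ⊠-assoc f g h (suc n) = begin
    ((f 0 ⊗ g 0) ⊗ h (suc n)) ⊕ ((scale (f 0) (g ∘ suc) ⊞ f ∘ suc ⊠ g) ⊠ h) n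
      ≡⟨ cong (_ ⊕_) (trans (⊠-distribʳ h (scale (f 0) (g ∘ suc)) (f ∘ suc ⊠ g) n)
           (cong₂ _⊕_ (scale-⊠ (f 0) (g ∘ suc) h n) (⊠-assoc (f ∘ suc) g h n))) ⟩
    ((f 0 ⊗ g 0) ⊗ h (suc n)) ⊕ ((f 0 ⊗ (g ∘ suc ⊠ h) n) ⊕ (f ∘ suc ⊠ (g ⊠ h)) n)
      ≡⟨ solve 5 (λ a b c x y → a :* b :* c :+ (a :* x :+ y) := a :* (b :* c :+ x) :+ y) refl
           (f 0) (g 0) (h (suc n)) _ _ ⟩
    (f 0 ⊗ (g ⊠ h) (suc n)) ⊕ (f ∘ suc ⊠ (g ⊠ h)) n
      ∎

  ⊠-identityˡ : ∀ f → const 1# ⊠ f ≈ f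
  ⊠-identityˡ f n = trans (const-⊠ 1# f n) (*-identityˡ (f n))

  var-⊠ : ∀ f → var ⊠ f ≈ shift f
  var-⊠ f zero    = zeroˡ _
  var-⊠ f (suc n) = trans (shift-⊠ (const 1#) f (suc n)) (⊠-identityˡ f n)

  ≈-isEquivalence : IsEquivalence _≈_
  ≈-isEquivalence = record
    { refl = λ _ → refl ; sym = λ p n → sym (p n) ; trans = λ p q n → trans (p n) (q n) }

  const-0# : const 0# ≈ λ _ → 0#
  const-0# zero    = refl
  const-0# (suc n) = refl

  seriesRing : CommutativeRing 0ℓ 0ℓ
  seriesRing = record
    { Carrier = Ser
    ; _≈_ = _≈_ ; _+_ = _⊞_ ; _*_ = _⊠_ ; -_ = negate ; 0# = const 0# ; 1# = const 1#
    ; isCommutativeRing = record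
      { isRing = record
        { +-isAbelianGroup = record
          { isGroup = record
            { isMonoid = record
              { isSemigroup = record
                { isMagma = record
                  { isEquivalence = ≈-isEquivalence
                  ; ∙-cong = λ p q n → cong₂ _⊕_ (p n) (q n) }
                ; assoc = λ f g h n → ⊕-assoc (f n) (g n) (h n) }
              ; identity = (λ f n → trans (cong (_⊕ f n) (const-0# n)) (⊕-identityˡ (f n)))
                         , (λ f n → trans (cong (f n ⊕_) (const-0# n)) (+-identityʳ (f n))) }
            ; inverse = (λ f n → trans (-‿inverseˡ (f n)) (sym (const-0# n)))
                      , (λ f n → trans (-‿inverseʳ (f n)) (sym (const-0# n)))
            ; ⁻¹-cong = λ p n → cong ⊖_ (p n) }
          ; comm = λ f g n → ⊕-comm (f n) (g n) }
        ; *-cong = ⊠-cong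
        ; *-assoc = ⊠-assoc
        ; *-identity = ⊠-identityˡ , λ f n → trans (⊠-comm f (const 1#) n) (⊠-identityˡ f n)
        ; distrib = ⊠-distribˡ , ⊠-distribʳ }
      ; *-comm = ⊠-comm } }

  -- Through this homomorphism the ring solver for series accepts coefficients as constants, such as
  -- the 1 in 1 - u.
  const-homomorphism : CommutativeRing.rawRing coefficientRing -Raw-AlmostCommutative⟶ fromCommutativeRing seriesRing
  const-homomorphism = record
    { ⟦_⟧    = const
    ; +-homo = λ { a b zero → refl ; a b (suc n) → sym (⊕-identityˡ 0#) }
    ; *-homo = λ { a b zero → refl ; a b (suc n) → sym (trans (const-⊠ a (const b) (suc n)) (zeroʳ a)) }
    ; -‿homo = λ { a zero → refl ; a (suc n) → sym -0#≈0# }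
    ; 0-homo = λ _ → refl
    ; 1-homo = λ _ → refl }

  -- Course-of-values induction on the degree: a coefficient of `c ⊠ f` is `c 0` times the same
  -- coefficient of `f` plus terms in lower ones. Only `c 0` has to be cancellable, so no inverse
  -- series is constructed.
  ⊠-cancelˡ : ∀ {c} → (∀ {a b} → c 0 ⊗ a ≡ c 0 ⊗ b → a ≡ b) → ∀ {f g} → c ⊠ f ≈ c ⊠ g → f ≈ g
  ⊠-cancelˡ {c} cancel {f} {g} cf≈cg n = below (suc n) ℕ.≤-refl
    where
    ⊕-cancelʳ : ∀ {a b} d → a ⊕ d ≡ b ⊕ d → a ≡ b
    ⊕-cancelʳ {a} {b} d eq = begin
      a                ≡⟨ undo a ⟨
      (a ⊕ d) ⊕ (⊖ d)  ≡⟨ cong (_⊕ (⊖ d)) eq ⟩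
      (b ⊕ d) ⊕ (⊖ d)  ≡⟨ undo b ⟩
      b                ∎
      where
      undo : ∀ x → (x ⊕ d) ⊕ (⊖ d) ≡ x
      undo x = trans (⊕-assoc x d (⊖ d)) (trans (cong (x ⊕_) (-‿inverseʳ d)) (+-identityʳ x))

    below : ∀ n {i} → i < n → f i ≡ g i
    below (suc n) {zero}  _         = cancel (cf≈cg 0)
    below (suc n) {suc i} (s≤s i<n) = cancel (⊕-cancelʳ _ (trans (cf≈cg (suc i))
      (cong ((c 0 ⊗ g (suc i)) ⊕_) (⊠-cong-≤ {c ∘ suc} i (λ _ → refl)
        (λ j≤i → sym (below n (ℕ.≤-<-trans j≤i i<n)))))))

  one-minus : A → Ser → Ser
  one-minus a f = const 1# ⊞ negate (scale a f)

  one-minus-⊠ : ∀ a f g → one-minus a f ⊠ g ≈ λ n → g n ⊕ (⊖ (a ⊗ (f ⊠ g) n))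
  one-minus-⊠ a f g n = begin
    (one-minus a f ⊠ g) n                             ≡⟨ ⊠-distribʳ g (const 1#) (negate (scale a f)) n ⟩
    (const 1# ⊠ g) n ⊕ (negate (scale a f) ⊠ g) n     ≡⟨ cong₂ _⊕_ (⊠-identityˡ g n) (trans (⊠-cong {negate (scale a f)} {scale (⊖ a) f}
                                                           (λ m → -‿distribˡ-* a (f m)) (λ _ → refl) n) (scale-⊠ (⊖ a) f g n)) ⟩
    g n ⊕ ((⊖ a) ⊗ (f ⊠ g) n)                         ≡⟨ cong (g n ⊕_) (-‿distribˡ-* a _) ⟨
    g n ⊕ (⊖ (a ⊗ (f ⊠ g) n))                         ∎

  ⊕-⊖-cross : ∀ {p q r s} → p ⊕ q ≡ r ⊕ s → p ⊕ (⊖ s) ≡ r ⊕ (⊖ q)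
  ⊕-⊖-cross {p} {q} {r} {s} eq = begin
    p ⊕ (⊖ s)                    ≡⟨ cong (_⊕ (⊖ s)) (trans (sym (+-identityʳ p)) (cong (p ⊕_) (sym (-‿inverseʳ q)))) ⟩
    (p ⊕ (q ⊕ (⊖ q))) ⊕ (⊖ s)    ≡⟨ cong (_⊕ (⊖ s)) (⊕-assoc p q (⊖ q)) ⟨
    ((p ⊕ q) ⊕ (⊖ q)) ⊕ (⊖ s)    ≡⟨ cong (λ e → (e ⊕ (⊖ q)) ⊕ (⊖ s)) eq ⟩
    ((r ⊕ s) ⊕ (⊖ q)) ⊕ (⊖ s)    ≡⟨ solve 4 (λ r s q′ s′ → ((r :+ s) :+ q′) :+ s′ := (r :+ q′) :+ (s :+ s′)) refl r s (⊖ q) (⊖ s) ⟩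
    (r ⊕ (⊖ q)) ⊕ (s ⊕ (⊖ s))    ≡⟨ trans (cong ((r ⊕ (⊖ q)) ⊕_) (-‿inverseʳ s)) (+-identityʳ _) ⟩
    r ⊕ (⊖ q)                    ∎

  -- Counting arguments yield identities without subtraction; this turns them into relations between
  -- factors of the form 1 - a x.
  one-minus-cross : ∀ {a c x y f g} → f ⊞ scale a (x ⊠ g) ≈ g ⊞ scale c (y ⊠ f) →
                    one-minus c y ⊠ f ≈ one-minus a x ⊠ g
  one-minus-cross {a} {c} {x} {y} {f} {g} eq n =
    trans (one-minus-⊠ c y f n) (trans (⊕-⊖-cross (eq n)) (sym (one-minus-⊠ a x g n)))

  one-minus-solve : ∀ {a x f g} → f ≈ g ⊞ scale a (x ⊠ f) → one-minus a x ⊠ f ≈ g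
  one-minus-solve {a} {x} {f} {g} eq n = trans (one-minus-⊠ a x f n)
    (trans (⊕-⊖-cross (trans (+-identityʳ (f n)) (eq n)))
      (trans (cong (g n ⊕_) -0#≈0#) (+-identityʳ (g n))))

-- Letter counts, gaps and insertion into words

if-yes : {P A : Set} (d : Dec P) {a b : A} → P → (if does d then a else b) ≡ a
if-yes (yes _) _ = refl
if-yes (no ¬p) p = contradiction p ¬p

if-no : {P A : Set} (d : Dec P) {a b : A} → ¬ P → (if does d then a else b) ≡ b
if-no (yes p) ¬p = contradiction p ¬p
if-no (no _)  _  = refl

if-cong : {P Q A : Set} (d : Dec P) (e : Dec Q) {a b : A} → (P → Q) → (Q → P) →
          (if does d then a else b) ≡ (if does e then a else b)
if-cong (yes p) e f g = sym (if-yes e (f p))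
if-cong (no ¬p) e f g = sym (if-no e (¬p ∘ g))

ι : {P : Set} → Dec P → ℕ
ι d = if does d then 1 else 0

-- `below` is strict and `above` is weak, so the two are complementary; letters strictly larger than
-- `x` are counted by `above (suc x)`.
below above : ℕ → List ℕ → ℕ
below k []      = 0
below k (x ∷ W) = ι (x ℕ.<? k) + below k W
above k []      = 0
above k (x ∷ W) = ι (k ℕ.≤? x) + above k W

module Words (ℓ : ℕ) where

  others : List ℕ → ℕ
  others []      = 0
  others (x ∷ W) = if does (x ℕ.≟ ℓ) then others W else suc (others W)

  -- The gaps of a word are the places between those letters that differ
  -- from ℓ; the letter ℓ is inserted at the beginning of gap number a.
  insert : ℕ → List ℕ → List ℕ
  insert zero    W       = ℓ ∷ W
  insert (suc a) []      = []
  insert (suc a) (x ∷ W) = x ∷ (if does (x ℕ.≟ ℓ) then insert (suc a) W else insert a W)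

  -- `end` covers two situations: the last gap is empty, or the word is too short to have a gap
  -- number `a`.
  data EmptyGap : ℕ → List ℕ → Set where
    end  : ∀ {a} → EmptyGap a []
    here : ∀ {x W} → x ≢ ℓ → EmptyGap 0 (x ∷ W)
    skip : ∀ {a x W} → x ≢ ℓ → EmptyGap a W → EmptyGap (suc a) (x ∷ W)
    same : ∀ {a W} → EmptyGap (suc a) W → EmptyGap (suc a) (ℓ ∷ W)

  others≡below+above : ∀ W → others W ≡ below ℓ W + above (suc ℓ) W
  others≡below+above []      = refl
  others≡below+above (x ∷ W) with ℕ.<-cmp x ℓ | others≡below+above W
  ... | tri< x<ℓ x≢ℓ _ | eq
    rewrite if-yes (x ℕ.<? ℓ) {1} {0} x<ℓ | if-no (x ℕ.≟ ℓ) {others W} {suc (others W)} x≢ℓ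
          | if-no (suc ℓ ℕ.≤? x) {1} {0} (ℕ.<-asym x<ℓ) = cong suc eq
  ... | tri≈ x≮ℓ x≡ℓ ℓ≮x | eq
    rewrite if-no (x ℕ.<? ℓ) {1} {0} x≮ℓ | if-yes (x ℕ.≟ ℓ) {others W} {suc (others W)} x≡ℓ
          | if-no (suc ℓ ℕ.≤? x) {1} {0} ℓ≮x = eq
  ... | tri> x≮ℓ x≢ℓ ℓ<x | eq
    rewrite if-no (x ℕ.<? ℓ) {1} {0} x≮ℓ | if-no (x ℕ.≟ ℓ) {others W} {suc (others W)} x≢ℓ
          | if-yes (suc ℓ ℕ.≤? x) {1} {0} ℓ<x = trans (cong suc eq) (sym (ℕ.+-suc _ _))

  above≤others : ∀ W → above (suc ℓ) W ≤ others W
  above≤others W = subst (above (suc ℓ) W ≤_) (sym (others≡below+above W)) (ℕ.m≤n+m _ _)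

  above-insert : ∀ a W → above (suc ℓ) (insert a W) ≡ above (suc ℓ) W
  above-insert zero    W       = cong (_+ above (suc ℓ) W) (if-no (suc ℓ ℕ.≤? ℓ) (ℕ.<-irrefl refl))
  above-insert (suc a) []      = refl
  above-insert (suc a) (x ∷ W) with does (x ℕ.≟ ℓ) | proof (x ℕ.≟ ℓ)
  ... | true  | _ = cong (ι (suc ℓ ℕ.≤? x) +_) (above-insert (suc a) W)
  ... | false | _ = cong (ι (suc ℓ ℕ.≤? x) +_) (above-insert a W)

  above-insert-≤ : ∀ k a W → above k W ≤ above k (insert a W)
  above-insert-≤ k zero    W       = ℕ.m≤n+m _ _
  above-insert-≤ k (suc a) []      = z≤n
  above-insert-≤ k (suc a) (x ∷ W) with does (x ℕ.≟ ℓ) | proof (x ℕ.≟ ℓ)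
  ... | true  | _ = ℕ.+-monoʳ-≤ (ι (k ℕ.≤? x)) (above-insert-≤ k (suc a) W)
  ... | false | _ = ℕ.+-monoʳ-≤ (ι (k ℕ.≤? x)) (above-insert-≤ k a W)

-- Equality of letters after all letters from `ℓ` upwards have been identified to a star.
Similar : ℕ → ℕ → ℕ → Set
Similar ℓ x y = x ≡ y ⊎ (ℓ ≤ x × ℓ ≤ y)

similar-≤ : ∀ {ℓ k x y} → k ≤ ℓ → Similar ℓ x y → k ≤ x → k ≤ y
similar-≤ k≤ℓ (inj₁ refl)      k≤x = k≤x
similar-≤ k≤ℓ (inj₂ (_ , ℓ≤y)) _   = ℕ.≤-trans k≤ℓ ℓ≤y

similar-sym : ∀ {ℓ x y} → Similar ℓ x y → Similar ℓ y x
similar-sym (inj₁ p)       = inj₁ (sym p)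
similar-sym (inj₂ (p , q)) = inj₂ (q , p)

above-similar : ∀ {ℓ k W W′} → k ≤ ℓ → Pointwise (Similar ℓ) W W′ → above k W ≡ above k W′
above-similar k≤ℓ []      = refl
above-similar k≤ℓ (p ∷ P) = cong₂ _+_
  (if-cong (_ ℕ.≤? _) (_ ℕ.≤? _) (similar-≤ k≤ℓ p) (similar-≤ k≤ℓ (similar-sym p)))
  (above-similar k≤ℓ P)

below-similar : ∀ {ℓ k W W′} → k ≤ ℓ → Pointwise (Similar ℓ) W W′ → below k W ≡ below k W′
below-similar k≤ℓ []      = refl
below-similar k≤ℓ (p ∷ P) = cong₂ _+_
  (if-cong (_ ℕ.<? _) (_ ℕ.<? _)
    (λ x<k → ℕ.≰⇒> (ℕ.<⇒≱ x<k ∘ similar-≤ k≤ℓ (similar-sym p)))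
    (λ y<k → ℕ.≰⇒> (ℕ.<⇒≱ y<k ∘ similar-≤ k≤ℓ p)))
  (below-similar k≤ℓ P)

below+above≡length : ∀ k W → below k W + above k W ≡ length W
below+above≡length k []      = refl
below+above≡length k (x ∷ W) with ℕ.≤-<-connex k x
... | inj₁ k≤x rewrite if-no (x ℕ.<? k) {1} {0} (ℕ.≤⇒≯ k≤x) | if-yes (k ℕ.≤? x) {1} {0} k≤x =
  trans (ℕ.+-suc _ _) (cong suc (below+above≡length k W))
... | inj₂ x<k rewrite if-yes (x ℕ.<? k) {1} {0} x<k | if-no (k ℕ.≤? x) {1} {0} (ℕ.<⇒≱ x<k) =
  cong suc (below+above≡length k W)

below-mono : ∀ {j k} W → j ≤ k → below j W ≤ below k W
below-mono         []      j≤k = z≤n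
below-mono {j} {k} (x ∷ W) j≤k with does (x ℕ.<? j) | proof (x ℕ.<? j)
... | true  | ofʸ x<j rewrite if-yes (x ℕ.<? k) {1} {0} (ℕ.<-≤-trans x<j j≤k) = s≤s (below-mono W j≤k)
... | false | _       = ℕ.m≤n⇒m≤o+n (ι (x ℕ.<? k)) (below-mono W j≤k)

above-anti : ∀ {j k} W → j ≤ k → above k W ≤ above j W
above-anti         []      j≤k = z≤n
above-anti {j} {k} (x ∷ W) j≤k with does (k ℕ.≤? x) | proof (k ℕ.≤? x)
... | true  | ofʸ k≤x rewrite if-yes (j ℕ.≤? x) {1} {0} (ℕ.≤-trans j≤k k≤x) = s≤s (above-anti W j≤k)
... | false | _       = ℕ.m≤n⇒m≤o+n (ι (j ℕ.≤? x)) (above-anti W j≤k)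

-- Weighted sums over words

module WeightedWords {A : Set} (_⊕_ _⊗_ : A → A → A) (⊖_ : A → A) (0# 1# : A)
  (isCommutativeRing : IsCommutativeRing _≡_ _⊕_ _⊗_ ⊖_ 0# 1#) where

  open IsCommutativeRing isCommutativeRing
    hiding (refl; sym; trans; setoid; zero)
    renaming (+-assoc to ⊕-assoc; +-comm to ⊕-comm; +-identityˡ to ⊕-identityˡ; +-identityʳ to ⊕-identityʳ
             ; *-assoc to ⊗-assoc; *-comm to ⊗-comm; *-identityˡ to ⊗-identityˡ; *-identityʳ to ⊗-identityʳ)
  open PowerSeries _⊕_ _⊗_ ⊖_ 0# 1# isCommutativeRing
  open import Algebra.Solver.Ring.NaturalCoefficients.Default
    (CommutativeRing.commutativeSemiring coefficientRing)
    using (solve; _:+_; _:*_; _:=_)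
  open ≡-Reasoning

  sumTo : ℕ → (ℕ → A) → A
  sumTo zero    f = 0#
  sumTo (suc k) f = sumTo k f ⊕ f k

  sumWords : ℕ → ℕ → (List ℕ → A) → A
  sumWords k zero    φ = φ []
  sumWords k (suc n) φ = sumTo k λ x → sumWords k n (φ ∘ (x ∷_))

  sumTo-cong : ∀ k {f g} → (∀ {x} → x < k → f x ≡ g x) → sumTo k f ≡ sumTo k g
  sumTo-cong zero    eq = refl
  sumTo-cong (suc k) eq = cong₂ _⊕_ (sumTo-cong k (eq ∘ ℕ.m≤n⇒m≤1+n)) (eq ℕ.≤-refl)

  sumTo-⊕ : ∀ k f g → sumTo k (λ x → f x ⊕ g x) ≡ sumTo k f ⊕ sumTo k g
  sumTo-⊕ zero    f g = sym (⊕-identityˡ 0#)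
  sumTo-⊕ (suc k) f g = trans (cong (_⊕ (f k ⊕ g k)) (sumTo-⊕ k f g))
    (solve 4 (λ a b c d → (a :+ b) :+ (c :+ d) := (a :+ c) :+ (b :+ d)) refl _ _ (f k) (g k))

  sumTo-⊗ : ∀ k a f → sumTo k (λ x → a ⊗ f x) ≡ a ⊗ sumTo k f
  sumTo-⊗ zero    a f = sym (zeroʳ a)
  sumTo-⊗ (suc k) a f = trans (cong (_⊕ (a ⊗ f k)) (sumTo-⊗ k a f)) (sym (distribˡ a _ _))

  sumTo-0 : ∀ k → sumTo k (λ _ → 0#) ≡ 0#
  sumTo-0 zero    = refl
  sumTo-0 (suc k) = trans (⊕-identityʳ _) (sumTo-0 k)

  sumTo-head : ∀ k f → sumTo (suc k) f ≡ f 0 ⊕ sumTo k (f ∘ suc)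
  sumTo-head zero    f = ⊕-comm 0# (f 0)
  sumTo-head (suc k) f = trans (cong (_⊕ f (suc k)) (sumTo-head k f)) (⊕-assoc _ _ _)

  sumWords-cong : ∀ k n {φ ψ} → (∀ W → length W ≡ n → All (_< k) W → φ W ≡ ψ W) →
                  sumWords k n φ ≡ sumWords k n ψ
  sumWords-cong k zero    eq = eq [] refl []
  sumWords-cong k (suc n) eq = sumTo-cong k λ {x} x<k → sumWords-cong k n λ W len W<k →
    eq (x ∷ W) (cong suc len) (x<k ∷ W<k)

  sumWords-≗ : ∀ k n {φ ψ} → (∀ W → φ W ≡ ψ W) → sumWords k n φ ≡ sumWords k n ψ
  sumWords-≗ k n eq = sumWords-cong k n λ W _ _ → eq W

  sumWords-⊕ : ∀ k n φ ψ → sumWords k n (λ W → φ W ⊕ ψ W) ≡ sumWords k n φ ⊕ sumWords k n ψ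
  sumWords-⊕ k zero    φ ψ = refl
  sumWords-⊕ k (suc n) φ ψ = trans (sumTo-cong k λ {x} _ → sumWords-⊕ k n (φ ∘ (x ∷_)) (ψ ∘ (x ∷_)))
    (sumTo-⊕ k _ _)

  sumWords-⊗ : ∀ k n a φ → sumWords k n (λ W → a ⊗ φ W) ≡ a ⊗ sumWords k n φ
  sumWords-⊗ k zero    a φ = refl
  sumWords-⊗ k (suc n) a φ = trans (sumTo-cong k λ {x} _ → sumWords-⊗ k n a (φ ∘ (x ∷_))) (sumTo-⊗ k a _)

  sumWords-0 : ∀ k n → sumWords k n (λ _ → 0#) ≡ 0#
  sumWords-0 k zero    = refl
  sumWords-0 k (suc n) = trans (sumTo-cong k λ _ → sumWords-0 k n) (sumTo-0 k)

  sumWords-sumTo : ∀ k n m (φ : ℕ → List ℕ → A) →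
                   sumWords k n (λ W → sumTo m (λ i → φ i W)) ≡ sumTo m (λ i → sumWords k n (φ i))
  sumWords-sumTo k n zero    φ = sumWords-0 k n
  sumWords-sumTo k n (suc m) φ = trans (sumWords-⊕ k n _ (φ m)) (cong (_⊕ sumWords k n (φ m)) (sumWords-sumTo k n m φ))

  [_] : {P : Set} → Dec P → A
  [ d ] = if does d then 1# else 0#

  sumTo-[≟] : ∀ k {m} → m < k → ∀ (f : ℕ → A) (a : A) → sumTo k (λ i → f i ⊗ ([ m ℕ.≟ i ] ⊗ a)) ≡ f m ⊗ a
  sumTo-[≟] (suc k) {m} m<1+k f a with does (m ℕ.≟ k) | proof (m ℕ.≟ k)
  ... | true  | ofʸ refl = begin
    sumTo k (λ i → f i ⊗ ([ k ℕ.≟ i ] ⊗ a)) ⊕ (f k ⊗ (1# ⊗ a))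
      ≡⟨ cong₂ _⊕_ (trans (sumTo-cong k λ {i} i<k → trans (cong (λ e → f i ⊗ (e ⊗ a))
           (if-no (k ℕ.≟ i) (ℕ.>⇒≢ i<k))) (trans (cong (f i ⊗_) (zeroˡ a)) (zeroʳ (f i)))) (sumTo-0 k))
           (cong (f k ⊗_) (⊗-identityˡ a)) ⟩
    0# ⊕ (f k ⊗ a)
      ≡⟨ ⊕-identityˡ _ ⟩
    f k ⊗ a ∎
  ... | false | ofⁿ m≢k = trans (cong₂ _⊕_ (sumTo-[≟] k (ℕ.≤∧≢⇒< (ℕ.≤-pred m<1+k) m≢k) f a)
      (trans (cong (f k ⊗_) (zeroˡ a)) (zeroʳ (f k)))) (⊕-identityʳ _)

  module TopLetter (ℓ : ℕ) where
    open Words ℓ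

    -- Deleting the first ℓ of a nonempty gap a is inverse to insert a.
    insertion-exchange : ∀ n a (φ ψ : List ℕ → A) →
      (∀ {W} → EmptyGap a W → φ W ≡ ψ W) →
      (∀ {W} → others W < a → φ (insert a W) ≡ ψ (insert a W)) →
      sumWords (2 + ℓ) (suc n) φ ⊕ sumWords (2 + ℓ) n (ψ ∘ insert a) ≡
      sumWords (2 + ℓ) (suc n) ψ ⊕ sumWords (2 + ℓ) n (φ ∘ insert a)
    -- Gap 0 is nonempty iff the word starts with `ℓ`. For the other first letters `φ` and `ψ`
    -- agree, and the two sums over words starting with `ℓ` just change sides.
    insertion-exchange n zero φ ψ empty few = begin
      ((low φ ⊕ mid φ) ⊕ high φ) ⊕ mid ψ
        ≡⟨ cong₂ (λ x y → ((x ⊕ mid φ) ⊕ y) ⊕ mid ψ)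
             (sumTo-cong ℓ λ x<ℓ → sumWords-≗ (2 + ℓ) n λ W → empty (here (ℕ.<⇒≢ x<ℓ)))
             (sumWords-≗ (2 + ℓ) n λ W → empty (here (ℕ.>⇒≢ ℕ.≤-refl))) ⟩
      ((low ψ ⊕ mid φ) ⊕ high ψ) ⊕ mid ψ
        ≡⟨ solve 4 (λ a b c d → ((a :+ b) :+ c) :+ d := ((a :+ d) :+ c) :+ b) refl _ _ _ _ ⟩
      ((low ψ ⊕ mid ψ) ⊕ high ψ) ⊕ mid φ ∎
      where
      low mid high : (List ℕ → A) → A
      low  χ = sumTo ℓ λ x → sumWords (2 + ℓ) n (χ ∘ (x ∷_))
      mid  χ = sumWords (2 + ℓ) n (χ ∘ (ℓ ∷_))
      high χ = sumWords (2 + ℓ) n (χ ∘ (suc ℓ ∷_))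
    -- In a word of one letter, gap `suc a` is empty or absent. `insert (suc a)` leaves the empty
    -- word as it is, so `few` covers that term.
    insertion-exchange zero (suc a) φ ψ empty few =
      cong₂ _⊕_ (sumTo-cong (2 + ℓ) λ {x} _ → empty (emptyGap-[ x ])) (sym (few (s≤s z≤n)))
      where
      emptyGap-[_] : ∀ x → EmptyGap (suc a) (x ∷ [])
      emptyGap-[ x ] with x ℕ.≟ ℓ
      ... | yes refl = same end
      ... | no  x≢ℓ  = skip x≢ℓ end
    insertion-exchange (suc n) (suc a) φ ψ empty few = begin
      sumTo (2 + ℓ) (inner (suc n) φ) ⊕ sumTo (2 + ℓ) (inner n (ψ ∘ insert (suc a)))
        ≡⟨ sumTo-⊕ (2 + ℓ) _ _ ⟨
      sumTo (2 + ℓ) (λ x → inner (suc n) φ x ⊕ inner n (ψ ∘ insert (suc a)) x)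
        ≡⟨ sumTo-cong (2 + ℓ) (λ {x} _ → step x) ⟩
      sumTo (2 + ℓ) (λ x → inner (suc n) ψ x ⊕ inner n (φ ∘ insert (suc a)) x)
        ≡⟨ sumTo-⊕ (2 + ℓ) _ _ ⟩
      sumTo (2 + ℓ) (inner (suc n) ψ) ⊕ sumTo (2 + ℓ) (inner n (φ ∘ insert (suc a))) ∎
      where
      inner : ℕ → (List ℕ → A) → ℕ → A
      inner n χ x = sumWords (2 + ℓ) n (χ ∘ (x ∷_))
      step : ∀ x → inner (suc n) φ x ⊕ inner n (ψ ∘ insert (suc a)) x ≡
                   inner (suc n) ψ x ⊕ inner n (φ ∘ insert (suc a)) x
      step x with x ℕ.≟ ℓ
      ... | yes refl = begin
        inner (suc n) φ ℓ ⊕ inner n (ψ ∘ insert (suc a)) ℓ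
          ≡⟨ cong (inner (suc n) φ ℓ ⊕_) (sumWords-≗ (2 + ℓ) n λ W → cong (ψ ∘ (ℓ ∷_)) (if-yes (ℓ ℕ.≟ ℓ) refl)) ⟩
        inner (suc n) φ ℓ ⊕ sumWords (2 + ℓ) n (ψ ∘ (ℓ ∷_) ∘ insert (suc a))
          ≡⟨ insertion-exchange n (suc a) (φ ∘ (ℓ ∷_)) (ψ ∘ (ℓ ∷_)) (empty ∘ same) (λ {W} p →
               trans (cong (φ ∘ (ℓ ∷_)) (sym (if-yes (ℓ ℕ.≟ ℓ) refl)))
                 (trans (few {ℓ ∷ W} (subst (_< suc a) (sym (if-yes (ℓ ℕ.≟ ℓ) refl)) p))
                   (cong (ψ ∘ (ℓ ∷_)) (if-yes (ℓ ℕ.≟ ℓ) refl)))) ⟩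
        inner (suc n) ψ ℓ ⊕ sumWords (2 + ℓ) n (φ ∘ (ℓ ∷_) ∘ insert (suc a))
          ≡⟨ cong (inner (suc n) ψ ℓ ⊕_) (sumWords-≗ (2 + ℓ) n λ W → cong (φ ∘ (ℓ ∷_)) (if-yes (ℓ ℕ.≟ ℓ) refl)) ⟨
        inner (suc n) ψ ℓ ⊕ inner n (φ ∘ insert (suc a)) ℓ ∎
      ... | no x≢ℓ = begin
        inner (suc n) φ x ⊕ inner n (ψ ∘ insert (suc a)) x
          ≡⟨ cong (inner (suc n) φ x ⊕_) (sumWords-≗ (2 + ℓ) n λ W → cong (ψ ∘ (x ∷_)) (if-no (x ℕ.≟ ℓ) x≢ℓ)) ⟩
        inner (suc n) φ x ⊕ sumWords (2 + ℓ) n (ψ ∘ (x ∷_) ∘ insert a)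
          ≡⟨ insertion-exchange n a (φ ∘ (x ∷_)) (ψ ∘ (x ∷_)) (empty ∘ skip x≢ℓ) (λ {W} p →
               trans (cong (φ ∘ (x ∷_)) (sym (if-no (x ℕ.≟ ℓ) x≢ℓ)))
                 (trans (few {x ∷ W} (subst (_< suc a) (sym (if-no (x ℕ.≟ ℓ) x≢ℓ)) (s≤s p)))
                   (cong (ψ ∘ (x ∷_)) (if-no (x ℕ.≟ ℓ) x≢ℓ)))) ⟩
        inner (suc n) ψ x ⊕ sumWords (2 + ℓ) n (φ ∘ (x ∷_) ∘ insert a)
          ≡⟨ cong (inner (suc n) ψ x ⊕_) (sumWords-≗ (2 + ℓ) n λ W → cong (φ ∘ (x ∷_)) (if-no (x ℕ.≟ ℓ) x≢ℓ)) ⟨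
        inner (suc n) ψ x ⊕ inner n (φ ∘ insert (suc a)) x ∎

-- Excedance weights of words with stars

module ExcedanceWeights {A : Set} (_⊕_ _⊗_ : A → A → A) (⊖_ : A → A) (0# 1# : A)
  (isCommutativeRing : IsCommutativeRing _≡_ _⊕_ _⊗_ ⊖_ 0# 1#) (α β : ℕ → A) where

  open IsCommutativeRing isCommutativeRing
    hiding (refl; sym; trans; setoid; zero)
    renaming (+-assoc to ⊕-assoc; +-comm to ⊕-comm; +-identityˡ to ⊕-identityˡ; +-identityʳ to ⊕-identityʳ
             ; *-assoc to ⊗-assoc; *-comm to ⊗-comm; *-identityˡ to ⊗-identityˡ; *-identityʳ to ⊗-identityʳ)
  open PowerSeries _⊕_ _⊗_ ⊖_ 0# 1# isCommutativeRing
  open WeightedWords _⊕_ _⊗_ ⊖_ 0# 1# isCommutativeRing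
  open import Algebra.Solver.Ring.NaturalCoefficients.Default
    (CommutativeRing.commutativeSemiring coefficientRing)
    using (solve; _:+_; _:*_; _:=_)
  open ≡-Reasoning

  -- Letters ≥ ℓ are stars. Here i counts the smaller letters to the left of x
  -- and j the larger letters to its right; x is an excedance iff j < i.
  letterWeight : (ℓ x i j : ℕ) → A
  letterWeight ℓ x i j = if does (x ℕ.<? ℓ) then (if does (j ℕ.<? i) then α x else β x) else 1#

  weight : ℕ → List ℕ → List ℕ → A
  weight ℓ L []      = 1#
  weight ℓ L (x ∷ R) = letterWeight ℓ x (below x L) (above (suc x) R) ⊗ weight ℓ (x ∷ L) R

  -- Stars weigh 1, and a letter below `ℓ` compares in the same way with every star.
  weight-similar : ∀ {ℓ L L′ R R′} → Pointwise (Similar ℓ) L L′ → Pointwise (Similar ℓ) R R′ →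
                   weight ℓ L R ≡ weight ℓ L′ R′
  weight-similar L~ []      = refl
  weight-similar {ℓ} {L} {L′} {x ∷ R} {y ∷ R′} L~ (p ∷ R~) =
    cong₂ _⊗_ (letter p) (weight-similar (p ∷ L~) R~)
    where
    letter : Similar ℓ x y → letterWeight ℓ x (below x L) (above (suc x) R) ≡
                             letterWeight ℓ y (below y L′) (above (suc y) R′)
    letter (inj₂ (ℓ≤x , ℓ≤y)) =
      trans (if-no (x ℕ.<? ℓ) (ℕ.≤⇒≯ ℓ≤x)) (sym (if-no (y ℕ.<? ℓ) (ℕ.≤⇒≯ ℓ≤y)))
    letter (inj₁ refl) with does (x ℕ.<? ℓ) | proof (x ℕ.<? ℓ)
    ... | false | _       = refl
    ... | true  | ofʸ x<ℓ = cong₂ (λ i j → if does (j ℕ.<? i) then α x else β x)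
      (below-similar (ℕ.<⇒≤ x<ℓ) L~) (above-similar x<ℓ R~)

  weight-congˡ : ∀ {ℓ} L L′ R → (∀ {x} → x < ℓ → below x L ≡ below x L′) → weight ℓ L R ≡ weight ℓ L′ R
  weight-congˡ     L L′ []      eq = refl
  weight-congˡ {ℓ} L L′ (x ∷ R) eq = cong₂ _⊗_ letter
    (weight-congˡ (x ∷ L) (x ∷ L′) R (λ {y} y<ℓ → cong (ι (x ℕ.<? y) +_) (eq y<ℓ)))
    where
    letter : letterWeight ℓ x (below x L) (above (suc x) R) ≡ letterWeight ℓ x (below x L′) (above (suc x) R)
    letter with does (x ℕ.<? ℓ) | proof (x ℕ.<? ℓ)
    ... | false | _       = refl
    ... | true  | ofʸ x<ℓ = cong (λ i → if does (above (suc x) R ℕ.<? i) then α x else β x) (eq x<ℓ)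

  -- The letter `ℓ` stands for all stars, hence the alphabet of `suc ℓ` letters; `v` is the number
  -- of stars and `n` the exponent of u.
  Ω : ℕ → ℕ → Ser
  Ω ℓ v n = sumWords (suc ℓ) n λ W → [ above ℓ W ℕ.≟ v ] ⊗ weight ℓ [] W

  module TopLetterWeights (ℓ : ℕ) where
    open Words ℓ
    open TopLetter ℓ

    κ : ℕ → A
    κ zero    = α ℓ
    κ (suc _) = β ℓ

    -- The joint weight of the letters `ℓ` when those in the first `a` gaps weigh `β ℓ` and the
    -- others `α ℓ`. The argument of `κ` is the number of `β`-gaps left, the current one included.
    phase : ℕ → List ℕ → A
    phase a []      = 1#
    phase a (x ∷ W) = if does (x ℕ.≟ ℓ) then κ a ⊗ phase a W else phase (ℕ.pred a) W

    phase-emptyGap : ∀ {a W} → EmptyGap a W → phase (suc a) W ≡ phase a W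
    phase-emptyGap end = refl
    phase-emptyGap {W = x ∷ W} (here x≢ℓ) = trans (if-no (x ℕ.≟ ℓ) x≢ℓ) (sym (if-no (x ℕ.≟ ℓ) x≢ℓ))
    phase-emptyGap {W = x ∷ W} (skip x≢ℓ e) =
      trans (if-no (x ℕ.≟ ℓ) x≢ℓ) (trans (phase-emptyGap e) (sym (if-no (x ℕ.≟ ℓ) x≢ℓ)))
    phase-emptyGap {W = x ∷ W} (same e) =
      trans (if-yes (x ℕ.≟ ℓ) refl) (trans (cong (β ℓ ⊗_) (phase-emptyGap e)) (sym (if-yes (x ℕ.≟ ℓ) refl)))

    phase-insert : ∀ a b W → a ≤ others W → phase (a + b) (insert a W) ≡ κ b ⊗ phase (a + b) W
    phase-insert zero    b W       a≤ = if-yes (ℓ ℕ.≟ ℓ) refl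
    phase-insert (suc a) b (x ∷ W) a≤ with does (x ℕ.≟ ℓ)
    ... | true  = trans (cong (β ℓ ⊗_) (phase-insert (suc a) b W a≤))
      (solve 3 (λ x y z → x :* (y :* z) := y :* (x :* z)) refl (β ℓ) (κ b) _)
    ... | false = phase-insert a b W (ℕ.≤-pred a≤)

    -- If a star is inserted behind at most as many letters as there are stars,
    -- then the letters to its left are no excedances before and after, and
    -- those to its right keep their status.
    weight-insert : ∀ a L W → length L + (a + (above ℓ W ∸ above (suc ℓ) W)) ≤ above ℓ L + above ℓ W →
                    weight ℓ L (insert a W) ≡ weight ℓ L W
    weight-insert zero L W _ = trans (cong₂ _⊗_ (if-no (ℓ ℕ.<? ℓ) (ℕ.<-irrefl refl))
      (weight-congˡ (ℓ ∷ L) L W λ {x} x<ℓ → cong (_+ below x L) (if-no (ℓ ℕ.<? x) (ℕ.<-asym x<ℓ))))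
      (⊗-identityˡ _)
    weight-insert (suc a) L []      _ = refl
    weight-insert (suc a) L (x ∷ W) h with x ℕ.≟ ℓ
    ... | yes x≡ℓ = trans
      (cong (weight ℓ L ∘ (x ∷_)) (if-yes (x ℕ.≟ ℓ) x≡ℓ))
      (cong₂ _⊗_ (trans (if-no (x ℕ.<? ℓ) x≮ℓ) (sym (if-no (x ℕ.<? ℓ) x≮ℓ)))
        (weight-insert (suc a) (x ∷ L) W h′))
      where
      x≮ℓ : ¬ x < ℓ
      x≮ℓ = ℕ.<-irrefl x≡ℓ
      ι₁ : ι (ℓ ℕ.≤? x) ≡ 1
      ι₁ = if-yes (ℓ ℕ.≤? x) (ℕ.≤-reflexive (sym x≡ℓ))
      h″ : length L + (suc a + (suc (above ℓ W) ∸ above (suc ℓ) W)) ≤ above ℓ L + suc (above ℓ W)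
      h″ = subst₂ (λ i j → length L + (suc a + ((i + above ℓ W) ∸ (j + above (suc ℓ) W))) ≤ above ℓ L + (i + above ℓ W))
        ι₁ (if-no (suc ℓ ℕ.≤? x) (ℕ.<-irrefl (sym x≡ℓ))) h
      h′ : suc (length L) + (suc a + (above ℓ W ∸ above (suc ℓ) W)) ≤ above ℓ (x ∷ L) + above ℓ W
      h′ = subst₂ _≤_
        (trans (cong (λ i → length L + (suc a + i)) (ℕ.+-∸-assoc 1 (above-anti W (ℕ.n≤1+n ℓ))))
          (trans (cong (length L +_) (ℕ.+-suc (suc a) _)) (ℕ.+-suc (length L) _)))
        (trans (ℕ.+-suc _ _) (cong (λ i → i + above ℓ L + above ℓ W) (sym ι₁))) h″
    ... | no x≢ℓ = trans
      (cong (weight ℓ L ∘ (x ∷_)) (if-no (x ℕ.≟ ℓ) x≢ℓ))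
      (cong₂ _⊗_ letter (weight-insert a (x ∷ L) W h′))
      where
      i : ℕ
      i = ι (ℓ ℕ.≤? x)
      h″ : length L + (suc a + (above ℓ W ∸ above (suc ℓ) W)) ≤ above ℓ L + (i + above ℓ W)
      h″ = subst (λ d → length L + (suc a + d) ≤ above ℓ L + (i + above ℓ W))
        (trans (cong (λ j → i + above ℓ W ∸ (j + above (suc ℓ) W))
            (if-cong (suc ℓ ℕ.≤? x) (ℓ ℕ.≤? x) ℕ.<⇒≤ (λ ℓ≤x → ℕ.≤∧≢⇒< ℓ≤x (x≢ℓ ∘ sym))))
          (ℕ.[m+n]∸[m+o]≡n∸o i (above ℓ W) _)) h
      h′ : suc (length L) + (a + (above ℓ W ∸ above (suc ℓ) W)) ≤ above ℓ (x ∷ L) + above ℓ W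
      h′ = subst₂ _≤_ (ℕ.+-suc _ _)
        (trans (sym (ℕ.+-assoc (above ℓ L) i _)) (cong (_+ above ℓ W) (ℕ.+-comm (above ℓ L) i))) h″
      letter : letterWeight ℓ x (below x L) (above (suc x) (insert a W)) ≡ letterWeight ℓ x (below x L) (above (suc x) W)
      letter with x ℕ.<? ℓ
      ... | no  x≮ℓ = trans (if-no (x ℕ.<? ℓ) x≮ℓ) (sym (if-no (x ℕ.<? ℓ) x≮ℓ))
      ... | yes x<ℓ = trans (nonexceeding (insert a W) (above-insert-≤ (suc x) a W)) (sym (nonexceeding W ℕ.≤-refl))
        where
        few : below x L ≤ above (suc x) W
        few = ℕ.≤-trans (below-mono L (ℕ.<⇒≤ x<ℓ)) (ℕ.≤-trans
          (ℕ.+-cancelʳ-≤ (above ℓ L) _ _ (ℕ.≤-trans (ℕ.≤-reflexive (below+above≡length ℓ L))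
            (ℕ.≤-trans (ℕ.m≤m+n _ _) (ℕ.≤-trans h″ (ℕ.≤-reflexive (trans
              (cong (λ j → above ℓ L + (j + above ℓ W)) (if-no (ℓ ℕ.≤? x) (ℕ.<⇒≱ x<ℓ))) (ℕ.+-comm (above ℓ L) _)))))))
          (above-anti W x<ℓ))
        nonexceeding : ∀ R → above (suc x) W ≤ above (suc x) R → letterWeight ℓ x (below x L) (above (suc x) R) ≡ β x
        nonexceeding R W≤R = trans (if-yes (x ℕ.<? ℓ) x<ℓ)
          (if-no (above (suc x) R ℕ.<? below x L) (ℕ.≤⇒≯ (ℕ.≤-trans few W≤R)))

    -- Let v be the number of letters above `ℓ` in the whole word. An `ℓ` preceded by g other
    -- letters, i of them smaller, is followed by v - (g - i) larger ones; it is an excedance iff v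
    -- - (g - i) < i, that is v < g. So the gaps 0, ..., v weigh `β ℓ`, and `others L` of them have
    -- been passed when `W` begins.
    weight-phase : ∀ L W → weight (suc ℓ) L W ≡
                   phase (suc (above (suc ℓ) L + above (suc ℓ) W) ∸ others L) W ⊗ weight ℓ L W
    weight-phase L []      = sym (⊗-identityˡ 1#)
    weight-phase L (x ∷ W) with x ℕ.≟ ℓ | weight-phase (x ∷ L) W
    ... | no x≢ℓ | ih = begin
      letterWeight (suc ℓ) x i j ⊗ weight (suc ℓ) (x ∷ L) W
        ≡⟨ cong₂ _⊗_ (if-cong (x ℕ.<? suc ℓ) (x ℕ.<? ℓ) (λ p → ℕ.≤∧≢⇒< (ℕ.≤-pred p) x≢ℓ) ℕ.m≤n⇒m≤1+n) ih ⟩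
      letterWeight ℓ x i j ⊗ (phase (suc (above (suc ℓ) (x ∷ L) + above (suc ℓ) W) ∸ others (x ∷ L)) W ⊗ weight ℓ (x ∷ L) W)
        ≡⟨ solve 3 (λ x y z → x :* (y :* z) := y :* (x :* z)) refl _ _ _ ⟩
      phase (suc (above (suc ℓ) (x ∷ L) + above (suc ℓ) W) ∸ others (x ∷ L)) W ⊗ weight ℓ L (x ∷ W)
        ≡⟨ cong (_⊗ weight ℓ L (x ∷ W)) (trans (cong (λ a → phase a W) count) (sym (if-no (x ℕ.≟ ℓ) x≢ℓ))) ⟩
      phase (suc (above (suc ℓ) L + above (suc ℓ) (x ∷ W)) ∸ others L) (x ∷ W) ⊗ weight ℓ L (x ∷ W) ∎
      where
      i j k : ℕ
      i = below x L
      j = above (suc x) W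
      k = ι (suc ℓ ℕ.≤? x)
      count : suc (above (suc ℓ) (x ∷ L) + above (suc ℓ) W) ∸ others (x ∷ L) ≡
              ℕ.pred (suc (above (suc ℓ) L + above (suc ℓ) (x ∷ W)) ∸ others L)
      count = trans (cong₂ (λ a o → suc a ∸ o)
          (trans (cong (_+ above (suc ℓ) W) (ℕ.+-comm k _)) (ℕ.+-assoc (above (suc ℓ) L) k _)) (if-no (x ℕ.≟ ℓ) x≢ℓ))
        (sym (ℕ.pred[m∸n]≡m∸[1+n] (suc (above (suc ℓ) L + above (suc ℓ) (x ∷ W))) (others L)))
    ... | yes refl | ih = begin
      letterWeight (suc ℓ) ℓ i j ⊗ weight (suc ℓ) (ℓ ∷ L) W
        ≡⟨ cong₂ _⊗_ (trans (if-yes (ℓ ℕ.<? suc ℓ) ℕ.≤-refl) status) ih ⟩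
      κ a ⊗ (phase (suc (above (suc ℓ) (ℓ ∷ L) + above (suc ℓ) W) ∸ others (ℓ ∷ L)) W ⊗ weight ℓ (ℓ ∷ L) W)
        ≡⟨ cong (λ b → κ a ⊗ (phase b W ⊗ weight ℓ (ℓ ∷ L) W)) count ⟩
      κ a ⊗ (phase a W ⊗ weight ℓ (ℓ ∷ L) W)
        ≡⟨ ⊗-assoc _ _ _ ⟨
      (κ a ⊗ phase a W) ⊗ weight ℓ (ℓ ∷ L) W
        ≡⟨ cong₂ _⊗_ (trans (cong (λ b → κ b ⊗ phase b W) count′) (sym (if-yes (ℓ ℕ.≟ ℓ) refl)))
             (trans (sym (⊗-identityˡ _)) (cong (_⊗ weight ℓ (ℓ ∷ L) W) (sym (if-no (ℓ ℕ.<? ℓ) ℓ≮ℓ)))) ⟩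
      phase (suc (above (suc ℓ) L + above (suc ℓ) (ℓ ∷ W)) ∸ others L) (ℓ ∷ W) ⊗ weight ℓ L (ℓ ∷ W) ∎
      where
      ℓ≮ℓ : ¬ ℓ < ℓ
      ℓ≮ℓ = ℕ.<-irrefl refl
      i j a : ℕ
      i = below ℓ L
      j = above (suc ℓ) W
      a = suc (above (suc ℓ) L + j) ∸ others L
      count : suc (above (suc ℓ) (ℓ ∷ L) + above (suc ℓ) W) ∸ others (ℓ ∷ L) ≡ a
      count = cong₂ (λ x y → suc (x + above (suc ℓ) L + j) ∸ y) (if-no (suc ℓ ℕ.≤? ℓ) ℓ≮ℓ) (if-yes (ℓ ℕ.≟ ℓ) refl)
      count′ : a ≡ suc (above (suc ℓ) L + above (suc ℓ) (ℓ ∷ W)) ∸ others L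
      count′ = cong (λ x → suc (above (suc ℓ) L + (x + j)) ∸ others L) (sym (if-no (suc ℓ ℕ.≤? ℓ) ℓ≮ℓ))
      a≡ : a ≡ suc j ∸ i
      a≡ = begin
        suc (above (suc ℓ) L + j) ∸ others L       ≡⟨ cong₂ _∸_ (sym (ℕ.+-suc (above (suc ℓ) L) j))
                                                       (trans (others≡below+above L) (ℕ.+-comm i _)) ⟩
        above (suc ℓ) L + suc j ∸ (above (suc ℓ) L + i)  ≡⟨ ℕ.[m+n]∸[m+o]≡n∸o (above (suc ℓ) L) (suc j) i ⟩
        suc j ∸ i                                  ∎
      status : (if does (j ℕ.<? i) then α ℓ else β ℓ) ≡ κ a
      status rewrite a≡ with ℕ.≤-<-connex i j
      ... | inj₁ i≤j = trans (if-no (j ℕ.<? i) (ℕ.≤⇒≯ i≤j)) (cong κ (sym (ℕ.+-∸-assoc 1 i≤j)))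
      ... | inj₂ j<i = trans (if-yes (j ℕ.<? i) j<i) (cong κ (sym (ℕ.m≤n⇒m∸n≡0 j<i)))

-- Elimination of the largest letter below the stars

module LetterElimination {A : Set} (_⊕_ _⊗_ : A → A → A) (⊖_ : A → A) (0# 1# : A)
  (isCommutativeRing : IsCommutativeRing _≡_ _⊕_ _⊗_ ⊖_ 0# 1#) (α β : ℕ → A) (ℓ : ℕ) where

  open IsCommutativeRing isCommutativeRing
    hiding (refl; sym; trans; setoid; zero)
    renaming (+-assoc to ⊕-assoc; +-comm to ⊕-comm; +-identityˡ to ⊕-identityˡ; +-identityʳ to ⊕-identityʳ
             ; *-assoc to ⊗-assoc; *-comm to ⊗-comm; *-identityˡ to ⊗-identityˡ; *-identityʳ to ⊗-identityʳ)
  open PowerSeries _⊕_ _⊗_ ⊖_ 0# 1# isCommutativeRing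
  open WeightedWords _⊕_ _⊗_ ⊖_ 0# 1# isCommutativeRing
  open ExcedanceWeights _⊕_ _⊗_ ⊖_ 0# 1# isCommutativeRing α β
  open Words ℓ
  open TopLetter ℓ
  open TopLetterWeights ℓ
  open import Algebra.Solver.Ring.NaturalCoefficients.Default
    (CommutativeRing.commutativeSemiring coefficientRing)
    using (solve; _:+_; _:*_; _:=_)
  open ≡-Reasoning

  -- Interpolates between words with all letters ℓ weighted by α (a = 0) and
  -- Ω (suc ℓ) v (a = v + 1): in the first a gaps the letter ℓ has weight β.
  S : ℕ → ℕ → Ser
  S a v n = sumWords (2 + ℓ) n λ W → [ above (suc ℓ) W ℕ.≟ v ] ⊗ (phase a W ⊗ weight ℓ [] W)

  -- The two weightings differ only in gap `a`, where one more `ℓ` costs `α ℓ` in `S a` and `β ℓ` in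
  -- `S (suc a)`. As series: (1 - βu) S (a + 1) = (1 - αu) S a. The bound on `a` is the one under
  -- which `weight-insert` applies.
  S-suc : ∀ {a v} n → a ≤ v → S (suc a) v (suc n) ⊕ (α ℓ ⊗ S a v n) ≡ S a v (suc n) ⊕ (β ℓ ⊗ S (suc a) v n)
  S-suc {a} {v} n a≤v = begin
    S (suc a) v (suc n) ⊕ (α ℓ ⊗ S a v n)
      ≡⟨ cong (S (suc a) v (suc n) ⊕_) (inserted 0 a (ℕ.+-identityʳ a) refl) ⟨
    S (suc a) v (suc n) ⊕ sumWords (2 + ℓ) n (term a ∘ insert a)
      ≡⟨ insertion-exchange n a (term (suc a)) (term a)
           (λ {W} e → cong (λ p → [ above (suc ℓ) W ℕ.≟ v ] ⊗ (p ⊗ weight ℓ [] W)) (phase-emptyGap e))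
           -- With fewer than `a` letters other than `ℓ`, and `a ≤ v`, there cannot be `v` larger
           -- ones, so both terms vanish.
           (λ {W} few → let absent = other-count {insert a W} (subst (_≢ v) (sym (above-insert a W))
                                       (ℕ.<⇒≢ (ℕ.≤-<-trans (above≤others W) (ℕ.<-≤-trans few a≤v))))
                        in trans (absent (suc a)) (sym (absent a))) ⟩
    S a v (suc n) ⊕ sumWords (2 + ℓ) n (term (suc a) ∘ insert a)
      ≡⟨ cong (S a v (suc n) ⊕_) (inserted 1 (suc a) (ℕ.+-comm a 1) refl) ⟩
    S a v (suc n) ⊕ (β ℓ ⊗ S (suc a) v n) ∎
    where
    term : ℕ → List ℕ → A
    term b W = [ above (suc ℓ) W ℕ.≟ v ] ⊗ (phase b W ⊗ weight ℓ [] W)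
    other-count : ∀ {W} → above (suc ℓ) W ≢ v → ∀ b → term b W ≡ 0#
    other-count {W} ≢v b = trans (cong (_⊗ (phase b W ⊗ weight ℓ [] W)) (if-no (above (suc ℓ) W ℕ.≟ v) ≢v)) (zeroˡ _)
    inserted : ∀ b c {k} → a + b ≡ c → κ b ≡ k →
               sumWords (2 + ℓ) n (term c ∘ insert a) ≡ k ⊗ S c v n
    inserted b c refl refl = trans (sumWords-≗ (2 + ℓ) n pointwise) (sumWords-⊗ (2 + ℓ) n (κ b) (term (a + b)))
      where
      pointwise : ∀ W → term (a + b) (insert a W) ≡ κ b ⊗ term (a + b) W
      pointwise W with above (suc ℓ) W ℕ.≟ v
      ... | no ≢v = trans (other-count {insert a W} (subst (_≢ v) (sym (above-insert a W)) ≢v) (a + b))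
                      (sym (trans (cong (κ b ⊗_) (other-count {W} ≢v (a + b))) (zeroʳ (κ b))))
      ... | yes refl = begin
        [ above (suc ℓ) (insert a W) ℕ.≟ v ] ⊗ (phase (a + b) (insert a W) ⊗ weight ℓ [] (insert a W))
          ≡⟨ cong₂ _⊗_ (cong (λ m → [ m ℕ.≟ v ]) (above-insert a W))
               (cong₂ _⊗_ (phase-insert a b W (ℕ.≤-trans a≤v (above≤others W)))
                 (weight-insert a [] W (ℕ.≤-trans (ℕ.+-monoˡ-≤ _ a≤v)
                   (ℕ.≤-reflexive (ℕ.m+[n∸m]≡n (above-anti W (ℕ.n≤1+n ℓ))))))) ⟩
        [ v ℕ.≟ v ] ⊗ ((κ b ⊗ phase (a + b) W) ⊗ weight ℓ [] W)
          ≡⟨ solve 4 (λ i k p w → i :* ((k :* p) :* w) := k :* (i :* (p :* w))) refl [ v ℕ.≟ v ] (κ b) _ _ ⟩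
        κ b ⊗ term (a + b) W ∎

  Ω-suc≡S : ∀ v n → Ω (suc ℓ) v n ≡ S (suc v) v n
  Ω-suc≡S v n = sumWords-≗ (2 + ℓ) n pointwise
    where
    pointwise : ∀ W → [ above (suc ℓ) W ℕ.≟ v ] ⊗ weight (suc ℓ) [] W ≡
                      [ above (suc ℓ) W ℕ.≟ v ] ⊗ (phase (suc v) W ⊗ weight ℓ [] W)
    pointwise W with above (suc ℓ) W ℕ.≟ v
    ... | yes refl = cong ([ v ℕ.≟ v ] ⊗_) (weight-phase [] W)
    ... | no  ≢v   = trans (absent _) (sym (absent _))
      where
      absent : ∀ a → [ above (suc ℓ) W ℕ.≟ v ] ⊗ a ≡ 0#
      absent a = trans (cong (_⊗ a) (if-no (above (suc ℓ) W ℕ.≟ v) ≢v)) (zeroˡ a)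

  -- C(k, v) αᵏ⁻ᵛ, the ways of turning all but v of k letters into the letter ℓ.
  T : ℕ → ℕ → A
  T zero    zero    = 1#
  T zero    (suc v) = 0#
  T (suc k) zero    = α ℓ ⊗ T k zero
  T (suc k) (suc v) = (α ℓ ⊗ T k (suc v)) ⊕ T k v

  -- In phase 0 every `ℓ` weighs `α ℓ`, and `φ` does not distinguish `ℓ` from `suc ℓ`. A word with k
  -- stars then comes from C(k, v) words with `v` of its stars equal to `suc ℓ`, each carrying k - v
  -- factors `α ℓ`. A general `φ` is needed because the induction moves the first letter into it.
  merge-top : ∀ n v (φ : List ℕ → A) → (∀ {W W′} → Pointwise (Similar ℓ) W W′ → φ W ≡ φ W′) →
    sumWords (2 + ℓ) n (λ W → [ above (suc ℓ) W ℕ.≟ v ] ⊗ (phase 0 W ⊗ φ W)) ≡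
    sumWords (1 + ℓ) n (λ W → T (above ℓ W) v ⊗ φ W)
  merge-top zero zero    φ φ~ = cong (1# ⊗_) (⊗-identityˡ (φ []))
  merge-top zero (suc v) φ φ~ = trans (zeroˡ _) (sym (zeroˡ (φ [])))
  merge-top (suc n) v    φ φ~ = begin
    (sumTo ℓ row ⊕ row ℓ) ⊕ row (suc ℓ)
      ≡⟨ cong₂ _⊕_ (cong₂ _⊕_ (sumTo-cong ℓ low) mid) (high v) ⟩
    (sumTo ℓ row′ ⊕ (α ℓ ⊗ below-top v)) ⊕ rest v
      ≡⟨ ⊕-assoc _ _ _ ⟩
    sumTo ℓ row′ ⊕ ((α ℓ ⊗ below-top v) ⊕ rest v)
      ≡⟨ cong (sumTo ℓ row′ ⊕_) (top v) ⟩
    sumTo ℓ row′ ⊕ row′ ℓ ∎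
    where
    row row′ : ℕ → A
    row  x = sumWords (2 + ℓ) n λ W → [ above (suc ℓ) (x ∷ W) ℕ.≟ v ] ⊗ (phase 0 (x ∷ W) ⊗ φ (x ∷ W))
    row′ x = sumWords (1 + ℓ) n λ W → T (above ℓ (x ∷ W)) v ⊗ φ (x ∷ W)
    below-top rest : ℕ → A
    below-top v = sumWords (1 + ℓ) n λ W → T (above ℓ W) v ⊗ φ (ℓ ∷ W)
    rest zero    = 0#
    rest (suc v) = below-top v
    low : ∀ {x} → x < ℓ → row x ≡ row′ x
    low {x} x<ℓ = begin
      row x
        ≡⟨ sumWords-≗ (2 + ℓ) n (λ W → cong₂ (λ k p → [ k ℕ.≟ v ] ⊗ (p ⊗ φ (x ∷ W)))
             (cong (_+ above (suc ℓ) W) (if-no (suc ℓ ℕ.≤? x) (ℕ.<-asym x<ℓ)))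
             (if-no (x ℕ.≟ ℓ) (ℕ.<⇒≢ x<ℓ))) ⟩
      sumWords (2 + ℓ) n (λ W → [ above (suc ℓ) W ℕ.≟ v ] ⊗ (phase 0 W ⊗ φ (x ∷ W)))
        ≡⟨ merge-top n v (φ ∘ (x ∷_)) (λ p → φ~ (inj₁ refl ∷ p)) ⟩
      sumWords (1 + ℓ) n (λ W → T (above ℓ W) v ⊗ φ (x ∷ W))
        ≡⟨ sumWords-≗ (1 + ℓ) n (λ W → cong (λ k → T (k + above ℓ W) v ⊗ φ (x ∷ W)) (if-no (ℓ ℕ.≤? x) (ℕ.<⇒≱ x<ℓ))) ⟨
      row′ x ∎
    mid : row ℓ ≡ α ℓ ⊗ below-top v
    mid = begin
      row ℓ
        ≡⟨ sumWords-≗ (2 + ℓ) n (λ W → trans (cong₂ (λ k p → [ k ℕ.≟ v ] ⊗ (p ⊗ φ (ℓ ∷ W)))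
             (cong (_+ above (suc ℓ) W) (if-no (suc ℓ ℕ.≤? ℓ) (ℕ.<-irrefl refl)))
             (if-yes (ℓ ℕ.≟ ℓ) refl))
             (solve 4 (λ i a p f → i :* ((a :* p) :* f) := a :* (i :* (p :* f))) refl
               [ above (suc ℓ) W ℕ.≟ v ] (α ℓ) (phase 0 W) (φ (ℓ ∷ W)))) ⟩
      sumWords (2 + ℓ) n (λ W → α ℓ ⊗ ([ above (suc ℓ) W ℕ.≟ v ] ⊗ (phase 0 W ⊗ φ (ℓ ∷ W))))
        ≡⟨ sumWords-⊗ (2 + ℓ) n (α ℓ) _ ⟩
      α ℓ ⊗ sumWords (2 + ℓ) n (λ W → [ above (suc ℓ) W ℕ.≟ v ] ⊗ (phase 0 W ⊗ φ (ℓ ∷ W)))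
        ≡⟨ cong (α ℓ ⊗_) (merge-top n v (φ ∘ (ℓ ∷_)) (λ p → φ~ (inj₁ refl ∷ p))) ⟩
      α ℓ ⊗ below-top v ∎
    high : ∀ v → sumWords (2 + ℓ) n (λ W → [ above (suc ℓ) (suc ℓ ∷ W) ℕ.≟ v ] ⊗ (phase 0 (suc ℓ ∷ W) ⊗ φ (suc ℓ ∷ W))) ≡ rest v
    high zero = trans (sumWords-≗ (2 + ℓ) n λ W → trans (cong (λ k → [ k + above (suc ℓ) W ℕ.≟ 0 ] ⊗ (phase 0 (suc ℓ ∷ W) ⊗ φ (suc ℓ ∷ W)))
      (if-yes (suc ℓ ℕ.≤? suc ℓ) ℕ.≤-refl)) (zeroˡ _)) (sumWords-0 (2 + ℓ) n)
    high (suc v) = trans (sumWords-≗ (2 + ℓ) n λ W →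
        trans (cong (λ k → [ k + above (suc ℓ) W ℕ.≟ suc v ] ⊗ (phase 0 (suc ℓ ∷ W) ⊗ φ (suc ℓ ∷ W))) (if-yes (suc ℓ ℕ.≤? suc ℓ) ℕ.≤-refl))
          (cong₂ (λ p f → [ above (suc ℓ) W ℕ.≟ v ] ⊗ (p ⊗ f)) (if-no (suc ℓ ℕ.≟ ℓ) (ℕ.>⇒≢ ℕ.≤-refl))
            (φ~ (inj₂ (ℕ.n≤1+n ℓ , ℕ.≤-refl) ∷ pointwise-refl (inj₁ refl)))))
      (merge-top n v (φ ∘ (ℓ ∷_)) (λ p → φ~ (inj₁ refl ∷ p)))
    top : ∀ w → (α ℓ ⊗ below-top w) ⊕ rest w ≡ sumWords (1 + ℓ) n λ W → T (above ℓ (ℓ ∷ W)) w ⊗ φ (ℓ ∷ W)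
    top w = trans (top′ w) (sym (sumWords-≗ (1 + ℓ) n λ W →
        cong (λ k → T (k + above ℓ W) w ⊗ φ (ℓ ∷ W)) (if-yes (ℓ ℕ.≤? ℓ) ℕ.≤-refl)))
      where
      top′ : ∀ w → (α ℓ ⊗ below-top w) ⊕ rest w ≡ sumWords (1 + ℓ) n λ W → T (suc (above ℓ W)) w ⊗ φ (ℓ ∷ W)
      top′ zero = trans (⊕-identityʳ _) (trans (sym (sumWords-⊗ (1 + ℓ) n (α ℓ) _))
        (sumWords-≗ (1 + ℓ) n λ W → sym (⊗-assoc _ _ _)))
      top′ (suc w) = begin
        (α ℓ ⊗ below-top (suc w)) ⊕ below-top w
          ≡⟨ cong (_⊕ below-top w) (sumWords-⊗ (1 + ℓ) n (α ℓ) _) ⟨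
        sumWords (1 + ℓ) n (λ W → α ℓ ⊗ (T (above ℓ W) (suc w) ⊗ φ (ℓ ∷ W))) ⊕ below-top w
          ≡⟨ sumWords-⊕ (1 + ℓ) n _ _ ⟨
        sumWords (1 + ℓ) n (λ W → (α ℓ ⊗ (T (above ℓ W) (suc w) ⊗ φ (ℓ ∷ W))) ⊕ (T (above ℓ W) w ⊗ φ (ℓ ∷ W)))
          ≡⟨ sumWords-≗ (1 + ℓ) n (λ W → solve 4 (λ a t u f → a :* (t :* f) :+ u :* f := (a :* t :+ u) :* f) refl (α ℓ) _ _ _) ⟩
        sumWords (1 + ℓ) n (λ W → T (suc (above ℓ W)) (suc w) ⊗ φ (ℓ ∷ W)) ∎

  S₀≡ΣTΩ : ∀ v n → S 0 v n ≡ sumTo (suc n) λ k → T k v ⊗ Ω ℓ k n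
  S₀≡ΣTΩ v n = begin
    S 0 v n
      ≡⟨ merge-top n v (weight ℓ []) (weight-similar []) ⟩
    sumWords (1 + ℓ) n (λ W → T (above ℓ W) v ⊗ weight ℓ [] W)
      -- A word of length `n` has at most `n` stars, so its star number occurs among the indices
      -- `k`.
      ≡⟨ sumWords-cong (1 + ℓ) n (λ W len _ → sumTo-[≟] (suc n)
           (s≤s (subst (above ℓ W ≤_) (trans (below+above≡length ℓ W) len) (ℕ.m≤n+m _ _)))
           (λ k → T k v) (weight ℓ [] W)) ⟨
    sumWords (1 + ℓ) n (λ W → sumTo (suc n) λ k → T k v ⊗ ([ above ℓ W ℕ.≟ k ] ⊗ weight ℓ [] W))
      ≡⟨ sumWords-sumTo (1 + ℓ) n (suc n) _ ⟩
    sumTo (suc n) (λ k → sumWords (1 + ℓ) n λ W → T k v ⊗ ([ above ℓ W ℕ.≟ k ] ⊗ weight ℓ [] W))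
      ≡⟨ sumTo-cong (suc n) (λ {k} _ → sumWords-⊗ (1 + ℓ) n (T k v) _) ⟩
    sumTo (suc n) (λ k → T k v ⊗ Ω ℓ k n) ∎

-- The series of words with v stars

module StarSeries {A : Set} (_⊕_ _⊗_ : A → A → A) (⊖_ : A → A) (0# 1# : A)
  (isCommutativeRing : IsCommutativeRing _≡_ _⊕_ _⊗_ ⊖_ 0# 1#) (α β : ℕ → A) where

  open IsCommutativeRing isCommutativeRing
    hiding (refl; sym; trans; setoid; zero)
    renaming (+-assoc to ⊕-assoc; +-comm to ⊕-comm; +-identityˡ to ⊕-identityˡ; +-identityʳ to ⊕-identityʳ
             ; *-assoc to ⊗-assoc; *-comm to ⊗-comm; *-identityˡ to ⊗-identityˡ; *-identityʳ to ⊗-identityʳ)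
  open PowerSeries _⊕_ _⊗_ ⊖_ 0# 1# isCommutativeRing
  open WeightedWords _⊕_ _⊗_ ⊖_ 0# 1# isCommutativeRing
  open ExcedanceWeights _⊕_ _⊗_ ⊖_ 0# 1# isCommutativeRing α β
  open import Algebra.Solver.Ring.NaturalCoefficients.Default
    (CommutativeRing.commutativeSemiring seriesRing)
    using (solve; _:+_; _:*_; _:=_)
  open import Relation.Binary.Reasoning.Setoid (CommutativeRing.setoid seriesRing)

  ⊠-swap : ∀ f g h → f ⊠ (g ⊠ h) ≈ g ⊠ (f ⊠ h)
  ⊠-swap = solve 3 (λ f g h → f :* (g :* h) := g :* (f :* h)) (λ _ → refl)

  ⊠-congˡ : ∀ f {g h} → g ≈ h → f ⊠ g ≈ f ⊠ h
  ⊠-congˡ f = ⊠-cong {f} (λ _ → refl)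

  geometric : Ser → ℕ → Ser
  geometric b zero    = b
  geometric b (suc v) = shift b ⊠ geometric b v

  -- The series has the factor uᵏ, which lets sums over all star numbers be cut off at the degree
  -- under consideration.
  geometric-vanishes : ∀ b {k n} → n < k → geometric b k n ≡ 0#
  geometric-vanishes b {suc k} {zero}  _         = zeroˡ _
  geometric-vanishes b {suc k} {suc n} (s≤s n<k) = trans (shift-⊠ b (geometric b k) (suc n))
    (trans (⊠-cong-≤ {b} n (λ _ → refl) (λ i≤n → geometric-vanishes b (ℕ.≤-<-trans i≤n n<k)))
      (trans (⊠-comm b (λ _ → 0#) n) (⊠-zeroˡ b n)))

  sumTo-truncate : ∀ {m} n {f} → m ≤ n → (∀ {k} → m ≤ k → f k ≡ 0#) → sumTo n f ≡ sumTo m f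
  sumTo-truncate         zero    z≤n    f≡0 = refl
  sumTo-truncate {m = m} (suc n) m≤1+n f≡0 with ℕ.m≤n⇒m<n∨m≡n m≤1+n
  ... | inj₂ refl        = refl
  ... | inj₁ (s≤s m≤n) = trans (cong₂ _⊕_ (sumTo-truncate n m≤n f≡0) (f≡0 m≤n)) (⊕-identityʳ _)

  ⊠-sumTo : ∀ b N (a : ℕ → A) (f : ℕ → Ser) n →
            (b ⊠ λ m → sumTo N λ k → a k ⊗ f k m) n ≡ sumTo N λ k → a k ⊗ (b ⊠ f k) n
  ⊠-sumTo b zero    a f n = trans (⊠-comm b (λ _ → 0#) n) (⊠-zeroˡ b n)
  ⊠-sumTo b (suc N) a f n = trans (⊠-distribˡ b (λ m → sumTo N λ k → a k ⊗ f k m) (scale (a N) (f N)) n)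
    (cong₂ _⊕_ (⊠-sumTo b N a f n) (⊠-scale (a N) b (f N) n))

  module Step (ℓ : ℕ) (b : Ser) (Ω≈ : ∀ v → Ω ℓ v ≈ geometric b v) where
    open LetterElimination _⊕_ _⊗_ ⊖_ 0# 1# isCommutativeRing α β ℓ

    x : Ser
    x = shift b

    S₀≡ : ∀ v n → S 0 v n ≡ sumTo (suc n) λ k → T k v ⊗ geometric b k n
    S₀≡ v n = trans (S₀≡ΣTΩ v n) (sumTo-cong (suc n) λ {k} _ → cong (T k v ⊗_) (Ω≈ k n))

    -- In degree m the series `S 0 v` is a sum cut off at k ≤ m. Multiplication term by term needs a
    -- cut-off independent of m; since b (ub)ᵏ vanishes in degrees below k, all degrees up to `n`
    -- can share one.
    x⊠S₀ : ∀ v n → (x ⊠ S 0 v) n ≡ sumTo n λ k → T k v ⊗ geometric b (suc k) n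
    x⊠S₀ v zero    = zeroˡ _
    x⊠S₀ v (suc n) = trans (shift-⊠ b (S 0 v) (suc n))
      (trans (⊠-cong-≤ {b} n (λ _ → refl) λ {m} m≤n → trans (S₀≡ v m)
          (sym (sumTo-truncate (suc n) (s≤s m≤n) λ {k} m<k →
            trans (cong (T k v ⊗_) (geometric-vanishes b m<k)) (zeroʳ _))))
        (trans (⊠-sumTo b (suc n) (λ k → T k v) (geometric b) n)
          (sumTo-cong (suc n) λ {k} _ → cong (T k v ⊗_) (sym (shift-⊠ b (geometric b k) (suc n))))))

    S₀-0 : S 0 0 ≈ b ⊞ scale (α ℓ) (x ⊠ S 0 0)
    S₀-0 n = trans (S₀≡ 0 n) (trans (sumTo-head n _) (cong₂ _⊕_ (⊗-identityˡ (b n))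
      (trans (sumTo-cong n λ _ → ⊗-assoc _ _ _) (trans (sumTo-⊗ n (α ℓ) _) (cong (α ℓ ⊗_) (sym (x⊠S₀ 0 n)))))))

    -- This is Pascal's rule for `T`. Together with `S₀-0` it amounts to S 0 v = b xᵛ / (1 - αx)ᵛ⁺¹,
    -- where x = ub.
    S₀-suc : ∀ v → S 0 (suc v) ≈ x ⊠ S 0 v ⊞ scale (α ℓ) (x ⊠ S 0 (suc v))
    S₀-suc v n = trans (S₀≡ (suc v) n) (trans (sumTo-head n _) (trans (cong₂ _⊕_ (zeroˡ (b n))
        (trans (sumTo-cong n λ {k} _ → trans (distribʳ _ _ _) (trans (⊕-comm _ _) (cong ((T k v ⊗ geometric b (suc k) n) ⊕_) (⊗-assoc _ _ _))))
          (trans (sumTo-⊕ n _ _) (cong₂ _⊕_ (sym (x⊠S₀ v n))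
            (trans (sumTo-⊗ n (α ℓ) _) (cong (α ℓ ⊗_) (sym (x⊠S₀ (suc v) n))))))))
      (⊕-identityˡ _)))

    B C D : Ser
    B = one-minus (β ℓ) var
    C = one-minus (α ℓ) var
    D = one-minus (α ℓ) x

    S-step : ∀ {a v} → a ≤ v → B ⊠ S (suc a) v ≈ C ⊠ S a v
    S-step {a} {v} a≤v = one-minus-cross λ where
      zero    → cong₂ _⊕_ refl (trans (cong (α ℓ ⊗_) (zeroˡ _)) (trans (zeroʳ _) (sym (trans (cong (β ℓ ⊗_) (zeroˡ _)) (zeroʳ _)))))
      (suc n) → trans (cong (λ e → S (suc a) v (suc n) ⊕ (α ℓ ⊗ e)) (var-⊠ (S a v) (suc n)))
        (trans (S-suc n a≤v) (cong (λ e → S a v (suc n) ⊕ (β ℓ ⊗ e)) (sym (var-⊠ (S (suc a) v) (suc n)))))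

    unit-cancel : ∀ {c} → c 0 ≡ 1# → ∀ {f g} → c ⊠ f ≈ c ⊠ g → f ≈ g
    unit-cancel c₀≡1 = ⊠-cancelˡ λ {p} {q} eq →
      trans (sym (trans (cong (_⊗ p) c₀≡1) (⊗-identityˡ p))) (trans eq (trans (cong (_⊗ q) c₀≡1) (⊗-identityˡ q)))

    one-minus-shift₀ : ∀ a f → one-minus a (shift f) 0 ≡ 1#
    one-minus-shift₀ a f = trans (cong (λ e → 1# ⊕ (⊖ e)) (zeroʳ a)) (trans (cong (1# ⊕_) -0#≈0#) (⊕-identityʳ 1#))
      where open import Algebra.Properties.Ring (CommutativeRing.ring coefficientRing) using (-0#≈0#)

    B₀≡1 : B 0 ≡ 1#
    B₀≡1 = one-minus-shift₀ (β ℓ) (const 1#)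

    BD₀≡1 : (B ⊠ D) 0 ≡ 1#
    BD₀≡1 = trans (cong₂ _⊗_ B₀≡1 (one-minus-shift₀ (α ℓ) b)) (⊗-identityˡ 1#)

    -- The case `a = 0` is `S₀-suc`. Passing from `a` to `suc a` multiplies both sides by (1 -
    -- αu)/(1 - βu), because the factor in `S-step` depends neither on `a` nor on `v`.
    S-shift : ∀ a v → a ≤ suc v → D ⊠ S a (suc v) ≈ x ⊠ S a v
    S-shift zero    v _         = one-minus-solve (S₀-suc v)
    S-shift (suc a) v (s≤s a≤v) = unit-cancel B₀≡1 (begin
      B ⊠ (D ⊠ S (suc a) (suc v))  ≈⟨ ⊠-swap B D (S (suc a) (suc v)) ⟩
      D ⊠ (B ⊠ S (suc a) (suc v))  ≈⟨ ⊠-congˡ D (S-step (ℕ.m≤n⇒m≤1+n a≤v)) ⟩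
      D ⊠ (C ⊠ S a (suc v))        ≈⟨ ⊠-swap D C (S a (suc v)) ⟩
      C ⊠ (D ⊠ S a (suc v))        ≈⟨ ⊠-congˡ C (S-shift a v (ℕ.m≤n⇒m≤1+n a≤v)) ⟩
      C ⊠ (x ⊠ S a v)              ≈⟨ ⊠-swap C x (S a v) ⟩
      x ⊠ (C ⊠ S a v)              ≈⟨ ⊠-congˡ x (S-step a≤v) ⟨
      x ⊠ (B ⊠ S (suc a) v)        ≈⟨ ⊠-swap x B (S (suc a) v) ⟩
      B ⊠ (x ⊠ S (suc a) v)        ∎)

    -- The Möbius transformation b′ = (1 - αu) b / ((1 - βu)(1 - αub)) with its denominator cleared.
    Ω-suc-0 : (B ⊠ D) ⊠ Ω (suc ℓ) 0 ≈ C ⊠ b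
    Ω-suc-0 = begin
      (B ⊠ D) ⊠ Ω (suc ℓ) 0  ≈⟨ ⊠-congˡ (B ⊠ D) (Ω-suc≡S 0) ⟩
      (B ⊠ D) ⊠ S 1 0        ≈⟨ solve 3 (λ p q r → (p :* q) :* r := q :* (p :* r)) (λ _ → refl) B D (S 1 0) ⟩
      D ⊠ (B ⊠ S 1 0)        ≈⟨ ⊠-congˡ D (S-step z≤n) ⟩
      D ⊠ (C ⊠ S 0 0)        ≈⟨ ⊠-swap D C (S 0 0) ⟩
      C ⊠ (D ⊠ S 0 0)        ≈⟨ ⊠-congˡ C (one-minus-solve S₀-0) ⟩
      C ⊠ b                  ∎

    -- One more star means one more step in `a`, with factor C/B, and one more shift in `v`, with
    -- factor x/D; their product C u b / (B D) is u b′ by `Ω-suc-0`.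
    Ω-suc≈ : ∀ v → Ω (suc ℓ) v ≈ geometric (Ω (suc ℓ) 0) v
    Ω-suc≈ zero    n = refl
    Ω-suc≈ (suc v) = unit-cancel BD₀≡1 (begin
      (B ⊠ D) ⊠ Ω (suc ℓ) (suc v)                  ≈⟨ ⊠-congˡ (B ⊠ D) (Ω-suc≡S (suc v)) ⟩
      (B ⊠ D) ⊠ S (2 + v) (suc v)                  ≈⟨ solve 3 (λ p q r → (p :* q) :* r := q :* (p :* r)) (λ _ → refl) B D (S (2 + v) (suc v)) ⟩
      D ⊠ (B ⊠ S (2 + v) (suc v))                  ≈⟨ ⊠-congˡ D (S-step ℕ.≤-refl) ⟩
      D ⊠ (C ⊠ S (suc v) (suc v))                  ≈⟨ ⊠-swap D C (S (suc v) (suc v)) ⟩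
      C ⊠ (D ⊠ S (suc v) (suc v))                  ≈⟨ ⊠-congˡ C (S-shift (suc v) v ℕ.≤-refl) ⟩
      C ⊠ (x ⊠ S (suc v) v)                        ≈⟨ ⊠-congˡ C (⊠-cong (var-⊠ b) (Ω-suc≡S v)) ⟨
      C ⊠ ((var ⊠ b) ⊠ Ω (suc ℓ) v)                ≈⟨ solve 4 (λ c u b o → c :* ((u :* b) :* o) := (c :* b) :* (u :* o)) (λ _ → refl) C var b (Ω (suc ℓ) v) ⟩
      (C ⊠ b) ⊠ (var ⊠ Ω (suc ℓ) v)                ≈⟨ ⊠-cong Ω-suc-0 (⊠-congˡ var (λ n → sym (Ω-suc≈ v n))) ⟨
      ((B ⊠ D) ⊠ b′) ⊠ (var ⊠ geometric b′ v)      ≈⟨ solve 4 (λ d b u g → (d :* b) :* (u :* g) := d :* ((u :* b) :* g)) (λ _ → refl) (B ⊠ D) b′ var (geometric b′ v) ⟩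
      (B ⊠ D) ⊠ ((var ⊠ b′) ⊠ geometric b′ v)      ≈⟨ ⊠-congˡ (B ⊠ D) (⊠-cong (var-⊠ b′) (λ _ → refl)) ⟩
      (B ⊠ D) ⊠ (shift b′ ⊠ geometric b′ v)        ∎)
      where
      b′ : Ser
      b′ = Ω (suc ℓ) 0

  weight-0 : ∀ L W → weight 0 L W ≡ 1#
  weight-0 L []      = refl
  weight-0 L (x ∷ W) = trans (⊗-identityˡ _) (weight-0 (x ∷ L) W)

  Ω-0 : ∀ v n → Ω 0 v n ≡ [ n ℕ.≟ v ]
  Ω-0 v n = trans (sumWords-≗ 1 n λ W → trans (cong ([ above 0 W ℕ.≟ v ] ⊗_) (weight-0 [] W)) (⊗-identityʳ _)) (count v n)
    where
    count : ∀ v n → sumWords 1 n (λ W → [ above 0 W ℕ.≟ v ]) ≡ [ n ℕ.≟ v ]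
    count v       zero    = refl
    count zero    (suc n) = trans (⊕-identityˡ _) (sumWords-0 1 n)
    count (suc v) (suc n) = trans (⊕-identityˡ _) (count v n)

  geometric-const : ∀ v n → geometric (const 1#) v n ≡ [ n ℕ.≟ v ]
  geometric-const zero    zero    = refl
  geometric-const zero    (suc n) = refl
  geometric-const (suc v) zero    = zeroˡ _
  geometric-const (suc v) (suc n) = trans (var-⊠ (geometric (const 1#) v) (suc n)) (geometric-const v n)

  geometric-cong : ∀ {b c} v → b ≈ c → geometric b v ≈ geometric c v
  geometric-cong         zero    b≈c = b≈c
  geometric-cong {b} {c} (suc v) b≈c = ⊠-cong {shift b} shift≈ (geometric-cong v b≈c)
    where
    shift≈ : shift b ≈ shift c
    shift≈ zero    = refl
    shift≈ (suc n) = b≈c n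

  Ω≈geometric : ∀ ℓ v → Ω ℓ v ≈ geometric (Ω ℓ 0) v
  -- For `ℓ = 0` every letter is a star, so there is one word of each length, and b = 1.
  Ω≈geometric zero v n = trans (Ω-0 v n) (trans (sym (geometric-const v n)) (geometric-cong v const≈Ω n))
    where
    const≈Ω : const 1# ≈ Ω 0 0
    const≈Ω n = trans (geometric-const 0 n) (sym (Ω-0 0 n))
  Ω≈geometric (suc ℓ) v = Step.Ω-suc≈ ℓ (Ω ℓ 0) (Ω≈geometric ℓ) v

  Ω-recurrence : ∀ ℓ → (one-minus (β ℓ) var ⊠ one-minus (α ℓ) (shift (Ω ℓ 0))) ⊠ Ω (suc ℓ) 0 ≈
                       one-minus (α ℓ) var ⊠ Ω ℓ 0
  Ω-recurrence ℓ = Step.Ω-suc-0 ℓ (Ω ℓ 0) (Ω≈geometric ℓ)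

  Ω-no-star : ∀ ℓ n → Ω ℓ 0 n ≡ sumWords ℓ n (weight ℓ [])
  Ω-no-star ℓ n = no-star n (weight ℓ [])
    where
    no-star : ∀ n (φ : List ℕ → A) → sumWords (suc ℓ) n (λ W → [ above ℓ W ℕ.≟ 0 ] ⊗ φ W) ≡ sumWords ℓ n φ
    no-star zero    φ = ⊗-identityˡ (φ [])
    no-star (suc n) φ = trans (cong₂ _⊕_
        (sumTo-cong ℓ λ {x} x<ℓ → trans (sumWords-≗ (suc ℓ) n λ W →
            cong (λ k → [ k + above ℓ W ℕ.≟ 0 ] ⊗ φ (x ∷ W)) (if-no (ℓ ℕ.≤? x) (ℕ.<⇒≱ x<ℓ)))
          (no-star n (φ ∘ (x ∷_))))
        (trans (sumWords-≗ (suc ℓ) n λ W →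
            trans (cong (λ k → [ k + above ℓ W ℕ.≟ 0 ] ⊗ φ (ℓ ∷ W)) (if-yes (ℓ ℕ.≤? ℓ) ℕ.≤-refl)) (zeroˡ _))
          (sumWords-0 (suc ℓ) n)))
      (⊕-identityʳ _)

-- The series of words by flag excedances

_^ᵠ_ : ℚ → ℕ → ℚ
s ^ᵠ zero  = 1ℚ
s ^ᵠ suc n = s ℚ.* s ^ᵠ n

infixr 8 _^ᵠ_

ℚ-cancelˡ : ∀ {c a b} → c ≢ 0ℚ → c ℚ.* a ≡ c ℚ.* b → a ≡ b
ℚ-cancelˡ {c} {a} {b} c≢0 eq = trans (sym (undo a)) (trans (cong ((ℚ.1/ c) ℚ.*_) eq) (undo b))
  where
  instance _ = ℚ.≢-nonZero c≢0
  undo : ∀ x → (ℚ.1/ c) ℚ.* (c ℚ.* x) ≡ x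
  undo x = trans (sym (ℚ.*-assoc (ℚ.1/ c) c x)) (trans (cong (ℚ._* x) (ℚ.*-inverseˡ c)) (ℚ.*-identityˡ x))

-- The colour c of the letter x = r f − c, where f = ⌈ x / r ⌉.
colour : (r : ℕ) .{{_ : NonZero r}} → ℕ → ℕ
colour r zero    = 0
colour r (suc x) = r ∸ 1 ∸ x % r

module ExcedanceSeries (r : ℕ) .{{_ : NonZero r}} (s : ℚ) (s≢1 : 1ℚ ℚ.- s ≢ 0ℚ) where

  X : ℚ
  X = s ^ᵠ r

  -- In `fexc` an excedance of colour 0 contributes r and any other letter its colour. Thus the two
  -- weights differ only at colour 0, that is at the multiples of r.
  α β : ℕ → ℚ
  α x = s ^ᵠ (if does (colour r x ℕ.≟ 0) then r else colour r x)
  β x = s ^ᵠ colour r x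

  open PowerSeries ℚ._+_ ℚ._*_ ℚ.-_ 0ℚ 1ℚ ℚ.+-*-isCommutativeRing
  open WeightedWords ℚ._+_ ℚ._*_ ℚ.-_ 0ℚ 1ℚ ℚ.+-*-isCommutativeRing
  open ExcedanceWeights ℚ._+_ ℚ._*_ ℚ.-_ 0ℚ 1ℚ ℚ.+-*-isCommutativeRing α β
  open StarSeries ℚ._+_ ℚ._*_ ℚ.-_ 0ℚ 1ℚ ℚ.+-*-isCommutativeRing α β
  module R = CommutativeRing seriesRing

  const≟ : ∀ a b → Maybe (const a ≈ const b)
  const≟ a b with a ℚ.≟ b
  ... | yes refl = just λ _ → refl
  ... | no  _    = nothing

  open import Algebra.Solver.Ring (CommutativeRing.rawRing coefficientRing) (fromCommutativeRing seriesRing)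
    const-homomorphism const≟
    using (solve; con; _:+_; _:*_; _:-_; _:=_)
  open import Relation.Binary.Reasoning.Setoid R.setoid

  pow : Ser → ℕ → Ser
  pow f zero    = const 1ℚ
  pow f (suc n) = f ⊠ pow f n

  infixl 6 _⊟_

  _⊟_ : Ser → Ser → Ser
  f ⊟ g = f ⊞ negate g

  1-u 1-Xu : Ser
  1-u  = const 1ℚ ⊟ var
  1-Xu = const 1ℚ ⊟ const X ⊠ var

  Δ : ℕ → Ser
  Δ t = pow 1-u t ⊟ const s ⊠ pow 1-Xu t

  one-minus≈ : ∀ a f → one-minus a f ≈ const 1ℚ ⊟ const a ⊠ f
  one-minus≈ a f n = cong (λ e → const 1ℚ n ℚ.+ (ℚ.- e)) (sym (const-⊠ a f n))

  cancel₁ : ∀ {c} → c 0 ≡ 1ℚ → ∀ {f g} → c ⊠ f ≈ c ⊠ g → f ≈ g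
  cancel₁ c₀≡1 = ⊠-cancelˡ λ {p} {q} eq →
    trans (sym (trans (cong (ℚ._* p) c₀≡1) (ℚ.*-identityˡ p))) (trans eq (trans (cong (ℚ._* q) c₀≡1) (ℚ.*-identityˡ q)))

  one-minus-var₀ : ∀ a → (const 1ℚ ⊟ const a ⊠ var) 0 ≡ 1ℚ
  one-minus-var₀ a = trans (cong (λ e → 1ℚ ℚ.+ (ℚ.- e)) (ℚ.*-zeroʳ a)) (ℚ.+-identityʳ 1ℚ)

  -- Multiplying by b turns p − α u q into q (1 − α u b), which is how the
  -- nonlinear recurrence for Ω becomes linear.
  letter-step : ∀ ℓ p q → Ω ℓ 0 ⊠ p ≈ q →
    Ω (suc ℓ) 0 ⊠ ((const 1ℚ ⊟ const (β ℓ) ⊠ var) ⊠ (p ⊟ const (α ℓ) ⊠ var ⊠ q)) ≈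
    (const 1ℚ ⊟ const (α ℓ) ⊠ var) ⊠ q
  letter-step ℓ p q bp≈q = cancel₁ {b} refl (begin
    b ⊠ (b′ ⊠ (B ⊠ (p ⊟ a ⊠ var ⊠ q)))
      ≈⟨ solve 6 (λ b b′ B p q u → b :* (b′ :* (B :* (p :- u :* q))) := (B :* b′) :* (b :* p :- u :* b :* q))
           (λ _ → refl) b b′ B p q (a ⊠ var) ⟩
    (B ⊠ b′) ⊠ (b ⊠ p ⊟ a ⊠ var ⊠ b ⊠ q)
      ≈⟨ ⊠-cong {B ⊠ b′} (λ _ → refl) (R.+-congʳ bp≈q) ⟩
    (B ⊠ b′) ⊠ (q ⊟ a ⊠ var ⊠ b ⊠ q)
      ≈⟨ solve 6 (λ b b′ B q a u → (B :* b′) :* (q :- a :* u :* b :* q) := q :* ((B :* (con 1ℚ :- a :* (u :* b))) :* b′))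
           (λ _ → refl) b b′ B q a var ⟩
    q ⊠ ((B ⊠ (const 1ℚ ⊟ a ⊠ (var ⊠ b))) ⊠ b′)
      ≈⟨ R.*-congˡ {q} (begin
           (B ⊠ (const 1ℚ ⊟ a ⊠ (var ⊠ b))) ⊠ b′
             ≈⟨ R.*-congʳ {b′} (R.*-cong (one-minus≈ (β ℓ) var) (R.trans (one-minus≈ (α ℓ) (shift b))
                  (R.+-congˡ {const 1ℚ} (R.-‿cong (R.*-congˡ {a} (R.sym (var-⊠ b))))))) ⟨
           (one-minus (β ℓ) var ⊠ one-minus (α ℓ) (shift b)) ⊠ b′
             ≈⟨ Ω-recurrence ℓ ⟩
           one-minus (α ℓ) var ⊠ b
             ≈⟨ R.*-congʳ {b} (one-minus≈ (α ℓ) var) ⟩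
           (const 1ℚ ⊟ a ⊠ var) ⊠ b ∎) ⟩
    q ⊠ ((const 1ℚ ⊟ a ⊠ var) ⊠ b)
      ≈⟨ solve 3 (λ q c b → q :* (c :* b) := b :* (c :* q)) (λ _ → refl) q (const 1ℚ ⊟ a ⊠ var) b ⟩
    b ⊠ ((const 1ℚ ⊟ a ⊠ var) ⊠ q) ∎)
    where
    a b b′ B : Ser
    a  = const (α ℓ)
    b  = Ω ℓ 0
    b′ = Ω (suc ℓ) 0
    B  = const 1ℚ ⊟ const (β ℓ) ⊠ var

  open import Data.Rational.Solver using (module +-*-Solver)
  module Q = +-*-Solver

  -- sʳ⁻¹ + ⋯ + sʳ⁻ʲ
  G : ℕ → ℚ
  G zero    = 0ℚ
  G (suc j) = G j ℚ.+ s ^ᵠ (r ∸ 1 ∸ j)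

  G-closed : ∀ {j} → j ≤ r → (1ℚ ℚ.- s) ℚ.* G j ≡ s ^ᵠ (r ∸ j) ℚ.- X
  G-closed {zero}  _   = trans (ℚ.*-zeroʳ (1ℚ ℚ.- s)) (sym (ℚ.+-inverseʳ X))
  G-closed {suc j} j<r = trans (ℚ.*-distribˡ-+ (1ℚ ℚ.- s) (G j) (s ^ᵠ (r ∸ 1 ∸ j)))
    (trans (cong (ℚ._+ (1ℚ ℚ.- s) ℚ.* s ^ᵠ (r ∸ 1 ∸ j)) (G-closed (ℕ.<⇒≤ j<r)))
      (trans (cong₂ (λ m n → (s ^ᵠ m ℚ.- X) ℚ.+ (1ℚ ℚ.- s) ℚ.* s ^ᵠ n) (ℕ.+-∸-assoc 1 j<r) exponent)
        (Q.solve 3 (λ s a x → ((s Q.:* a) Q.:- x) Q.:+ ((Q.con 1ℚ Q.:- s) Q.:* a) Q.:= a Q.:- x) refl s (s ^ᵠ (r ∸ suc j)) X)))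
    where
    exponent : r ∸ 1 ∸ j ≡ r ∸ suc j
    exponent = ℕ.∸-+-assoc r 1 j

  colour-suc : ∀ f {j} → j < r → colour r (suc (r * f + j)) ≡ r ∸ 1 ∸ j
  colour-suc f {j} j<r = cong (r ∸ 1 ∸_) (trans (cong (λ e → (e + j) % r) (ℕ.*-comm r f))
    (trans (cong (_% r) (ℕ.+-comm (f * r) j)) (trans ([m+kn]%n≡m%n j f r) (m<n⇒m%n≡m j<r))))

  -- For the alphabet {0, ..., rf} these are the two sides of the equation that characterizes the
  -- series: F · den = num.
  den num : ℕ → Ser
  den f = 1-u ⊠ Δ f
  num f = const (1ℚ ℚ.- s) ⊠ pow 1-Xu f

  -- The letters rf + 1, ..., rf + j have the nonzero colours r - 1, ..., r - j, where `α` and `β`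
  -- agree. The factors 1 - αu and 1 - βu of the Möbius transformation cancel, and each letter
  -- merely subtracts αu from 1/b; `G j` collects these terms.
  within-level : ∀ f → Ω (suc (r * f)) 0 ⊠ den f ≈ num f → ∀ {j} → j < r →
                 Ω (suc (r * f + j)) 0 ⊠ (den f ⊟ const (G j) ⊠ var ⊠ num f) ≈ num f
  within-level f start {zero} _ = begin
    Ω (suc (r * f + 0)) 0 ⊠ (den f ⊟ const 0ℚ ⊠ var ⊠ num f)
      ≈⟨ ⊠-cong (λ n → cong (λ m → Ω (suc m) 0 n) (ℕ.+-identityʳ (r * f)))
           (solve 3 (λ p u q → p :- con 0ℚ :* u :* q := p) (λ _ → refl) (den f) var (num f)) ⟩
    Ω (suc (r * f)) 0 ⊠ den f
      ≈⟨ start ⟩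
    num f ∎
  within-level f start {suc j} j+1<r = cancel₁ (one-minus-var₀ (s ^ᵠ e)) (begin
    B ⊠ (Ω (suc (r * f + suc j)) 0 ⊠ (den f ⊟ (const (G j ℚ.+ s ^ᵠ e)) ⊠ var ⊠ num f))
      ≈⟨ R.*-congˡ {B} (⊠-cong (λ n → cong (λ m → Ω (suc m) 0 n) (ℕ.+-suc (r * f) j))
           (R.+-congˡ {den f} (R.-‿cong (R.*-congʳ {num f} (R.*-congʳ {var} (const-+ (G j) (s ^ᵠ e))))))) ⟩
    B ⊠ (Ω (suc ℓ) 0 ⊠ (den f ⊟ (const (G j) ⊞ const (s ^ᵠ e)) ⊠ var ⊠ num f))
      ≈⟨ solve 7 (λ B o p g a u q → B :* (o :* (p :- (g :+ a) :* u :* q)) := o :* (B :* ((p :- g :* u :* q) :- a :* u :* q)))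
           (λ _ → refl) B (Ω (suc ℓ) 0) (den f) (const (G j)) (const (s ^ᵠ e)) var (num f) ⟩
    Ω (suc ℓ) 0 ⊠ (B ⊠ ((den f ⊟ const (G j) ⊠ var ⊠ num f) ⊟ const (s ^ᵠ e) ⊠ var ⊠ num f))
      ≈⟨ (λ n → cong₂ (λ a b → (Ω (suc ℓ) 0 ⊠ ((const 1ℚ ⊟ const b ⊠ var) ⊠ ((den f ⊟ const (G j) ⊠ var ⊠ num f) ⊟ const a ⊠ var ⊠ num f))) n)
           (sym α≡) (sym β≡)) ⟩
    Ω (suc ℓ) 0 ⊠ ((const 1ℚ ⊟ const (β ℓ) ⊠ var) ⊠ ((den f ⊟ const (G j) ⊠ var ⊠ num f) ⊟ const (α ℓ) ⊠ var ⊠ num f))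
      ≈⟨ letter-step ℓ _ (num f) (within-level f start (ℕ.<⇒≤ j+1<r)) ⟩
    (const 1ℚ ⊟ const (α ℓ) ⊠ var) ⊠ num f
      ≈⟨ (λ n → cong (λ a → ((const 1ℚ ⊟ const a ⊠ var) ⊠ num f) n) α≡) ⟩
    B ⊠ num f ∎)
    where
    ℓ e : ℕ
    ℓ = suc (r * f + j)
    e = r ∸ 1 ∸ j
    B : Ser
    B = const 1ℚ ⊟ const (s ^ᵠ e) ⊠ var
    const-+ : ∀ a b → const (a ℚ.+ b) ≈ const a ⊞ const b
    const-+ = _-Raw-AlmostCommutative⟶_.+-homo const-homomorphism
    colour≡ : colour r ℓ ≡ e
    colour≡ = colour-suc f (ℕ.<⇒≤ j+1<r)
    e≢0 : e ≢ 0
    e≢0 eq = ℕ.<⇒≱ j+1<r (ℕ.≤-trans (ℕ.m∸n≡0⇒m≤n (trans (sym (ℕ.∸-+-assoc r 1 j)) eq)) ℕ.≤-refl)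
    β≡ : β ℓ ≡ s ^ᵠ e
    β≡ = cong (s ^ᵠ_) colour≡
    α≡ : α ℓ ≡ s ^ᵠ e
    α≡ = trans (cong (s ^ᵠ_) (if-no (colour r ℓ ℕ.≟ 0) (e≢0 ∘ trans (sym colour≡)))) β≡

  -- Induction from one multiple of r to the next. After the letters of nonzero colour comes r(f +
  -- 1), of colour 0, with α = sʳ and β = 1; it supplies the new factor 1 - u in the denominator and
  -- 1 - sʳu in the numerator.
  excedance-series : ∀ f → Ω (suc (r * f)) 0 ⊠ den f ≈ num f
  excedance-series zero = cancel₁ (one-minus-var₀ X) (begin
    1-Xu ⊠ (Ω (suc (r * 0)) 0 ⊠ (1-u ⊠ (const 1ℚ ⊟ const s ⊠ const 1ℚ)))
      ≈⟨ R.*-congˡ {1-Xu} (R.*-congʳ {den 0} (λ n → cong (λ m → Ω (suc m) 0 n) (ℕ.*-zeroʳ r))) ⟩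
    1-Xu ⊠ (Ω 1 0 ⊠ (1-u ⊠ (const 1ℚ ⊟ const s ⊠ const 1ℚ)))
      ≈⟨ solve 5 (λ X u o s i → (con 1ℚ :- X :* u) :* (o :* ((con 1ℚ :- u) :* (con 1ℚ :- s :* con 1ℚ))) :=
           (o :* ((con 1ℚ :- con 1ℚ :* u) :* (con 1ℚ :- X :* u :* con 1ℚ))) :* (con 1ℚ :- s))
           (λ _ → refl) (const X) var (Ω 1 0) (const s) (const 1ℚ) ⟩
    (Ω 1 0 ⊠ ((const 1ℚ ⊟ const 1ℚ ⊠ var) ⊠ (const 1ℚ ⊟ const X ⊠ var ⊠ const 1ℚ))) ⊠ (const 1ℚ ⊟ const s)
      ≈⟨ R.*-congʳ {const 1ℚ ⊟ const s} (letter-step 0 (const 1ℚ) (const 1ℚ) Ω₀≈1) ⟩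
    (1-Xu ⊠ const 1ℚ) ⊠ (const 1ℚ ⊟ const s)
      ≈⟨ solve 2 (λ c s → (c :* con 1ℚ) :* (con 1ℚ :- s) := c :* ((con 1ℚ :- s) :* con 1ℚ)) (λ _ → refl) 1-Xu (const s) ⟩
    1-Xu ⊠ ((const 1ℚ ⊟ const s) ⊠ const 1ℚ)
      ≈⟨ R.*-congˡ {1-Xu} (R.*-congʳ {const 1ℚ} (const-1- s)) ⟨
    1-Xu ⊠ num 0 ∎)
    where
    Ω₀≈1 : Ω 0 0 ⊠ const 1ℚ ≈ const 1ℚ
    Ω₀≈1 n = trans (R.*-identityʳ (Ω 0 0) n) (trans (Ω-0 0 n) (sym (geometric-const 0 n)))
    const-1- : ∀ s → const (1ℚ ℚ.- s) ≈ const 1ℚ ⊟ const s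
    const-1- s zero    = refl
    const-1- s (suc n) = refl
  excedance-series (suc f) = begin
    Ω (suc (r * suc f)) 0 ⊠ (1-u ⊠ Δ (suc f))
      ≈⟨ ⊠-cong (λ n → cong (λ m → Ω m 0 n) index) (R.*-congˡ {1-u} Δ-suc) ⟩
    Ω (suc ℓ) 0 ⊠ (1-u ⊠ ((den f ⊟ const (G e) ⊠ var ⊠ num f) ⊟ const X ⊠ var ⊠ num f))
      ≈⟨ (λ n → cong₂ (λ a b → (Ω (suc ℓ) 0 ⊠ (b ⊠ ((den f ⊟ const (G e) ⊠ var ⊠ num f) ⊟ const a ⊠ var ⊠ num f))) n)
           (sym α≡) refl) ⟩
    Ω (suc ℓ) 0 ⊠ (1-u ⊠ ((den f ⊟ const (G e) ⊠ var ⊠ num f) ⊟ const (α ℓ) ⊠ var ⊠ num f))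
      ≈⟨ R.*-congˡ {Ω (suc ℓ) 0} (R.*-congʳ {(den f ⊟ const (G e) ⊠ var ⊠ num f) ⊟ const (α ℓ) ⊠ var ⊠ num f} 1-u≈) ⟩
    Ω (suc ℓ) 0 ⊠ ((const 1ℚ ⊟ const (β ℓ) ⊠ var) ⊠ ((den f ⊟ const (G e) ⊠ var ⊠ num f) ⊟ const (α ℓ) ⊠ var ⊠ num f))
      ≈⟨ letter-step ℓ _ (num f) (within-level f (excedance-series f) e<r) ⟩
    (const 1ℚ ⊟ const (α ℓ) ⊠ var) ⊠ num f
      ≈⟨ (λ n → cong (λ a → ((const 1ℚ ⊟ const a ⊠ var) ⊠ num f) n) α≡) ⟩
    1-Xu ⊠ (const (1ℚ ℚ.- s) ⊠ pow 1-Xu f)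
      ≈⟨ solve 3 (λ a b c → a :* (b :* c) := b :* (a :* c)) (λ _ → refl) 1-Xu (const (1ℚ ℚ.- s)) (pow 1-Xu f) ⟩
    num (suc f) ∎
    where
    e ℓ : ℕ
    e = r ∸ 1
    ℓ = suc (r * f + e)
    e<r : e < r
    e<r = ℕ.≤-reflexive (ℕ.suc-pred r)
    index : suc (r * suc f) ≡ suc ℓ
    index = cong suc (trans (ℕ.*-suc r f) (trans (ℕ.+-comm r (r * f))
      (trans (cong (r * f +_) (sym (ℕ.suc-pred r))) (ℕ.+-suc (r * f) e))))
    colour≡ : colour r ℓ ≡ 0
    colour≡ = trans (colour-suc f e<r) (ℕ.n∸n≡0 e)
    α≡ : α ℓ ≡ X
    α≡ = cong (s ^ᵠ_) (if-yes (colour r ℓ ℕ.≟ 0) colour≡)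
    1-u≈ : 1-u ≈ const 1ℚ ⊟ const (β ℓ) ⊠ var
    1-u≈ = R.+-congˡ {const 1ℚ} (R.-‿cong (λ n → trans (sym (R.*-identityˡ var n))
      (cong (λ a → (const a ⊠ var) n) (sym (cong (s ^ᵠ_) colour≡)))))
    const-* : ∀ a b → const (a ℚ.* b) ≈ const a ⊠ const b
    const-* = _-Raw-AlmostCommutative⟶_.*-homo const-homomorphism
    -- The finite geometric sum (1 - s)(s + ⋯ + sʳ) = s - sʳ⁺¹, with the last summand sʳ coming from
    -- the letter of colour 0.
    sum-of-powers : const (G e) ⊠ const (1ℚ ℚ.- s) ⊞ const X ⊠ const (1ℚ ℚ.- s) ≈ const s ⊟ const s ⊠ const X
    sum-of-powers = begin
      const (G e) ⊠ const (1ℚ ℚ.- s) ⊞ const X ⊠ const (1ℚ ℚ.- s)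
        ≈⟨ R.+-cong (const-* (G e) (1ℚ ℚ.- s)) (const-* X (1ℚ ℚ.- s)) ⟨
      const (G e ℚ.* (1ℚ ℚ.- s)) ⊞ const (X ℚ.* (1ℚ ℚ.- s))
        ≈⟨ _-Raw-AlmostCommutative⟶_.+-homo const-homomorphism (G e ℚ.* (1ℚ ℚ.- s)) (X ℚ.* (1ℚ ℚ.- s)) ⟨
      const (G e ℚ.* (1ℚ ℚ.- s) ℚ.+ X ℚ.* (1ℚ ℚ.- s))
        ≈⟨ (λ n → cong (λ a → const a n) (trans (cong (ℚ._+ X ℚ.* (1ℚ ℚ.- s)) (trans (ℚ.*-comm (G e) (1ℚ ℚ.- s))
             (trans (G-closed (ℕ.<⇒≤ e<r)) (cong (λ k → s ^ᵠ k ℚ.- X) (ℕ.m∸[m∸n]≡n (ℕ.>-nonZero⁻¹ r))))))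
             (Q.solve 2 (λ s x → (s Q.:* Q.con 1ℚ Q.:- x) Q.:+ x Q.:* (Q.con 1ℚ Q.:- s) Q.:= s Q.:- s Q.:* x) refl s X))) ⟩
      const (s ℚ.- s ℚ.* X)
        ≈⟨ _-Raw-AlmostCommutative⟶_.+-homo const-homomorphism s (ℚ.- (s ℚ.* X)) ⟩
      const s ⊞ const (ℚ.- (s ℚ.* X))
        ≈⟨ R.+-congˡ {const s} (R.trans (_-Raw-AlmostCommutative⟶_.-‿homo const-homomorphism (s ℚ.* X)) (R.-‿cong (const-* s X))) ⟩
      const s ⊟ const s ⊠ const X ∎
    Δ-suc : Δ (suc f) ≈ (den f ⊟ const (G e) ⊠ var ⊠ num f) ⊟ const X ⊠ var ⊠ num f
    Δ-suc = begin
      1-u ⊠ pow 1-u f ⊟ const s ⊠ (1-Xu ⊠ pow 1-Xu f)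
        ≈⟨ solve 5 (λ u a s X c → (con 1ℚ :- u) :* a :- s :* ((con 1ℚ :- X :* u) :* c) :=
             (con 1ℚ :- u) :* (a :- s :* c) :- (s :- s :* X) :* (u :* c))
             (λ _ → refl) var (pow 1-u f) (const s) (const X) (pow 1-Xu f) ⟩
      den f ⊟ (const s ⊟ const s ⊠ const X) ⊠ (var ⊠ pow 1-Xu f)
        ≈⟨ R.+-congˡ {den f} (R.-‿cong (R.*-congʳ {var ⊠ pow 1-Xu f} sum-of-powers)) ⟨
      den f ⊟ (const (G e) ⊠ const (1ℚ ℚ.- s) ⊞ const X ⊠ const (1ℚ ℚ.- s)) ⊠ (var ⊠ pow 1-Xu f)
        ≈⟨ solve 6 (λ p g d X u c → p :- (g :* d :+ X :* d) :* (u :* c) := (p :- g :* u :* (d :* c)) :- X :* u :* (d :* c))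
             (λ _ → refl) (den f) (const (G e)) (const (1ℚ ℚ.- s)) (const X) var (pow 1-Xu f) ⟩
      (den f ⊟ const (G e) ⊠ var ⊠ num f) ⊟ const X ⊠ var ⊠ num f ∎

  -- The series of words by their sums

  module Lattice (t′ : ℕ) where

    t L : ℕ
    t = suc t′
    L = suc (r * t)

    -- The offset `i` absorbs the first letter of a word, which makes a recursion on the length
    -- possible.
    ψ : ℕ → Ser
    ψ i n = sumWords L n λ W → s ^ᵠ ((sum W + i) / t)

    Λ : Ser
    Λ n = sumWords L n λ W → s ^ᵠ ((sum W ∸ 1) / t)

    ψ-unfold : ∀ i n → ψ i (suc n) ≡ sumTo L λ x → ψ (x + i) n
    ψ-unfold i n = sumTo-cong L λ {x} _ → sumWords-≗ L n λ W → cong (λ m → s ^ᵠ (m / t))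
      (trans (cong (_+ i) (ℕ.+-comm x (sum W))) (ℕ.+-assoc (sum W) x i))

    ψ-dilate : ∀ i m n → ψ (i + m * t) n ≡ s ^ᵠ m ℚ.* ψ i n
    ψ-dilate i m n = trans (sumWords-≗ L n λ W → trans (cong (s ^ᵠ_)
        (trans (cong (_/ t) (sym (ℕ.+-assoc (sum W) i (m * t))))
          (trans (+-distrib-/-∣ʳ (sum W + i) (divides m refl)) (trans (cong ((sum W + i) / t +_) (m*n/n≡m m t))
            (ℕ.+-comm _ m)))))
        (^ᵠ-+ m _)) (sumWords-⊗ L n (s ^ᵠ m) _)
      where
      ^ᵠ-+ : ∀ a b → s ^ᵠ (a + b) ≡ s ^ᵠ a ℚ.* s ^ᵠ b
      ^ᵠ-+ zero    b = sym (ℚ.*-identityˡ _)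
      ^ᵠ-+ (suc a) b = trans (cong (s ℚ.*_) (^ᵠ-+ a b)) (sym (ℚ.*-assoc s _ _))

    -- With the first letter absorbed, the offsets run over i, ..., i + rt on one side and over i +
    -- 1, ..., i + rt + 1 on the other. Only the two ends differ, and the offset i + 1 + rt yields
    -- the factor sʳ.
    ψ-telescope : ∀ i n → ψ i (suc n) ℚ.+ X ℚ.* ψ (suc i) n ≡ ψ (suc i) (suc n) ℚ.+ ψ i n
    ψ-telescope i n = trans (cong₂ ℚ._+_ (ψ-unfold i n) (sym (trans (cong (λ m → ψ m n) (ℕ.+-comm L i))
        (trans (cong (λ m → ψ m n) (ℕ.+-suc i (r * t))) (ψ-dilate (suc i) r n)))))
      (trans (sumTo-head L (λ x → ψ (x + i) n))
        (trans (ℚ.+-comm (ψ i n) _) (cong (ℚ._+ ψ i n)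
          (sym (trans (ψ-unfold (suc i) n) (sumTo-cong L λ {x} _ → cong (λ m → ψ m n) (ℕ.+-suc x i)))))))

    -- The telescoping speaks of positive degrees only; in degree 0 the empty word contributes the
    -- jump `h` between the offsets `i` and `suc i`.
    ψ-advance : ∀ i h → s ^ᵠ (i / t) ≡ s ^ᵠ (suc i / t) ℚ.+ h → 1-u ⊠ ψ i ≈ 1-Xu ⊠ ψ (suc i) ⊞ const h
    ψ-advance i h start = begin
      1-u ⊠ ψ i
        ≈⟨ solve 4 (λ u X p q → (con 1ℚ :- u) :* p := (p :+ X :* (u :* q)) :- (u :* p :+ X :* (u :* q)))
             (λ _ → refl) var (const X) (ψ i) (ψ (suc i)) ⟩
      (ψ i ⊞ const X ⊠ (var ⊠ ψ (suc i))) ⊟ (var ⊠ ψ i ⊞ const X ⊠ (var ⊠ ψ (suc i)))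
        ≈⟨ R.+-congʳ {negate (var ⊠ ψ i ⊞ const X ⊠ (var ⊠ ψ (suc i)))} telescope ⟩
      ((ψ (suc i) ⊞ var ⊠ ψ i) ⊞ const h) ⊟ (var ⊠ ψ i ⊞ const X ⊠ (var ⊠ ψ (suc i)))
        ≈⟨ solve 5 (λ u X p q h → ((q :+ u :* p) :+ h) :- (u :* p :+ X :* (u :* q)) := (con 1ℚ :- X :* u) :* q :+ h)
             (λ _ → refl) var (const X) (ψ i) (ψ (suc i)) (const h) ⟩
      1-Xu ⊠ ψ (suc i) ⊞ const h ∎
      where
      telescope : ψ i ⊞ const X ⊠ (var ⊠ ψ (suc i)) ≈ (ψ (suc i) ⊞ var ⊠ ψ i) ⊞ const h
      telescope zero    = trans (cong₂ ℚ._+_ start (trans (cong (X ℚ.*_) (ℚ.*-zeroˡ (ψ (suc i) 0))) (ℚ.*-zeroʳ X)))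
        (trans (ℚ.+-identityʳ (s ^ᵠ (suc i / t) ℚ.+ h)) (cong (ℚ._+ h) (sym (trans (cong (s ^ᵠ (suc i / t) ℚ.+_) (ℚ.*-zeroˡ (ψ i 0)))
          (ℚ.+-identityʳ (s ^ᵠ (suc i / t)))))))
      telescope (suc n) = trans (cong (ψ i (suc n) ℚ.+_) (trans (const-⊠ X (var ⊠ ψ (suc i)) (suc n))
          (cong (X ℚ.*_) (var-⊠ (ψ (suc i)) (suc n)))))
        (trans (ψ-telescope i n) (trans (cong (ψ (suc i) (suc n) ℚ.+_) (sym (var-⊠ (ψ i) (suc n)))) (sym (ℚ.+-identityʳ _))))

    ψ-chain : ∀ i → i < t → pow 1-u i ⊠ ψ 0 ≈ pow 1-Xu i ⊠ ψ i
    ψ-chain zero    _     = λ _ → refl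
    ψ-chain (suc i) i+1<t = begin
      (1-u ⊠ pow 1-u i) ⊠ ψ 0     ≈⟨ R.*-assoc 1-u (pow 1-u i) (ψ 0) ⟩
      1-u ⊠ (pow 1-u i ⊠ ψ 0)     ≈⟨ R.*-congˡ {1-u} (ψ-chain i (ℕ.<⇒≤ i+1<t)) ⟩
      1-u ⊠ (pow 1-Xu i ⊠ ψ i)    ≈⟨ solve 3 (λ a b c → a :* (b :* c) := b :* (a :* c)) (λ _ → refl) 1-u (pow 1-Xu i) (ψ i) ⟩
      pow 1-Xu i ⊠ (1-u ⊠ ψ i)    ≈⟨ R.*-congˡ {pow 1-Xu i} (ψ-advance i 0ℚ (trans (cong (s ^ᵠ_)
                                       (trans (m<n⇒m/n≡0 (ℕ.<⇒≤ i+1<t)) (sym (m<n⇒m/n≡0 i+1<t)))) (sym (ℚ.+-identityʳ _)))) ⟩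
      pow 1-Xu i ⊠ (1-Xu ⊠ ψ (suc i) ⊞ const 0ℚ)
        ≈⟨ solve 3 (λ b a c → b :* (a :* c :+ con 0ℚ) := (a :* b) :* c) (λ _ → refl) (pow 1-Xu i) 1-Xu (ψ (suc i)) ⟩
      (1-Xu ⊠ pow 1-Xu i) ⊠ ψ (suc i) ∎

    -- From offset t - 1 to t the floor increases, so the jump is 1 - s; and ψ t = s ψ 0 closes the
    -- chain of offsets to a cycle, which determines ψ 0.
    ψ-wrap : 1-u ⊠ ψ t′ ≈ 1-Xu ⊠ (const s ⊠ ψ 0) ⊞ const (1ℚ ℚ.- s)
    ψ-wrap = R.trans
      (ψ-advance t′ (1ℚ ℚ.- s) (trans (cong (s ^ᵠ_) (m<n⇒m/n≡0 {t′} ℕ.≤-refl))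
        (trans (Q.solve 1 (λ s → Q.con 1ℚ Q.:= s Q.:* Q.con 1ℚ Q.:+ (Q.con 1ℚ Q.:- s)) refl s)
          (cong (λ k → s ^ᵠ k ℚ.+ (1ℚ ℚ.- s)) (sym (n/n≡1 t))))))
      (R.+-congʳ {const (1ℚ ℚ.- s)} (R.*-congˡ {1-Xu} λ n →
        trans (cong (λ m → ψ m n) (sym (ℕ.*-identityˡ t))) (trans (ψ-dilate 0 1 n)
          (trans (cong (ℚ._* ψ 0 n) (ℚ.*-identityʳ s)) (sym (const-⊠ s (ψ 0) n))))))

    -- The zero word is the only one that violates ⌈Σ / t⌉ = ⌊(Σ ∸ 1) / t⌋ + 1.
    Λ-shift : const s ⊠ Λ ≈ ψ t′ ⊞ λ _ → s ℚ.- 1ℚ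
    Λ-shift n = trans (trans (const-⊠ s Λ n) (sym (sumWords-⊗ L n s _)))
      (trans (sumWords-≗ L n λ W → term (sum W))
        (trans (sumWords-⊕ L n _ _) (cong (ψ t′ n ℚ.+_) (trans (sumWords-⊗ L n (s ℚ.- 1ℚ) (λ W → [ sum W ℕ.≟ 0 ]))
          (trans (cong ((s ℚ.- 1ℚ) ℚ.*_) (zero-word n)) (ℚ.*-identityʳ (s ℚ.- 1ℚ)))))))
      where
      term : ∀ m → s ℚ.* s ^ᵠ ((m ∸ 1) / t) ≡ s ^ᵠ ((m + t′) / t) ℚ.+ (s ℚ.- 1ℚ) ℚ.* [ m ℕ.≟ 0 ]
      term zero    = trans (cong (λ k → s ℚ.* s ^ᵠ k) (m<n⇒m/n≡0 {0} {t} (s≤s z≤n)))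
        (trans (Q.solve 1 (λ s → s Q.:* Q.con 1ℚ Q.:= Q.con 1ℚ Q.:+ (s Q.:- Q.con 1ℚ) Q.:* Q.con 1ℚ) refl s)
          (cong (λ k → s ^ᵠ k ℚ.+ (s ℚ.- 1ℚ) ℚ.* 1ℚ) (sym (m<n⇒m/n≡0 {t′} ℕ.≤-refl))))
      term (suc m) = trans (cong (s ^ᵠ_) (sym (trans (cong (_/ t) (sym (ℕ.+-suc m t′)))
          (trans (cong (λ k → (m + k) / t) (sym (ℕ.*-identityˡ t)))
            (trans (+-distrib-/-∣ʳ m (divides 1 refl)) (trans (cong (m / t +_) (m*n/n≡m 1 t)) (ℕ.+-comm (m / t) 1)))))))
        (sym (trans (cong (s ^ᵠ ((suc m + t′) / t) ℚ.+_) (ℚ.*-zeroʳ (s ℚ.- 1ℚ))) (ℚ.+-identityʳ _)))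
      zero-word : ∀ n → sumWords L n (λ W → [ sum W ℕ.≟ 0 ]) ≡ 1ℚ
      zero-word zero    = refl
      zero-word (suc n) = trans (sumTo-head (r * t) _) (trans (cong₂ ℚ._+_ (zero-word n)
        (trans (sumTo-cong (r * t) λ _ → sumWords-0 L n) (sumTo-0 (r * t)))) (ℚ.+-identityʳ 1ℚ))

    module _ (s≢0 : s ≢ 0ℚ) where

      -- The correction (s - 1)/(1 - u) for the zero words in `Λ-shift` becomes the constant s - 1
      -- and cancels the jump 1 - s of `ψ-wrap`.
      1-u⊠Λ : 1-u ⊠ Λ ≈ 1-Xu ⊠ ψ 0
      1-u⊠Λ = ⊠-cancelˡ {const s} (ℚ-cancelˡ s≢0) (begin
        const s ⊠ (1-u ⊠ Λ)
          ≈⟨ solve 3 (λ s a l → s :* (a :* l) := a :* (s :* l)) (λ _ → refl) (const s) 1-u Λ ⟩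
        1-u ⊠ (const s ⊠ Λ)
          ≈⟨ R.trans (R.*-congˡ {1-u} Λ-shift) (⊠-distribˡ 1-u (ψ t′) (λ _ → s ℚ.- 1ℚ)) ⟩
        1-u ⊠ ψ t′ ⊞ 1-u ⊠ (λ _ → s ℚ.- 1ℚ)
          ≈⟨ R.+-cong ψ-wrap constant ⟩
        1-Xu ⊠ (const s ⊠ ψ 0) ⊞ const (1ℚ ℚ.- s) ⊞ const (s ℚ.- 1ℚ)
          ≈⟨ R.trans (R.+-assoc (1-Xu ⊠ (const s ⊠ ψ 0)) (const (1ℚ ℚ.- s)) (const (s ℚ.- 1ℚ)))
               (R.+-congˡ {1-Xu ⊠ (const s ⊠ ψ 0)} (R.sym (_-Raw-AlmostCommutative⟶_.+-homo const-homomorphism (1ℚ ℚ.- s) (s ℚ.- 1ℚ)))) ⟩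
        1-Xu ⊠ (const s ⊠ ψ 0) ⊞ const ((1ℚ ℚ.- s) ℚ.+ (s ℚ.- 1ℚ))
          ≈⟨ R.+-congˡ {1-Xu ⊠ (const s ⊠ ψ 0)} (λ n → cong (λ a → const a n)
               (Q.solve 1 (λ s → (Q.con 1ℚ Q.:- s) Q.:+ (s Q.:- Q.con 1ℚ) Q.:= Q.con 0ℚ) refl s)) ⟩
        1-Xu ⊠ (const s ⊠ ψ 0) ⊞ const 0ℚ
          ≈⟨ solve 3 (λ s a l → a :* (s :* l) :+ con 0ℚ := s :* (a :* l)) (λ _ → refl) (const s) 1-Xu (ψ 0) ⟩
        const s ⊠ (1-Xu ⊠ ψ 0) ∎)
        where
        constant : ∀ {a} → 1-u ⊠ (λ _ → a) ≈ const a
        constant {a} n = trans (R.*-congʳ {λ _ → a} 1-u≈one-minus n)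
          (one-minus-solve {1ℚ} {var} {λ _ → a} {const a} (λ m → sym (trans (cong (const a m ℚ.+_)
            (trans (ℚ.*-identityˡ _) (var-⊠ (λ _ → a) m))) (split m))) n)
          where
          1-u≈one-minus : 1-u ≈ one-minus 1ℚ var
          1-u≈one-minus = R.sym (R.trans (one-minus≈ 1ℚ var) (R.+-congˡ {const 1ℚ} (R.-‿cong (R.*-identityˡ var))))
          split : ∀ m → const a m ℚ.+ shift (λ _ → a) m ≡ a
          split zero    = ℚ.+-identityʳ a
          split (suc m) = ℚ.+-identityˡ a

      lattice-series : Λ ⊠ den t ≈ num t
      lattice-series = begin
        Λ ⊠ (1-u ⊠ (1-u ⊠ pow 1-u t′ ⊟ const s ⊠ pow 1-Xu t))
          ≈⟨ solve 5 (λ l a b s c → l :* (a :* (a :* b :- s :* c)) := a :* (b :* (a :* l)) :- s :* c :* (a :* l))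
               (λ _ → refl) Λ 1-u (pow 1-u t′) (const s) (pow 1-Xu t) ⟩
        1-u ⊠ (pow 1-u t′ ⊠ (1-u ⊠ Λ)) ⊟ const s ⊠ pow 1-Xu t ⊠ (1-u ⊠ Λ)
          ≈⟨ R.+-cong (R.*-congˡ {1-u} (R.*-congˡ {pow 1-u t′} 1-u⊠Λ))
               (R.-‿cong (R.*-congˡ {const s ⊠ pow 1-Xu t} 1-u⊠Λ)) ⟩
        1-u ⊠ (pow 1-u t′ ⊠ (1-Xu ⊠ ψ 0)) ⊟ const s ⊠ pow 1-Xu t ⊠ (1-Xu ⊠ ψ 0)
          ≈⟨ R.+-congʳ {negate (const s ⊠ pow 1-Xu t ⊠ (1-Xu ⊠ ψ 0))} (begin
               1-u ⊠ (pow 1-u t′ ⊠ (1-Xu ⊠ ψ 0))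
                 ≈⟨ solve 4 (λ a b c d → a :* (b :* (c :* d)) := a :* (c :* (b :* d))) (λ _ → refl) 1-u (pow 1-u t′) 1-Xu (ψ 0) ⟩
               1-u ⊠ (1-Xu ⊠ (pow 1-u t′ ⊠ ψ 0))
                 ≈⟨ R.*-congˡ {1-u} (R.*-congˡ {1-Xu} (ψ-chain t′ ℕ.≤-refl)) ⟩
               1-u ⊠ (1-Xu ⊠ (pow 1-Xu t′ ⊠ ψ t′))
                 ≈⟨ solve 4 (λ a b c d → a :* (b :* (c :* d)) := (b :* c) :* (a :* d)) (λ _ → refl) 1-u 1-Xu (pow 1-Xu t′) (ψ t′) ⟩
               pow 1-Xu t ⊠ (1-u ⊠ ψ t′)
                 ≈⟨ R.*-congˡ {pow 1-Xu t} ψ-wrap ⟩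
               pow 1-Xu t ⊠ (1-Xu ⊠ (const s ⊠ ψ 0) ⊞ const (1ℚ ℚ.- s)) ∎) ⟩
        pow 1-Xu t ⊠ (1-Xu ⊠ (const s ⊠ ψ 0) ⊞ const (1ℚ ℚ.- s)) ⊟ const s ⊠ pow 1-Xu t ⊠ (1-Xu ⊠ ψ 0)
          ≈⟨ solve 5 (λ p a s q d → p :* (a :* (s :* q) :+ d) :- s :* p :* (a :* q) := d :* p)
               (λ _ → refl) (pow 1-Xu t) 1-Xu (const s) (ψ 0) (const (1ℚ ℚ.- s)) ⟩
        const (1ℚ ℚ.- s) ⊠ pow 1-Xu t ∎

      -- Both series solve the same linear equation, and its coefficient `den t` has the constant
      -- term 1 - s, which is not zero.
      excedances≡lattice : ∀ n → sumWords L n (weight L []) ≡ Λ n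
      excedances≡lattice n = trans (sym (Ω-no-star L n)) (⊠-cancelˡ {den t} den₀-cancel (begin
          den t ⊠ Ω L 0   ≈⟨ R.*-comm (den t) (Ω L 0) ⟩
          Ω L 0 ⊠ den t   ≈⟨ excedance-series t ⟩
          num t           ≈⟨ lattice-series ⟨
          Λ ⊠ den t       ≈⟨ R.*-comm Λ (den t) ⟩
          den t ⊠ Λ       ∎) n)
        where
        pow₀ : ∀ {f} k → f 0 ≡ 1ℚ → pow f k 0 ≡ 1ℚ
        pow₀ zero    f₀ = refl
        pow₀ (suc k) f₀ = trans (cong₂ ℚ._*_ f₀ (pow₀ k f₀)) (ℚ.*-identityˡ 1ℚ)
        den₀≡ : den t 0 ≡ 1ℚ ℚ.- s
        den₀≡ = trans (ℚ.*-identityˡ (Δ t 0)) (cong₂ (λ a b → a ℚ.+ (ℚ.- b)) (pow₀ {1-u} t refl)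
          (trans (cong (s ℚ.*_) (pow₀ {1-Xu} t (one-minus-var₀ X))) (ℚ.*-identityʳ s)))
        den₀-cancel : ∀ {a b} → den t 0 ℚ.* a ≡ den t 0 ℚ.* b → a ≡ b
        den₀-cancel = ℚ-cancelˡ (λ eq → s≢1 (trans (sym den₀≡) eq))

-- Integers as rationals

module _ where
  open import Data.Rational.Unnormalised as ℚᵘ using (mkℚᵘ; *≡*)
  import Data.Rational.Unnormalised.Properties as ℚᵘ

  toℚᵘ-fromℤ : ∀ z → ℚ.toℚᵘ (fromℤ z) ℚᵘ.≃ mkℚᵘ z 0
  toℚᵘ-fromℤ z = ℚ.toℚᵘ-fromℚᵘ (mkℚᵘ z 0)

  fromℤ-+ : ∀ a b → fromℤ (a ℤ.+ b) ≡ fromℤ a ℚ.+ fromℤ b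
  fromℤ-+ a b = ℚ.toℚᵘ-injective (ℚᵘ.≃-trans (toℚᵘ-fromℤ (a ℤ.+ b)) (ℚᵘ.≃-trans
    (*≡* (cong (ℤ._* ℤ.+ 1) (sym (cong₂ ℤ._+_ (ℤ.*-identityʳ a) (ℤ.*-identityʳ b)))))
    (ℚᵘ.≃-sym (ℚᵘ.≃-trans (ℚ.toℚᵘ-homo-+ (fromℤ a) (fromℤ b)) (ℚᵘ.+-cong (toℚᵘ-fromℤ a) (toℚᵘ-fromℤ b))))))

  fromℤ-* : ∀ a b → fromℤ (a ℤ.* b) ≡ fromℤ a ℚ.* fromℤ b
  fromℤ-* a b = ℚ.toℚᵘ-injective (ℚᵘ.≃-trans (toℚᵘ-fromℤ (a ℤ.* b))
    (ℚᵘ.≃-sym (ℚᵘ.≃-trans (ℚ.toℚᵘ-homo-* (fromℤ a) (fromℤ b)) (ℚᵘ.*-cong (toℚᵘ-fromℤ a) (toℚᵘ-fromℤ b)))))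

  fromℤ-mono-≤ : ∀ {a b} → a ℤ.≤ b → fromℤ a ℚ.≤ fromℤ b
  fromℤ-mono-≤ {a} {b} a≤b = ℚ.toℚᵘ-cancel-≤ (ℚᵘ.≤-respˡ-≃ (ℚᵘ.≃-sym (toℚᵘ-fromℤ a)) (ℚᵘ.≤-respʳ-≃ (ℚᵘ.≃-sym (toℚᵘ-fromℤ b))
    (ℚᵘ.*≤* (ℤ.*-monoʳ-≤-nonNeg (ℤ.+ 1) a≤b))))

  fromℤ-mono-< : ∀ {a b} → a ℤ.< b → fromℤ a ℚ.< fromℤ b
  fromℤ-mono-< {a} {b} a<b = ℚ.toℚᵘ-cancel-< (ℚᵘ.<-respˡ-≃ (ℚᵘ.≃-sym (toℚᵘ-fromℤ a)) (ℚᵘ.<-respʳ-≃ (ℚᵘ.≃-sym (toℚᵘ-fromℤ b))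
    (ℚᵘ.*<* (ℤ.*-monoʳ-<-pos (ℤ.+ 1) a<b))))

  /-cancel : ∀ z d .{{_ : NonZero d}} → fromℕ d ℚ.* (z ℚ./ d) ≡ fromℤ z
  /-cancel z (suc d) = ℚ.toℚᵘ-injective (ℚᵘ.≃-trans (ℚ.toℚᵘ-homo-* (fromℕ (suc d)) (z ℚ./ suc d))
    (ℚᵘ.≃-trans (ℚᵘ.*-cong (toℚᵘ-fromℤ (ℤ.+ suc d)) (ℚ.toℚᵘ-fromℚᵘ (mkℚᵘ z d)))
      (ℚᵘ.≃-trans (*≡* cross) (ℚᵘ.≃-sym (toℚᵘ-fromℤ z)))))
    where
    cross : (ℤ.+ suc d ℤ.* z) ℤ.* ℤ.+ 1 ≡ z ℤ.* ℤ.+ suc (d + 0)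
    cross = trans (ℤ.*-identityʳ (ℤ.+ suc d ℤ.* z)) (trans (ℤ.*-comm (ℤ.+ suc d) z)
      (cong (λ e → z ℤ.* ℤ.+ suc e) (sym (ℕ.+-identityʳ d))))

fromℤ-cancel-≤ : ∀ {a b} → fromℤ a ℚ.≤ fromℤ b → a ℤ.≤ b
fromℤ-cancel-≤ {a} {b} p with a ℤ.≤? b
... | yes a≤b = a≤b
... | no  a≰b = contradiction (ℚ.<-≤-trans (fromℤ-mono-< (ℤ.≰⇒> a≰b)) p) (ℚ.<-irrefl refl)

fromℤ-cancel-< : ∀ {a b} → fromℤ a ℚ.< fromℤ b → a ℤ.< b
fromℤ-cancel-< {a} {b} p with a ℤ.<? b
... | yes a<b = a<b
... | no  a≮b = contradiction (ℚ.<-≤-trans p (fromℤ-mono-≤ (ℤ.≮⇒≥ a≮b))) (ℚ.<-irrefl refl)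

fromℕ-+ : ∀ m n → fromℕ (m + n) ≡ fromℕ m ℚ.+ fromℕ n
fromℕ-+ m n = fromℤ-+ (ℤ.+ m) (ℤ.+ n)

fromℕ-* : ∀ m n → fromℕ (m * n) ≡ fromℕ m ℚ.* fromℕ n
fromℕ-* m n = trans (cong fromℤ (ℤ.pos-* m n)) (fromℤ-* (ℤ.+ m) (ℤ.+ n))

fromℕ-injective : ∀ {m n} → fromℕ m ≡ fromℕ n → m ≡ n
fromℕ-injective eq = ℤ.+-injective (ℤ.≤-antisym (fromℤ-cancel-≤ (ℚ.≤-reflexive eq)) (fromℤ-cancel-≤ (ℚ.≤-reflexive (sym eq))))

fromℕ-mono-≤ : ∀ {m n} → m ≤ n → fromℕ m ℚ.≤ fromℕ n
fromℕ-mono-≤ m≤n = fromℤ-mono-≤ (ℤ.+≤+ m≤n)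

fromℕ-mono-< : ∀ {m n} → m < n → fromℕ m ℚ.< fromℕ n
fromℕ-mono-< m<n = fromℤ-mono-< (ℤ.+<+ m<n)

-- Polynomials as coefficient lists

open import Data.Rational.Solver using (module +-*-Solver)
open +-*-Solver using (solve; con; _:+_; _:*_; _:-_; _:=_)

infixl 6 _+ᴾ_

_+ᴾ_ : Polynomial → Polynomial → Polynomial
[]      +ᴾ q       = q
(a ∷ p) +ᴾ []      = a ∷ p
(a ∷ p) +ᴾ (b ∷ q) = a ℚ.+ b ∷ p +ᴾ q

scaleᴾ : ℚ → Polynomial → Polynomial
scaleᴾ c = List.map (c ℚ.*_)

eval-+ᴾ : ∀ p q x → eval (p +ᴾ q) x ≡ eval p x ℚ.+ eval q x
eval-+ᴾ []      q       x = sym (ℚ.+-identityˡ (eval q x))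
eval-+ᴾ (a ∷ p) []      x = sym (ℚ.+-identityʳ _)
eval-+ᴾ (a ∷ p) (b ∷ q) x = trans (cong (λ e → (a ℚ.+ b) ℚ.+ x ℚ.* e) (eval-+ᴾ p q x))
  (solve 5 (λ a b x p q → (a :+ b) :+ x :* (p :+ q) := (a :+ x :* p) :+ (b :+ x :* q)) refl a b x (eval p x) (eval q x))

eval-scaleᴾ : ∀ c p x → eval (scaleᴾ c p) x ≡ c ℚ.* eval p x
eval-scaleᴾ c []      x = sym (ℚ.*-zeroʳ c)
eval-scaleᴾ c (a ∷ p) x = trans (cong (λ e → c ℚ.* a ℚ.+ x ℚ.* e) (eval-scaleᴾ c p x))
  (solve 4 (λ c a x p → c :* a :+ x :* (c :* p) := c :* (a :+ x :* p)) refl c a x (eval p x))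

-- Synthetic division by x - a: the coefficients of the quotient are the intermediate values of
-- Horner's scheme at `a`.
quotient : ℚ → Polynomial → Polynomial
quotient a []          = []
quotient a (c ∷ [])    = []
quotient a (c ∷ d ∷ p) = eval (d ∷ p) a ∷ quotient a (d ∷ p)

eval-quotient : ∀ a p x → eval p x ≡ eval p a ℚ.+ (x ℚ.- a) ℚ.* eval (quotient a p) x
eval-quotient a []          x = solve 2 (λ a x → con 0ℚ := con 0ℚ :+ (x :- a) :* con 0ℚ) refl a x
eval-quotient a (c ∷ [])    x = solve 3 (λ c a x → c :+ x :* con 0ℚ := c :+ a :* con 0ℚ :+ (x :- a) :* con 0ℚ) refl c a x
eval-quotient a (c ∷ d ∷ p) x = trans (cong (λ e → c ℚ.+ x ℚ.* e) (eval-quotient a (d ∷ p) x))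
  (solve 5 (λ c a x v q → c :+ x :* (v :+ (x :- a) :* q) := (c :+ a :* v) :+ (x :- a) :* (v :+ x :* q)) refl
    c a x (eval (d ∷ p) a) (eval (quotient a (d ∷ p)) x))

length-quotient : ∀ a c p → length (quotient a (c ∷ p)) ≡ length p
length-quotient a c []      = refl
length-quotient a c (d ∷ p) = cong suc (length-quotient a d p)

-- Dividing by the root `m` leaves a shorter polynomial that still vanishes from `suc m` on.
eval-vanishes : ∀ n p m → length p ≡ n → (∀ t → m ≤ t → eval p (fromℕ t) ≡ 0ℚ) → ∀ x → eval p x ≡ 0ℚ
eval-vanishes n       []      m len root x = refl
eval-vanishes (suc n) (c ∷ p) m len root x = trans (factor x)
  (trans (cong ((x ℚ.- a) ℚ.*_) (eval-vanishes n q (suc m)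
      (trans (length-quotient a c p) (ℕ.suc-injective len)) root-q x))
    (ℚ.*-zeroʳ (x ℚ.- a)))
  where
  a = fromℕ m
  q = quotient a (c ∷ p)
  factor : ∀ x → eval (c ∷ p) x ≡ (x ℚ.- a) ℚ.* eval q x
  factor x = trans (eval-quotient a (c ∷ p) x) (trans (cong (ℚ._+ (x ℚ.- a) ℚ.* eval q x) (root m ℕ.≤-refl)) (ℚ.+-identityˡ _))
  root-q : ∀ t → suc m ≤ t → eval q (fromℕ t) ≡ 0ℚ
  root-q t m<t = ℚ-cancelˡ {fromℕ t ℚ.- a} nonzero
    (trans (sym (factor (fromℕ t))) (trans (root t (ℕ.<⇒≤ m<t)) (sym (ℚ.*-zeroʳ (fromℕ t ℚ.- a)))))
    where
    nonzero : fromℕ t ℚ.- a ≢ 0ℚ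
    nonzero eq = ℕ.<⇒≢ m<t (fromℕ-injective (trans (sym (ℚ.+-identityˡ a))
      (trans (cong (ℚ._+ a) (sym eq)) (solve 2 (λ t a → t :- a :+ a := t) refl (fromℕ t) a))))

eval-unique : ∀ p q m → (∀ t → m ≤ t → eval p (fromℕ t) ≡ eval q (fromℕ t)) → ∀ x → eval p x ≡ eval q x
eval-unique p q m eq x = trans (solve 2 (λ a b → a := (a :+ con (ℚ.- 1ℚ) :* b) :+ b) refl (eval p x) (eval q x))
  (trans (cong (ℚ._+ eval q x) (trans (sym (eval-d x)) (eval-vanishes _ d m refl root x))) (ℚ.+-identityˡ (eval q x)))
  where
  d = p +ᴾ scaleᴾ (ℚ.- 1ℚ) q
  eval-d : ∀ x → eval d x ≡ eval p x ℚ.+ (ℚ.- 1ℚ) ℚ.* eval q x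
  eval-d x = trans (eval-+ᴾ p (scaleᴾ (ℚ.- 1ℚ) q) x) (cong (eval p x ℚ.+_) (eval-scaleᴾ (ℚ.- 1ℚ) q x))
  root : ∀ t → m ≤ t → eval d (fromℕ t) ≡ 0ℚ
  root t m≤t = trans (eval-d (fromℕ t)) (trans (cong (ℚ._+ (ℚ.- 1ℚ) ℚ.* eval q (fromℕ t)) (eq t m≤t))
    (solve 1 (λ a → a :+ con (ℚ.- 1ℚ) :* a := con 0ℚ) refl (eval q (fromℕ t))))

coefficient : Polynomial → ℕ → ℚ
coefficient []      e       = 0ℚ
coefficient (a ∷ p) zero    = a
coefficient (a ∷ p) (suc e) = coefficient p e

coefficient-+ᴾ : ∀ p q e → coefficient (p +ᴾ q) e ≡ coefficient p e ℚ.+ coefficient q e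
coefficient-+ᴾ []      q       e       = sym (ℚ.+-identityˡ _)
coefficient-+ᴾ (a ∷ p) []      e       = sym (ℚ.+-identityʳ _)
coefficient-+ᴾ (a ∷ p) (b ∷ q) zero    = refl
coefficient-+ᴾ (a ∷ p) (b ∷ q) (suc e) = coefficient-+ᴾ p q e

coefficient-scaleᴾ : ∀ c p e → coefficient (scaleᴾ c p) e ≡ c ℚ.* coefficient p e
coefficient-scaleᴾ c []      e       = sym (ℚ.*-zeroʳ c)
coefficient-scaleᴾ c (a ∷ p) zero    = refl
coefficient-scaleᴾ c (a ∷ p) (suc e) = coefficient-scaleᴾ c p e

-- The value at 0 shows that the constant term is 0; then the factor x can be cancelled at the
-- points t ≥ 1, and the remaining coefficients follow by induction.
coefficient-vanishes : ∀ p m → (∀ t → m ≤ t → eval p (fromℕ t) ≡ 0ℚ) → ∀ e → coefficient p e ≡ 0ℚ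
coefficient-vanishes []      m root e       = refl
coefficient-vanishes (a ∷ p) m root e       = go e
  where
  everywhere : ∀ x → eval (a ∷ p) x ≡ 0ℚ
  everywhere = eval-vanishes _ (a ∷ p) m refl root
  a≡0 : a ≡ 0ℚ
  a≡0 = trans (solve 2 (λ a p → a := a :+ con 0ℚ :* p) refl a (eval p 0ℚ)) (everywhere 0ℚ)
  go : ∀ e → coefficient (a ∷ p) e ≡ 0ℚ
  go zero    = a≡0
  go (suc e) = coefficient-vanishes p 1 (λ t 0<t → ℚ-cancelˡ {fromℕ t}
    (λ eq → ℕ.<⇒≢ 0<t (fromℕ-injective (sym eq)))
    (trans (sym (trans (cong (ℚ._+ fromℕ t ℚ.* eval p (fromℕ t)) a≡0) (ℚ.+-identityˡ _)))
      (trans (everywhere (fromℕ t)) (sym (ℚ.*-zeroʳ (fromℕ t)))))) e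

coefficient-unique : ∀ p q m → (∀ t → m ≤ t → eval p (fromℕ t) ≡ eval q (fromℕ t)) →
                     ∀ e → coefficient p e ≡ coefficient q e
coefficient-unique p q m eq e =
  trans (solve 2 (λ a b → a := (a :+ con (ℚ.- 1ℚ) :* b) :+ b) refl (coefficient p e) (coefficient q e))
    (trans (cong (ℚ._+ coefficient q e) (trans (sym coefficient-d) (coefficient-vanishes d m root e))) (ℚ.+-identityˡ _))
  where
  d = p +ᴾ scaleᴾ (ℚ.- 1ℚ) q
  coefficient-d : coefficient d e ≡ coefficient p e ℚ.+ (ℚ.- 1ℚ) ℚ.* coefficient q e
  coefficient-d = trans (coefficient-+ᴾ p (scaleᴾ (ℚ.- 1ℚ) q) e) (cong (coefficient p e ℚ.+_) (coefficient-scaleᴾ (ℚ.- 1ℚ) q e))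
  root : ∀ t → m ≤ t → eval d (fromℕ t) ≡ 0ℚ
  root t m≤t = trans (eval-+ᴾ p (scaleᴾ (ℚ.- 1ℚ) q) (fromℕ t))
    (trans (cong₂ ℚ._+_ (eq t m≤t) (eval-scaleᴾ (ℚ.- 1ℚ) q (fromℕ t)))
      (solve 1 (λ a → a :+ con (ℚ.- 1ℚ) :* a := con 0ℚ) refl (eval q (fromℕ t))))

monomial : ℕ → Polynomial
monomial zero    = 1ℚ ∷ []
monomial (suc e) = 0ℚ ∷ monomial e

eval-monomial : ∀ e x → eval (monomial e) x ≡ x ^ᵠ e
eval-monomial zero    x = trans (cong (1ℚ ℚ.+_) (ℚ.*-zeroʳ x)) (ℚ.+-identityʳ 1ℚ)
eval-monomial (suc e) x = trans (ℚ.+-identityˡ _) (cong (x ℚ.*_) (eval-monomial e x))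

coefficient-monomial : ∀ h e → coefficient (monomial h) e ≡ fromℕ (ι (h ℕ.≟ e))
coefficient-monomial zero    zero    = refl
coefficient-monomial zero    (suc e) = refl
coefficient-monomial (suc h) zero    = refl
coefficient-monomial (suc h) (suc e) = coefficient-monomial h e

-- Polynomials equal to the counting sequence B

-- The coefficient of zᵗ in zᵈ (1 − z)⁻ⁿ⁻¹.
B : ℕ → ℕ → ℕ → ℕ
B zero    d t       = ι (d ℕ.≤? t)
B (suc n) d zero    = B n d zero
B (suc n) d (suc t) = B (suc n) d t + B n d (suc t)

infixl 7 _/ⁿ_

_/ⁿ_ : ℚ → ℕ → ℚ
q /ⁿ n = q ℚ.* (ℤ.+ 1 ℚ./ suc n)

/ⁿ-cancel : ∀ q n → fromℕ (suc n) ℚ.* (q /ⁿ n) ≡ q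
/ⁿ-cancel q n = trans (solve 3 (λ m q i → m :* (q :* i) := q :* (m :* i)) refl (fromℕ (suc n)) q (ℤ.+ 1 ℚ./ suc n))
  (trans (cong (q ℚ.*_) (/-cancel (ℤ.+ 1) (suc n))) (ℚ.*-identityʳ q))

-- (y + 1) ⋯ (y + n) / n!
rising : ℕ → ℚ → ℚ
rising zero    y = 1ℚ
rising (suc n) y = (y ℚ.+ fromℕ (suc n)) ℚ.* rising n y /ⁿ n

fromℕ-suc : ∀ n → fromℕ (suc n) ≡ 1ℚ ℚ.+ fromℕ n
fromℕ-suc n = fromℕ-+ 1 n

-- Both sides are (y + 1) ⋯ (y + n + 1) / n!.
rising-shift : ∀ n y → rising n (y ℚ.+ 1ℚ) ℚ.* (y ℚ.+ 1ℚ) ≡ rising n y ℚ.* (y ℚ.+ fromℕ (suc n))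
rising-shift zero    y = refl
rising-shift (suc n) y = trans
  (solve 4 (λ y k r i → (y :+ con 1ℚ :+ k) :* r :* i :* (y :+ con 1ℚ) := (y :+ (con 1ℚ :+ k)) :* i :* (r :* (y :+ con 1ℚ)))
      refl y (fromℕ (suc n)) (rising n (y ℚ.+ 1ℚ)) (ℤ.+ 1 ℚ./ suc n))
  (trans (cong₂ (λ a b → (y ℚ.+ a) ℚ.* (ℤ.+ 1 ℚ./ suc n) ℚ.* b) (sym (fromℕ-suc (suc n))) (rising-shift n y))
    (solve 5 (λ y k k′ r i → (y :+ k′) :* i :* (r :* (y :+ k)) := (y :+ k) :* r :* i :* (y :+ k′))
        refl y (fromℕ (suc n)) (fromℕ (2 + n)) (rising n y) (ℤ.+ 1 ℚ./ suc n)))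

suc≢0ℚ : ∀ n → fromℕ (suc n) ≢ 0ℚ
suc≢0ℚ n eq with () ← fromℕ-injective {suc n} {0} eq

rising-pascal : ∀ n y → rising (suc n) (y ℚ.+ 1ℚ) ≡ rising (suc n) y ℚ.+ rising n (y ℚ.+ 1ℚ)
rising-pascal n y = ℚ-cancelˡ (suc≢0ℚ n) (trans (/ⁿ-cancel ((y ℚ.+ 1ℚ ℚ.+ fromℕ (suc n)) ℚ.* rising n (y ℚ.+ 1ℚ)) n)
  (trans (solve 3 (λ y k r → (y :+ con 1ℚ :+ k) :* r := r :* (y :+ con 1ℚ) :+ k :* r) refl y (fromℕ (suc n)) (rising n (y ℚ.+ 1ℚ)))
    (trans (cong (ℚ._+ fromℕ (suc n) ℚ.* rising n (y ℚ.+ 1ℚ))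
        (trans (rising-shift n y) (trans (ℚ.*-comm (rising n y) (y ℚ.+ fromℕ (suc n))) (sym (/ⁿ-cancel ((y ℚ.+ fromℕ (suc n)) ℚ.* rising n y) n)))))
      (sym (ℚ.*-distribˡ-+ (fromℕ (suc n)) (rising (suc n) y) (rising n (y ℚ.+ 1ℚ)))))))

rising-suc-0 : ∀ n y → y ℚ.+ fromℕ (suc n) ≡ 0ℚ → rising (suc n) y ≡ 0ℚ
rising-suc-0 n y eq = trans (cong (λ e → e ℚ.* rising n y /ⁿ n) eq)
  (trans (cong (_/ⁿ n) (ℚ.*-zeroˡ (rising n y))) (ℚ.*-zeroˡ (ℤ.+ 1 ℚ./ suc n)))

B-zero : ∀ n {d t} → t < d → B n d t ≡ 0
B-zero zero    {d} {t}     t<d = if-no (d ℕ.≤? t) (ℕ.<⇒≱ t<d)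
B-zero (suc n) {d} {zero}  t<d = B-zero n t<d
B-zero (suc n) {d} {suc t} t<d = cong₂ _+_ (B-zero (suc n) (ℕ.<⇒≤ t<d)) (B-zero n t<d)

fromℕ-difference : ∀ {d} t m → d ≡ t + m → fromℕ t ℚ.- fromℕ d ℚ.+ fromℕ m ≡ 0ℚ
fromℕ-difference t m refl = trans (cong (λ e → fromℕ t ℚ.- e ℚ.+ fromℕ m) (fromℕ-+ t m))
  (solve 2 (λ t m → t :- (t :+ m) :+ m := con 0ℚ) refl (fromℕ t) (fromℕ m))

-- Both sides are C(t - d + n, n) and obey Pascal's rule. For t < d ≤ t + n the polynomial has a
-- vanishing factor, as it must; for d > t + n it has none, whence the bound. If d ≤ n, the equation
-- thus reaches down to t = 0.
B≡rising : ∀ n d t → d ≤ t + n → fromℕ (B n d t) ≡ rising n (fromℕ t ℚ.- fromℕ d)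
B≡rising zero d t d≤t+0 = cong fromℕ (if-yes (d ℕ.≤? t) (subst (d ≤_) (ℕ.+-identityʳ t) d≤t+0))
B≡rising (suc n) d t d≤ with ℕ.m≤n⇒m<n∨m≡n d≤
... | inj₂ refl = trans (cong fromℕ (B-zero (suc n) {t + suc n} {t} (ℕ.m<m+n t (s≤s z≤n))))
      (sym (rising-suc-0 n (fromℕ t ℚ.- fromℕ (t + suc n)) (fromℕ-difference t (suc n) refl)))
B≡rising (suc n) d (suc t) _ | inj₁ d<  = trans (fromℕ-+ (B (suc n) d t) (B n d (suc t)))
  (trans (cong₂ ℚ._+_ (B≡rising (suc n) d t d≤) (trans (B≡rising n d (suc t) (subst (d ≤_) (ℕ.+-suc t n) d≤)) (cong (rising n) y+1)))
    (trans (sym (rising-pascal n (fromℕ t ℚ.- fromℕ d))) (cong (rising (suc n)) (sym y+1))))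
  where
  d≤ : d ≤ t + suc n
  d≤ = ℕ.≤-pred d<
  y+1 : fromℕ (suc t) ℚ.- fromℕ d ≡ fromℕ t ℚ.- fromℕ d ℚ.+ 1ℚ
  y+1 = trans (cong (ℚ._- fromℕ d) (fromℕ-suc t)) (solve 2 (λ t d → con 1ℚ :+ t :- d := t :- d :+ con 1ℚ) refl (fromℕ t) (fromℕ d))
-- At t = 0 Pascal's rule offers no earlier value. Here y = -d, and the product y · `B n d 0` is 0,
-- because `B n d 0` vanishes unless d = 0.
B≡rising (suc n) d zero _ | inj₁ (s≤s d≤n) = ℚ-cancelˡ (suc≢0ℚ n)
  (trans (solve 3 (λ k b y → k :* b := (y :+ k) :* b :+ con (ℚ.- 1ℚ) :* (y :* b)) refl (fromℕ (suc n)) (fromℕ (B n d 0)) y)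
    (trans (cong₂ (λ b z → (y ℚ.+ fromℕ (suc n)) ℚ.* b ℚ.+ (ℚ.- 1ℚ) ℚ.* z) (B≡rising n d 0 d≤n) (vanish d))
      (trans (solve 1 (λ a → a :+ con (ℚ.- 1ℚ) :* con 0ℚ := a) refl ((y ℚ.+ fromℕ (suc n)) ℚ.* rising n y))
        (sym (/ⁿ-cancel ((y ℚ.+ fromℕ (suc n)) ℚ.* rising n y) n)))))
  where
  y = fromℕ 0 ℚ.- fromℕ d
  vanish : ∀ d → (fromℕ 0 ℚ.- fromℕ d) ℚ.* fromℕ (B n d 0) ≡ 0ℚ
  vanish zero    = ℚ.*-zeroˡ (fromℕ (B n 0 0))
  vanish (suc d) = trans (cong (λ b → (fromℕ 0 ℚ.- fromℕ (suc d)) ℚ.* fromℕ b) (B-zero n (s≤s z≤n))) (ℚ.*-zeroʳ (fromℕ 0 ℚ.- fromℕ (suc d)))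

risingᴾ : ℕ → ℕ → Polynomial
risingᴾ zero    d = 1ℚ ∷ []
risingᴾ (suc n) d = scaleᴾ (ℤ.+ 1 ℚ./ suc n) (scaleᴾ (fromℕ (suc n) ℚ.- fromℕ d) (risingᴾ n d) +ᴾ (0ℚ ∷ risingᴾ n d))

eval-risingᴾ : ∀ n d x → eval (risingᴾ n d) x ≡ rising n (x ℚ.- fromℕ d)
eval-risingᴾ zero    d x = trans (cong (1ℚ ℚ.+_) (ℚ.*-zeroʳ x)) (ℚ.+-identityʳ 1ℚ)
eval-risingᴾ (suc n) d x = trans (eval-scaleᴾ i (scaleᴾ c p +ᴾ (0ℚ ∷ p)) x)
  (trans (cong (i ℚ.*_) (trans (eval-+ᴾ (scaleᴾ c p) (0ℚ ∷ p) x) (cong (ℚ._+ (0ℚ ℚ.+ x ℚ.* eval p x)) (eval-scaleᴾ c p x))))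
    (trans (solve 5 (λ i k d x p → i :* ((k :- d) :* p :+ (con 0ℚ :+ x :* p)) := (x :- d :+ k) :* p :* i) refl i (fromℕ (suc n)) (fromℕ d) x (eval p x))
      (cong (λ e → (x ℚ.- fromℕ d ℚ.+ fromℕ (suc n)) ℚ.* e ℚ.* i) (eval-risingᴾ n d x))))
  where
  i c : ℚ
  i = ℤ.+ 1 ℚ./ suc n
  c = fromℕ (suc n) ℚ.- fromℕ d
  p : Polynomial
  p = risingᴾ n d

-- Sums over lists and double counting

sumOver : {A : Set} → List A → (A → ℕ) → ℕ
sumOver xs h = sum (List.map h xs)

sumOver-cong : {A : Set} (xs : List A) {h k : A → ℕ} → (∀ {x} → x ∈ xs → h x ≡ k x) → sumOver xs h ≡ sumOver xs k
sumOver-cong []       eq = refl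
sumOver-cong (x ∷ xs) eq = cong₂ _+_ (eq (here refl)) (sumOver-cong xs (eq ∘ there))

sumOver-* : {A : Set} (c : ℕ) (xs : List A) (h : A → ℕ) → sumOver xs (λ x → c * h x) ≡ c * sumOver xs h
sumOver-* c []       h = sym (ℕ.*-zeroʳ c)
sumOver-* c (x ∷ xs) h = trans (cong (c * h x +_) (sumOver-* c xs h)) (sym (ℕ.*-distribˡ-+ c (h x) _))

sumOver-filter : {A : Set} {P : A → Set} (P? : ∀ x → Dec (P x)) (xs : List A) (h : A → ℕ) →
                 sumOver (List.filter P? xs) h ≡ sumOver xs (λ x → ι (P? x) * h x)
sumOver-filter P? []       h = refl
sumOver-filter P? (x ∷ xs) h with P? x
... | yes _ = cong₂ _+_ (sym (ℕ.*-identityˡ (h x))) (sumOver-filter P? xs h)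
... | no  _ = sumOver-filter P? xs h

length≡sumOver : {A : Set} (xs : List A) → length xs ≡ sumOver xs (λ _ → 1)
length≡sumOver []       = refl
length≡sumOver (x ∷ xs) = cong suc (length≡sumOver xs)

sumOver-++ : {A : Set} (xs ys : List A) (h : A → ℕ) → sumOver (xs ++ ys) h ≡ sumOver xs h + sumOver ys h
sumOver-++ []       ys h = refl
sumOver-++ (x ∷ xs) ys h = trans (cong (h x +_) (sumOver-++ xs ys h)) (sym (ℕ.+-assoc (h x) _ _))

sumOver-map : {A C : Set} (f : A → C) (xs : List A) (h : C → ℕ) → sumOver (List.map f xs) h ≡ sumOver xs (h ∘ f)
sumOver-map f []       h = refl
sumOver-map f (x ∷ xs) h = cong (h (f x) +_) (sumOver-map f xs h)

sumOver-cartesianProductWith : {A C D : Set} (f : A → C → D) (xs : List A) (ys : List C) (h : D → ℕ) →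
  sumOver (List.cartesianProductWith f xs ys) h ≡ sumOver xs λ x → sumOver ys λ y → h (f x y)
sumOver-cartesianProductWith f []       ys h = refl
sumOver-cartesianProductWith f (x ∷ xs) ys h = trans (sumOver-++ (List.map (f x) ys) _ h)
  (cong₂ _+_ (sumOver-map (f x) ys h) (sumOver-cartesianProductWith f xs ys h))

-- A relation serves as the bijection, so that neither direction has to be a function on the whole
-- type. The partner of the first element of `xs` is moved to the front of `ys` by a permutation,
-- and the remaining lists are still in bijection.
sumOver-bijection : {A C : Set} (R : A → C → Set) (h : A → ℕ) (k : C → ℕ) (xs : List A) (ys : List C) →
  List.Unique xs → List.Unique ys →
  (∀ {x} → x ∈ xs → ∃ λ y → y ∈ ys × R x y) → (∀ {y} → y ∈ ys → ∃ λ x → x ∈ xs × R x y) →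
  (∀ {x y y′} → x ∈ xs → R x y → R x y′ → y ≡ y′) → (∀ {x x′ y} → x ∈ xs → x′ ∈ xs → R x y → R x′ y → x ≡ x′) →
  (∀ {x y} → x ∈ xs → y ∈ ys → R x y → h x ≡ k y) → sumOver xs h ≡ sumOver ys k
sumOver-bijection R h k [] []       _ _ to from fun inj eq = refl
sumOver-bijection R h k [] (y ∷ ys) _ _ to from fun inj eq with () ← proj₁ (proj₂ (from (here refl)))
sumOver-bijection R h k (x ∷ xs) ys (x∉xs ListAllPairs.∷ xs!) ys! to from fun inj eq
  with to (here refl)
... | y , y∈ys , Rxy with ∈-∃++ y∈ys
... | ys₁ , ys₂ , refl = trans
  (cong₂ _+_ (eq (here refl) y∈ys Rxy) (sumOver-bijection R h k xs ys′ xs! (tail! split!) to′ from′ (fun ∘ there) (λ p q → inj (there p) (there q))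
    (λ p q → eq (there p) (∈-weaken q))))
  (sym (sum-↭ (↭.map⁺ k moved)))
  where
  ys′ = ys₁ ++ ys₂
  moved : ys₁ ++ y ∷ ys₂ ↭ y ∷ ys′
  moved = ↭.shift y ys₁ ys₂
  split! : List.Unique (y ∷ ys′)
  split! = SetoidPermutation.Unique-resp-↭ (≡-setoid _) (↭⇒↭ₛ moved) ys!
  tail! : List.Unique (y ∷ ys′) → List.Unique ys′
  tail! (_ ListAllPairs.∷ p) = p
  y∉ys′ : ¬ y ∈ ys′
  y∉ys′ y∈ with y≢ ListAllPairs.∷ _ ← split! = ListAll.lookup y≢ y∈ refl
  ∈-weaken : ∀ {z} → z ∈ ys′ → z ∈ ys₁ ++ y ∷ ys₂
  ∈-weaken z∈ = ↭.∈-resp-↭ (↭-sym moved) (there z∈)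
  to′ : ∀ {z} → z ∈ xs → ∃ λ w → w ∈ ys′ × R z w
  to′ z∈xs with to (there z∈xs)
  ... | w , w∈ys , Rzw with ↭.∈-resp-↭ moved w∈ys
  ... | here refl  = contradiction (inj (here refl) (there z∈xs) Rxy Rzw) (ListAll.lookup x∉xs z∈xs)
  ... | there w∈ys′ = w , w∈ys′ , Rzw
  from′ : ∀ {w} → w ∈ ys′ → ∃ λ z → z ∈ xs × R z w
  from′ w∈ys′ with from (∈-weaken w∈ys′)
  ... | z , there z∈xs , Rzw = z , z∈xs , Rzw
  ... | z , here refl  , Rxw = contradiction (subst (_∈ ys′) (fun (here refl) Rxw Rxy) w∈ys′) y∉ys′

cardinality-unique : {A : Set} {P : A → Set} {m m′ : ℕ} → HasCardinality P m → HasCardinality P m′ → m ≡ m′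
cardinality-unique M M′ = trans (sym (M .size)) (trans (length≡sumOver (M .elements))
  (trans (sumOver-bijection _≡_ _ _ (M .elements) (M′ .elements) (M .unique) (M′ .unique)
      (λ {x} x∈ → x , Equivalence.from (M′ .correct x) (Equivalence.to (M .correct x) x∈) , refl)
      (λ {x} x∈ → x , Equivalence.from (M .correct x) (Equivalence.to (M′ .correct x) x∈) , refl)
      (λ _ p q → trans (sym p) q) (λ _ _ p q → trans p (sym q)) (λ _ _ _ → refl))
    (trans (sym (length≡sumOver (M′ .elements))) (M′ .size))))
  where open HasCardinality

-- The Ehrhart series

module _ where
  open PowerSeries ℚ._+_ ℚ._*_ ℚ.-_ 0ℚ 1ℚ ℚ.+-*-isCommutativeRing
  module SR = CommutativeRing seriesRing

  *ˢ≈⊠ : ∀ f g → f *ˢ g ≈ f ⊠ g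
  *ˢ≈⊠ f g j = trans (cong sumℚ (map-applyUpTo id (λ i → f i ℚ.* g (j ∸ i)) (suc j))) (convolution f g j)
    where
    convolution : ∀ f g j → sumℚ (List.applyUpTo (λ i → f i ℚ.* g (j ∸ i)) (suc j)) ≡ (f ⊠ g) j
    convolution f g zero    = ℚ.+-identityʳ _
    convolution f g (suc j) = cong (f 0 ℚ.* g (suc j) ℚ.+_) (convolution (f ∘ suc) g j)

  z^≡ι : ∀ m j → z^ m j ≡ fromℕ (ι (j ℕ.≟ m))
  z^≡ι m j with j ℕ.≟ m
  ... | yes p = cong fromℕ (sym (if-yes (j ℕ.≟ m) p))
  ... | no ¬p = cong fromℕ (sym (if-no (j ℕ.≟ m) ¬p))

  1-z≈ : 1-z ≈ one-minus 1ℚ var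
  1-z≈ zero          = refl
  1-z≈ (suc zero)    = refl
  1-z≈ (suc (suc j)) = refl

  Bˢ : ℕ → ℕ → Ser
  Bˢ n d t = fromℕ (B n d t)

  1-z-Bˢ : ∀ n d → 1-z ⊠ Bˢ (suc n) d ≈ Bˢ n d
  1-z-Bˢ n d = SR.trans (SR.*-congʳ {Bˢ (suc n) d} 1-z≈) (one-minus-solve {1ℚ} {var} step)
    where
    step : Bˢ (suc n) d ≈ Bˢ n d ⊞ scale 1ℚ (var ⊠ Bˢ (suc n) d)
    step zero    = sym (trans (cong (λ e → fromℕ (B n d 0) ℚ.+ 1ℚ ℚ.* e) (var-⊠ (Bˢ (suc n) d) 0)) (ℚ.+-identityʳ (fromℕ (B n d 0))))
    step (suc t) = trans (fromℕ-+ (B (suc n) d t) (B n d (suc t))) (trans (ℚ.+-comm (fromℕ (B (suc n) d t)) (fromℕ (B n d (suc t))))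
      (cong (fromℕ (B n d (suc t)) ℚ.+_) (sym (trans (ℚ.*-identityˡ ((var ⊠ Bˢ (suc n) d) (suc t))) (var-⊠ (Bˢ (suc n) d) (suc t))))))

  1-z-Bˢ₀ : ∀ d → 1-z ⊠ Bˢ 0 d ≈ z^ d
  1-z-Bˢ₀ d = SR.trans (SR.*-congʳ {Bˢ 0 d} 1-z≈) (one-minus-solve {1ℚ} {var} step)
    where
    count : ∀ t → ι (d ℕ.≤? suc t) ≡ ι (suc t ℕ.≟ d) + ι (d ℕ.≤? t)
    count t with ℕ.<-cmp d (suc t)
    ... | tri< (s≤s d≤t) d≢ _ rewrite if-yes (d ℕ.≤? suc t) {1} {0} (ℕ.m≤n⇒m≤1+n d≤t)
        | if-no (suc t ℕ.≟ d) {1} {0} (d≢ ∘ sym) | if-yes (d ℕ.≤? t) {1} {0} d≤t = refl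
    ... | tri≈ d≮ d≡ _ rewrite if-yes (d ℕ.≤? suc t) {1} {0} (ℕ.≤-reflexive d≡)
        | if-yes (suc t ℕ.≟ d) {1} {0} (sym d≡) | if-no (d ℕ.≤? t) {1} {0} (λ d≤t → d≮ (s≤s d≤t)) = refl
    ... | tri> d≮ d≢ t<d rewrite if-no (d ℕ.≤? suc t) {1} {0} (ℕ.<⇒≱ t<d)
        | if-no (suc t ℕ.≟ d) {1} {0} (d≢ ∘ sym) | if-no (d ℕ.≤? t) {1} {0} (λ d≤t → d≮ (s≤s d≤t)) = refl
    start : ∀ d → ι (d ℕ.≤? 0) ≡ ι (0 ℕ.≟ d)
    start zero    = refl
    start (suc d) = refl
    step : Bˢ 0 d ≈ z^ d ⊞ scale 1ℚ (var ⊠ Bˢ 0 d)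
    step zero    = trans (trans (cong fromℕ (start d)) (sym (z^≡ι d 0)))
      (sym (trans (cong (λ e → z^ d 0 ℚ.+ 1ℚ ℚ.* e) (var-⊠ (Bˢ 0 d) 0)) (ℚ.+-identityʳ (z^ d 0))))
    step (suc t) = trans (cong fromℕ (count t)) (trans (fromℕ-+ (ι (suc t ℕ.≟ d)) (ι (d ℕ.≤? t)))
      (cong₂ ℚ._+_ (sym (z^≡ι d (suc t))) (sym (trans (ℚ.*-identityˡ ((var ⊠ Bˢ 0 d) (suc t))) (var-⊠ (Bˢ 0 d) (suc t))))))

  ^ˢ-Bˢ : ∀ n d → 1-z ^ˢ suc n ⊠ Bˢ n d ≈ z^ d
  ^ˢ-Bˢ zero d = SR.trans (SR.*-congʳ {Bˢ 0 d} (SR.trans (*ˢ≈⊠ 1-z (z^ 0)) (SR.trans (SR.*-congˡ {1-z} one) (SR.*-identityʳ 1-z)))) (1-z-Bˢ₀ d)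
    where
    one : z^ 0 ≈ const 1ℚ
    one zero    = refl
    one (suc j) = refl
  ^ˢ-Bˢ (suc n) d = SR.trans (SR.*-congʳ {Bˢ (suc n) d} (SR.trans (*ˢ≈⊠ 1-z (1-z ^ˢ suc n)) (SR.*-comm 1-z (1-z ^ˢ suc n))))
    (SR.trans (SR.*-assoc (1-z ^ˢ suc n) 1-z (Bˢ (suc n) d))
      (SR.trans (SR.*-congˡ {1-z ^ˢ suc n} (1-z-Bˢ n d)) (^ˢ-Bˢ n d)))

  E*≈ : {A : Set} (n : ℕ) (E : Polynomial) (xs : List A) (d : A → ℕ) →
        (∀ t → eval E (fromℕ t) ≡ fromℕ (sumOver xs λ x → B n (d x) t)) →
        E* n E ≈ˢ sumˢ xs (λ x → z^ (d x))
  E*≈ n E xs d eq = SR.trans (*ˢ≈⊠ (1-z ^ˢ suc n) _) (SR.trans (SR.*-congˡ {1-z ^ˢ suc n} eq) (linear xs))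
    where
    linear : ∀ xs → 1-z ^ˢ suc n ⊠ (λ t → fromℕ (sumOver xs λ x → B n (d x) t)) ≈ sumˢ xs (λ x → z^ (d x))
    linear [] = SR.trans (SR.*-comm (1-z ^ˢ suc n) (λ _ → 0ℚ)) (⊠-zeroˡ (1-z ^ˢ suc n))
    linear (x ∷ xs) = SR.trans (SR.*-congˡ {1-z ^ˢ suc n} λ t → fromℕ-+ (B n (d x) t) _)
      (SR.trans (⊠-distribˡ (1-z ^ˢ suc n) (Bˢ n (d x)) _) (SR.+-cong (^ˢ-Bˢ n (d x)) (linear xs)))

Bᴾ : {A : Set} → ℕ → List A → (A → ℕ) → Polynomial
Bᴾ n []       d = []
Bᴾ n (x ∷ xs) d = risingᴾ n (d x) +ᴾ Bᴾ n xs d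

eval-Bᴾ : {A : Set} (n : ℕ) (xs : List A) (d : A → ℕ) → (∀ x → x ∈ xs → d x ≤ n) →
          ∀ t → eval (Bᴾ n xs d) (fromℕ t) ≡ fromℕ (sumOver xs λ x → B n (d x) t)
eval-Bᴾ n []       d d≤n t = refl
eval-Bᴾ n (x ∷ xs) d d≤n t = trans (eval-+ᴾ (risingᴾ n (d x)) (Bᴾ n xs d) (fromℕ t))
  (trans (cong₂ ℚ._+_
      (trans (eval-risingᴾ n (d x) (fromℕ t)) (sym (B≡rising n (d x) t (ℕ.m≤n⇒m≤o+n t (d≤n x (here refl))))))
      (eval-Bᴾ n xs d (λ y y∈ → d≤n y (there y∈)) t))
    (sym (fromℕ-+ (B n (d x) t) _)))

-- The counts at t > 0 determine the polynomial and so its value at 0. The bound `d x ≤ n` makes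
-- this value agree with the coefficient of z⁰ in z^d / (1 - z)ⁿ⁺¹, as `B≡rising` then includes t =
-- 0.
ehrhart-series : {A : Set} {n : ℕ} (Y : Subsetᴿ n) (xs : List A) (d : A → ℕ) → (∀ x → x ∈ xs → d x ≤ n) →
  (∀ t → 0 < t → HasCardinality (LatticePoint (dilate t Y)) (sumOver xs λ x → B n (d x) t)) →
  (∃ λ E → IsEhrhartPolynomial Y E) ×
  (∀ E → IsEhrhartPolynomial Y E → E* n E ≈ˢ sumˢ xs (λ x → z^ (d x)))
ehrhart-series {n = n} Y xs d d≤n card =
  (Bᴾ n xs d , λ t 0<t → _ , card t 0<t , eval-Bᴾ n xs d d≤n t) ,
  λ E ehrhart → E*≈ n E xs d λ t → trans
    (eval-unique E (Bᴾ n xs d) 1 (λ u 0<u → let m , M , eq = ehrhart u 0<u in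
      trans eq (trans (cong fromℕ (cardinality-unique M (card u 0<u))) (sym (eval-Bᴾ n xs d d≤n u)))) (fromℕ t))
    (eval-Bᴾ n xs d d≤n t)

-- Counting words by flag excedances

sumℚ-++ : ∀ xs ys → sumℚ (xs ++ ys) ≡ sumℚ xs ℚ.+ sumℚ ys
sumℚ-++ []       ys = sym (ℚ.+-identityˡ (sumℚ ys))
sumℚ-++ (x ∷ xs) ys = trans (cong (x ℚ.+_) (sumℚ-++ xs ys)) (sym (ℚ.+-assoc x (sumℚ xs) (sumℚ ys)))

letters : ∀ {L n} → Vec (Fin L) n → List ℕ
letters []      = []
letters (x ∷ w) = toℕ x ∷ letters w

excess : (r : ℕ) .{{_ : NonZero r}} → (x i j : ℕ) → ℕ
excess r x i j = if does (j ℕ.<? i) then (if does (colour r x ℕ.≟ 0) then r else colour r x) else colour r x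

-- The flag excedance statistic of the standardization of a word L⁻¹ R,
-- restricted to the positions in R.
wordFexc : (r : ℕ) .{{_ : NonZero r}} → List ℕ → List ℕ → ℕ
wordFexc r L []      = 0
wordFexc r L (x ∷ R) = excess r x (below x L) (above (suc x) R) + wordFexc r (x ∷ L) R

module _ where
  open WeightedWords ℚ._+_ ℚ._*_ ℚ.-_ 0ℚ 1ℚ ℚ.+-*-isCommutativeRing

  sumTo≡sumℚ : ∀ L f → sumTo L f ≡ sumℚ (List.map (f ∘ toℕ) (List.allFin L))
  sumTo≡sumℚ L f = trans (tabulated L f) (cong sumℚ (sym (map-tabulate {n = L} id (f ∘ toℕ))))
    where
    tabulated : ∀ L f → sumTo L f ≡ sumℚ (List.tabulate {n = L} (f ∘ toℕ))
    tabulated zero    f = refl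
    tabulated (suc L) f = trans (sumTo-head L f) (cong (f 0 ℚ.+_) (tabulated L (f ∘ suc)))

  sumWords≡sumℚ : ∀ L n φ → sumWords L n φ ≡ sumℚ (List.map (φ ∘ letters) (words (List.allFin L) n))
  sumWords≡sumℚ L zero    φ = sym (ℚ.+-identityʳ (φ []))
  sumWords≡sumℚ L (suc n) φ = trans (sumTo-cong L λ {x} _ → sumWords≡sumℚ L n (φ ∘ (x ∷_)))
    (trans (sumTo≡sumℚ L _) (sym (product (List.allFin L))))
    where
    tails : List (Vec (Fin L) n)
    tails = words (List.allFin L) n
    product : ∀ xs → sumℚ (List.map (φ ∘ letters) (List.cartesianProductWith _∷_ xs tails)) ≡
                     sumℚ (List.map (λ x → sumℚ (List.map (φ ∘ (toℕ x ∷_) ∘ letters) tails)) xs)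
    product []       = refl
    product (x ∷ xs) = trans (cong sumℚ (map-++ (φ ∘ letters) (List.map (x ∷_) tails) (List.cartesianProductWith _∷_ xs tails)))
      (trans (sumℚ-++ (List.map (φ ∘ letters) (List.map (x ∷_) tails)) _)
        (cong₂ ℚ._+_ (cong sumℚ (sym (map-∘ tails))) (product xs)))

generating : {A : Set} → (A → ℕ) → List A → Polynomial
generating h []       = []
generating h (x ∷ xs) = monomial (h x) +ᴾ generating h xs

eval-generating : {A : Set} (h : A → ℕ) (xs : List A) → ∀ s → eval (generating h xs) s ≡ sumℚ (List.map (λ x → s ^ᵠ h x) xs)
eval-generating h []       s = refl
eval-generating h (x ∷ xs) s = trans (eval-+ᴾ (monomial (h x)) (generating h xs) s)
  (cong₂ ℚ._+_ (eval-monomial (h x) s) (eval-generating h xs s))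

coefficient-generating : {A : Set} (h : A → ℕ) (xs : List A) → ∀ e →
  coefficient (generating h xs) e ≡ fromℕ (sumOver xs λ x → ι (h x ℕ.≟ e))
coefficient-generating h []       e = refl
coefficient-generating h (x ∷ xs) e = trans (coefficient-+ᴾ (monomial (h x)) (generating h xs) e)
  (trans (cong₂ ℚ._+_ (coefficient-monomial (h x) e) (coefficient-generating h xs e))
    (sym (fromℕ-+ (ι (h x ℕ.≟ e)) _)))

-- Polynomials in s that agree at infinitely many points have the same coefficients, so s may be a
-- number in all series. The points m ≥ 2 avoid 0 and 1, where the cancellations of s and 1 - s
-- would fail.
equidistributed : {A : Set} (h k : A → ℕ) (xs : List A) →
  (∀ m → 2 ≤ m → sumℚ (List.map (λ x → fromℕ m ^ᵠ h x) xs) ≡ sumℚ (List.map (λ x → fromℕ m ^ᵠ k x) xs)) →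
  ∀ e → sumOver xs (λ x → ι (h x ℕ.≟ e)) ≡ sumOver xs (λ x → ι (k x ℕ.≟ e))
equidistributed h k xs eq e = fromℕ-injective (trans (sym (coefficient-generating h xs e))
  (trans (coefficient-unique (generating h xs) (generating k xs) 2
      (λ m 2≤m → trans (eval-generating h xs (fromℕ m)) (trans (eq m 2≤m) (sym (eval-generating k xs (fromℕ m))))) e)
    (coefficient-generating k xs e)))

words-equidistributed : (r t n : ℕ) .{{_ : NonZero r}} .{{_ : NonZero t}} → ∀ e →
  sumOver (words (List.allFin (suc (r * t))) n) (λ w → ι (wordFexc r [] (letters w) ℕ.≟ e)) ≡
  sumOver (words (List.allFin (suc (r * t))) n) (λ w → ι ((sum (letters w) ∸ 1) / t ℕ.≟ e))
words-equidistributed r t@(suc t′) n = equidistributed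
  (λ w → wordFexc r [] (letters w)) (λ w → (sum (letters w) ∸ 1) / t) (words (List.allFin (suc (r * t))) n) same
  where
  open WeightedWords ℚ._+_ ℚ._*_ ℚ.-_ 0ℚ 1ℚ ℚ.+-*-isCommutativeRing
  same : ∀ m → 2 ≤ m →
    sumℚ (List.map (λ w → fromℕ m ^ᵠ wordFexc r [] (letters w)) (words (List.allFin (suc (r * t))) n)) ≡
    sumℚ (List.map (λ w → fromℕ m ^ᵠ ((sum (letters w) ∸ 1) / t)) (words (List.allFin (suc (r * t))) n))
  same m 2≤m = trans (sym (sumWords≡sumℚ (suc (r * t)) n (λ W → s ^ᵠ wordFexc r [] W)))
    (trans (sumWords-cong (suc (r * t)) n λ W _ W<L → sym (weight≡ [] W W<L))
      (trans (E.Lattice.excedances≡lattice t′ s≢0 n) (sumWords≡sumℚ (suc (r * t)) n (λ W → s ^ᵠ ((sum W ∸ 1) / t)))))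
    where
    s : ℚ
    s = fromℕ m
    s≢0 : s ≢ 0ℚ
    s≢0 eq = ℕ.<⇒≢ (ℕ.≤-trans (s≤s z≤n) 2≤m) (sym (fromℕ-injective {m} {0} eq))
    s≢1 : 1ℚ ℚ.- s ≢ 0ℚ
    s≢1 eq = ℕ.<⇒≢ 2≤m (sym (fromℕ-injective {m} {1} (trans
      (solve 1 (λ s → s := con 1ℚ :- (con 1ℚ :- s)) refl s) (cong (λ q → 1ℚ ℚ.- q) eq))))
    module E = ExcedanceSeries r s s≢1
    open ExcedanceWeights ℚ._+_ ℚ._*_ ℚ.-_ 0ℚ 1ℚ ℚ.+-*-isCommutativeRing E.α E.β using (weight)
    ^-+ : ∀ a b → s ^ᵠ (a + b) ≡ s ^ᵠ a ℚ.* s ^ᵠ b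
    ^-+ zero    b = sym (ℚ.*-identityˡ (s ^ᵠ b))
    ^-+ (suc a) b = trans (cong (s ℚ.*_) (^-+ a b)) (sym (ℚ.*-assoc s (s ^ᵠ a) (s ^ᵠ b)))
    weight≡ : ∀ L W → All (_< suc (r * t)) W → weight (suc (r * t)) L W ≡ s ^ᵠ wordFexc r L W
    weight≡ L []      []          = refl
    weight≡ L (x ∷ W) (x<ℓ ∷ W<ℓ) = trans (cong₂ ℚ._*_ (trans (if-yes (x ℕ.<? suc (r * t)) x<ℓ) letter) (weight≡ (x ∷ L) W W<ℓ))
      (sym (^-+ (excess r x (below x L) (above (suc x) W)) (wordFexc r (x ∷ L) W)))
      where
      letter : (if does (above (suc x) W ℕ.<? below x L) then E.α x else E.β x) ≡ s ^ᵠ excess r x (below x L) (above (suc x) W)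
      letter with does (above (suc x) W ℕ.<? below x L)
      ... | true  = refl
      ... | false = refl

-- Sums over Fin n

sumFin : ∀ {n} → (Fin n → ℕ) → ℕ
sumFin {zero}  h = 0
sumFin {suc n} h = h Fin.zero + sumFin (h ∘ Fin.suc)

sumFin-cong : ∀ {n} {h k : Fin n → ℕ} → (∀ i → h i ≡ k i) → sumFin h ≡ sumFin k
sumFin-cong {zero}  eq = refl
sumFin-cong {suc n} eq = cong₂ _+_ (eq Fin.zero) (sumFin-cong (eq ∘ Fin.suc))

sumFin-+ : ∀ {n} (h k : Fin n → ℕ) → sumFin (λ i → h i + k i) ≡ sumFin h + sumFin k
sumFin-+ {zero}  h k = refl
sumFin-+ {suc n} h k = trans (cong (h Fin.zero + k Fin.zero +_) (sumFin-+ (h ∘ Fin.suc) (k ∘ Fin.suc)))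
  (Nat.solve 4 (λ a b c d → a Nat.:+ b Nat.:+ (c Nat.:+ d) Nat.:= a Nat.:+ c Nat.:+ (b Nat.:+ d)) refl
    (h Fin.zero) (k Fin.zero) (sumFin (h ∘ Fin.suc)) (sumFin (k ∘ Fin.suc)))

sumFin-* : ∀ {n} c (h : Fin n → ℕ) → sumFin (λ i → c * h i) ≡ c * sumFin h
sumFin-* {zero}  c h = sym (ℕ.*-zeroʳ c)
sumFin-* {suc n} c h = trans (cong (c * h Fin.zero +_) (sumFin-* c (h ∘ Fin.suc))) (sym (ℕ.*-distribˡ-+ c _ _))

sumFin-0 : ∀ {n} → sumFin {n} (λ _ → 0) ≡ 0
sumFin-0 {zero}  = refl
sumFin-0 {suc n} = sumFin-0 {n}

sumFin-≤ : ∀ {n} {h k : Fin n → ℕ} → (∀ i → h i ≤ k i) → sumFin h ≤ sumFin k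
sumFin-≤ {zero}  h≤k = z≤n
sumFin-≤ {suc n} h≤k = ℕ.+-mono-≤ (h≤k Fin.zero) (sumFin-≤ (h≤k ∘ Fin.suc))

sumFin-< : ∀ {n} {h k : Fin n → ℕ} → (∀ i → h i ≤ k i) → ∀ i → h i < k i → sumFin h < sumFin k
sumFin-< h≤k Fin.zero    h<k = ℕ.+-mono-<-≤ h<k (sumFin-≤ (h≤k ∘ Fin.suc))
sumFin-< h≤k (Fin.suc i) h<k = ℕ.+-mono-≤-< (h≤k Fin.zero) (sumFin-< (h≤k ∘ Fin.suc) i h<k)

sumFin-1 : ∀ {n} → sumFin {n} (λ _ → 1) ≡ n
sumFin-1 {zero}  = refl
sumFin-1 {suc n} = cong suc sumFin-1

sumFin-ι< : ∀ {n} (p : Fin n) → sumFin {n} (λ q → ι (toℕ q ℕ.<? toℕ p)) ≡ toℕ p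
sumFin-ι< {suc n} Fin.zero = sumFin-0 {n}
sumFin-ι< (Fin.suc p) = cong suc (sumFin-ι< p)

sumFin≡sumOver : ∀ {n} (h : Fin n → ℕ) → sumFin h ≡ sumOver (List.allFin n) h
sumFin≡sumOver {n} h = trans (tabulated h) (cong sum (sym (map-tabulate id h)))
  where
  tabulated : ∀ {n} (h : Fin n → ℕ) → sumFin h ≡ sum (List.tabulate h)
  tabulated {zero}  h = refl
  tabulated {suc n} h = cong (h Fin.zero +_) (tabulated (h ∘ Fin.suc))

-- Pigeonhole principle: if `p` were missed, punching it out would embed `Fin (suc n)` into `Fin n`.
injective⇒surjective : ∀ {n} (f : Fin n → Fin n) → (∀ {i j} → f i ≡ f j → i ≡ j) → ∀ p → ∃ λ i → f i ≡ p
injective⇒surjective {suc n} f inj p with Fin.any? (λ i → f i Fin.≟ p)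
... | yes hit = hit
... | no  miss = contradiction
      (Fin.injective⇒≤ {f = λ i → Fin.punchOut (p≢ i)} λ {i} {j} eq → inj (Fin.punchOut-injective (p≢ i) (p≢ j) eq))
      (ℕ.<⇒≱ ℕ.≤-refl)
  where
  p≢ : ∀ i → p ≢ f i
  p≢ i p≡ = miss (i , sym p≡)

sumFin-permute : ∀ {n} (σ : Fin n → Fin n) → (∀ {i j} → σ i ≡ σ j → i ≡ j) → (h : Fin n → ℕ) →
                 sumFin h ≡ sumFin (h ∘ σ)
sumFin-permute {n} σ inj h = trans (sumFin≡sumOver h) (trans (sym
  (sumOver-bijection (λ i p → σ i ≡ p) (h ∘ σ) h (List.allFin n) (List.allFin n) (Unique.allFin⁺ n) (Unique.allFin⁺ n)
    (λ {i} _ → σ i , ∈-allFin (σ i) , refl)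
    (λ {p} _ → let i , eq = injective⇒surjective σ inj p in i , ∈-allFin i , eq)
    (λ _ p q → trans (sym p) q) (λ _ _ p q → inj (trans p (sym q))) (λ _ _ p → cong h p)))
  (sym (sumFin≡sumOver (h ∘ σ))))

count≡sumFin : ∀ {n m} {P : Fin m → Set} (P? : ∀ i → Dec (P i)) (g : Fin n → Fin m) →
               Vec.count P? (Vec.tabulate g) ≡ sumFin (λ i → ι (P? (g i)))
count≡sumFin {zero}  P? g = refl
count≡sumFin {suc n} P? g with does (P? (g Fin.zero))
... | true  = cong suc (count≡sumFin P? (g ∘ Fin.suc))
... | false = count≡sumFin P? (g ∘ Fin.suc)

vec-sum≡sumFin : ∀ {n} (v : Vec ℕ n) → Vec.sum v ≡ sumFin (lookup v)
vec-sum≡sumFin []      = refl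
vec-sum≡sumFin (x ∷ v) = cong (x +_) (vec-sum≡sumFin v)

-- Standardization: positions ordered by decreasing letter, then from left to right

module Standardization {n : ℕ} (g : Fin n → ℕ) where

  _≺_ : Fin n → Fin n → Set
  p ≺ q = g q < g p ⊎ (g p ≡ g q × p Fin.< q)

  _≺?_ : ∀ p q → Dec (p ≺ q)
  p ≺? q = (g q ℕ.<? g p) ⊎-dec ((g p ℕ.≟ g q) ×-dec (p Fin.<? q))

  ≺-trans : ∀ {p q s} → p ≺ q → q ≺ s → p ≺ s
  ≺-trans (inj₁ a)       (inj₁ b)       = inj₁ (ℕ.<-trans b a)
  ≺-trans {p} (inj₁ a)   (inj₂ (b , _)) = inj₁ (subst (_< g p) b a)
  ≺-trans {s = s} (inj₂ (a , _)) (inj₁ b) = inj₁ (subst (g s <_) (sym a) b)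
  ≺-trans (inj₂ (a , c)) (inj₂ (b , d)) = inj₂ (trans a b , ℕ.<-trans c d)

  ≺-irrefl : ∀ {p} → ¬ p ≺ p
  ≺-irrefl (inj₁ a)       = ℕ.<-irrefl refl a
  ≺-irrefl (inj₂ (_ , a)) = ℕ.<-irrefl refl a

  ≺-total : ∀ p q → p ≢ q → p ≺ q ⊎ q ≺ p
  ≺-total p q p≢q with ℕ.<-cmp (g p) (g q) | Fin.<-cmp p q
  ... | tri< a _ _ | _          = inj₂ (inj₁ a)
  ... | tri> _ _ a | _          = inj₁ (inj₁ a)
  ... | tri≈ _ a _ | tri< b _ _ = inj₁ (inj₂ (a , b))
  ... | tri≈ _ a _ | tri≈ _ b _ = contradiction b p≢q
  ... | tri≈ _ a _ | tri> _ _ b = inj₂ (inj₂ (sym a , b))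

  rank : Fin n → ℕ
  rank p = sumFin λ q → ι (q ≺? p)

  rank-mono : ∀ {p q} → p ≺ q → rank p < rank q
  rank-mono {p} {q} p≺q = sumFin-< smaller p (subst₂ _<_ (sym (if-no (p ≺? p) ≺-irrefl)) (sym (if-yes (p ≺? q) p≺q)) ℕ.≤-refl)
    where
    smaller : ∀ s → ι (s ≺? p) ≤ ι (s ≺? q)
    smaller s with s ≺? p
    ... | no ¬s≺p = subst (_≤ ι (s ≺? q)) (sym (if-no (s ≺? p) ¬s≺p)) z≤n
    ... | yes s≺p = ℕ.≤-reflexive (trans (if-yes (s ≺? p) s≺p) (sym (if-yes (s ≺? q) (≺-trans s≺p p≺q))))

  rank-cancel : ∀ {p q} → rank p < rank q → p ≺ q
  rank-cancel {p} {q} r with p Fin.≟ q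
  ... | yes refl = contradiction r (ℕ.<-irrefl refl)
  ... | no  p≢q with ≺-total p q p≢q
  ...   | inj₁ p≺q = p≺q
  ...   | inj₂ q≺p = contradiction r (ℕ.<-asym (rank-mono q≺p))

  rank-injective : ∀ {p q} → rank p ≡ rank q → p ≡ q
  rank-injective {p} {q} eq with p Fin.≟ q
  ... | yes p≡q = p≡q
  ... | no  p≢q with ≺-total p q p≢q
  ...   | inj₁ p≺q = contradiction eq (ℕ.<⇒≢ (rank-mono p≺q))
  ...   | inj₂ q≺p = contradiction eq (ℕ.>⇒≢ (rank-mono q≺p))

  rank<n : ∀ p → rank p < n
  rank<n p = subst (rank p <_) sumFin-1 (sumFin-< (λ q → ι≤1 (q ≺? p)) p
    (subst (_< 1) (sym (if-no (p ≺? p) ≺-irrefl)) ℕ.≤-refl))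
    where
    ι≤1 : {P : Set} (d : Dec P) → ι d ≤ 1
    ι≤1 (yes _) = ℕ.≤-refl
    ι≤1 (no  _) = z≤n

  -- The inverse of `rank`, which exists because an injection of a finite set into itself is onto.
  sorting : ∃ λ (σ : Fin n → Fin n) → ∀ i → rank (σ i) ≡ toℕ i
  sorting = (λ i → proj₁ (position i)) , λ i → trans (sym (Fin.toℕ-fromℕ< (rank<n _))) (cong toℕ (proj₂ (position i)))
    where
    position : ∀ i → ∃ λ p → Fin.fromℕ< (rank<n p) ≡ i
    position = injective⇒surjective (λ p → Fin.fromℕ< (rank<n p))
      (λ {p} {q} eq → rank-injective (Fin.fromℕ<-injective (rank p) (rank q) (rank<n p) (rank<n q) eq))

  module Sorted (σ : Fin n → Fin n) (σ-injective : ∀ {i j} → σ i ≡ σ j → i ≡ j)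
                (sorted : ∀ {i j} → i Fin.< j → σ i ≺ σ j) where

    ≺⇔< : ∀ i j → ι (σ i ≺? σ j) ≡ ι (toℕ i ℕ.<? toℕ j)
    ≺⇔< i j = if-cong (σ i ≺? σ j) (toℕ i ℕ.<? toℕ j) to sorted
      where
      to : σ i ≺ σ j → toℕ i < toℕ j
      to σi≺σj with Fin.<-cmp i j
      ... | tri< i<j _ _ = i<j
      ... | tri≈ _ refl _ = contradiction σi≺σj ≺-irrefl
      ... | tri> _ _ j<i = contradiction (≺-trans σi≺σj (sorted j<i)) ≺-irrefl

    rank-σ : ∀ i → rank (σ i) ≡ toℕ i
    rank-σ i = trans (sumFin-permute σ σ-injective _) (trans (sumFin-cong λ j → ≺⇔< j i) (sumFin-ι< i))

    smallerLeft largerRight : Fin n → ℕ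
    smallerLeft p = sumFin λ q → ι (toℕ q ℕ.<? toℕ p) * ι (g q ℕ.<? g p)
    largerRight p = sumFin λ q → ι (toℕ p ℕ.<? toℕ q) * ι (g p ℕ.<? g q)

    -- The contribution of the single position `σ j` to `excedance-balance`, according to the order
    -- of the letters and of the positions.
    exchange : ∀ i j → ι (toℕ (σ j) ℕ.<? toℕ (σ i)) * ι (g (σ j) ℕ.<? g (σ i)) + ι (toℕ j ℕ.<? toℕ i) ≡
                       ι (toℕ (σ i) ℕ.<? toℕ (σ j)) * ι (g (σ i) ℕ.<? g (σ j)) + ι (toℕ (σ j) ℕ.<? toℕ (σ i))
    exchange i j with Fin.<-cmp j i
    ... | tri≈ _ refl _
      rewrite if-no (toℕ (σ i) ℕ.<? toℕ (σ i)) {1} {0} (ℕ.<-irrefl refl)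
            | if-no (toℕ i ℕ.<? toℕ i) {1} {0} (ℕ.<-irrefl refl) = refl
    ... | tri< j<i _ _ rewrite if-yes (toℕ j ℕ.<? toℕ i) {1} {0} j<i with sorted j<i
    ...   | inj₂ (eq , σj<σi)
      rewrite if-yes (toℕ (σ j) ℕ.<? toℕ (σ i)) {1} {0} σj<σi
            | if-no (toℕ (σ i) ℕ.<? toℕ (σ j)) {1} {0} (ℕ.<-asym σj<σi)
            | if-no (g (σ j) ℕ.<? g (σ i)) {1} {0} (ℕ.<-irrefl eq) = refl
    ...   | inj₁ gi<gj
      rewrite if-no (g (σ j) ℕ.<? g (σ i)) {1} {0} (ℕ.<-asym gi<gj)
            | if-yes (g (σ i) ℕ.<? g (σ j)) {1} {0} gi<gj with Fin.<-cmp (σ j) (σ i)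
    ...     | tri< a _ _
      rewrite if-yes (toℕ (σ j) ℕ.<? toℕ (σ i)) {1} {0} a
            | if-no (toℕ (σ i) ℕ.<? toℕ (σ j)) {1} {0} (ℕ.<-asym a) = refl
    ...     | tri≈ _ a _ = contradiction (σ-injective a) (Fin.<⇒≢ j<i)
    ...     | tri> _ _ a
      rewrite if-no (toℕ (σ j) ℕ.<? toℕ (σ i)) {1} {0} (ℕ.<-asym a)
            | if-yes (toℕ (σ i) ℕ.<? toℕ (σ j)) {1} {0} a = refl
    exchange i j | tri> _ _ i<j rewrite if-no (toℕ j ℕ.<? toℕ i) {1} {0} (ℕ.<-asym i<j) with sorted i<j
    ...   | inj₂ (eq , σi<σj)
      rewrite if-no (toℕ (σ j) ℕ.<? toℕ (σ i)) {1} {0} (ℕ.<-asym σi<σj)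
            | if-no (g (σ i) ℕ.<? g (σ j)) {1} {0} (ℕ.<-irrefl eq)
            | ℕ.*-zeroʳ (ι (toℕ (σ i) ℕ.<? toℕ (σ j))) = refl
    ...   | inj₁ gj<gi
      rewrite if-yes (g (σ j) ℕ.<? g (σ i)) {1} {0} gj<gi
            | if-no (g (σ i) ℕ.<? g (σ j)) {1} {0} (ℕ.<-asym gj<gi)
            | ℕ.*-zeroʳ (ι (toℕ (σ i) ℕ.<? toℕ (σ j)))
            | ℕ.*-identityʳ (ι (toℕ (σ j) ℕ.<? toℕ (σ i))) = ℕ.+-identityʳ _

    -- `toℕ i` counts what precedes `σ i` in sorted order: the larger letters on both sides and the
    -- equal ones to the left. `toℕ (σ i)` counts what stands to the left: larger, equal and smaller
    -- letters. The difference leaves the larger ones on the right against the smaller ones on the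
    -- left.
    excedance-balance : ∀ i → smallerLeft (σ i) + toℕ i ≡ largerRight (σ i) + toℕ (σ i)
    excedance-balance i = trans
      (cong₂ _+_ (sumFin-permute σ σ-injective _) (sym (sumFin-ι< i)))
      (trans (sym (sumFin-+ {n} _ _)) (trans (sumFin-cong (exchange i)) (trans (sumFin-+ {n} _ _)
        (cong₂ _+_ (sym (sumFin-permute σ σ-injective _))
          (trans (sym (sumFin-permute σ σ-injective (λ q → ι (toℕ q ℕ.<? toℕ (σ i))))) (sumFin-ι< (σ i)))))))

    excedance⇔ : ∀ i → largerRight (σ i) < smallerLeft (σ i) ⇔ i Fin.< σ i
    excedance⇔ i = mk⇔
      (λ b<a → ℕ.+-cancelˡ-< (largerRight (σ i)) _ _ (ℕ.<-≤-trans (ℕ.+-monoˡ-< (toℕ i) b<a) (ℕ.≤-reflexive (excedance-balance i))))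
      (λ i<σ → ℕ.+-cancelʳ-< (toℕ i) _ _ (subst (largerRight (σ i) + toℕ i <_) (sym (excedance-balance i)) (ℕ.+-monoʳ-< (largerRight (σ i)) i<σ)))

-- Weakly decreasing labellings with prescribed strict descents

-- `ε` gives the least drop between neighbours and `e` the least last entry; in use they are the
-- indicators of a descent and of cₙ > 0.
Compatible : ∀ {L m} → (Fin m → ℕ) → ℕ → Vec (Fin L) (suc m) → Set
Compatible {m = zero}  ε e (x ∷ [])    = e ≤ toℕ x
Compatible {m = suc m} ε e (x ∷ y ∷ f) = toℕ y + ε Fin.zero ≤ toℕ x × Compatible (ε ∘ Fin.suc) e (y ∷ f)

compatible? : ∀ {L m} (ε : Fin m → ℕ) e (f : Vec (Fin L) (suc m)) → Dec (Compatible ε e f)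
compatible? {m = zero}  ε e (x ∷ [])    = e ℕ.≤? toℕ x
compatible? {m = suc m} ε e (x ∷ y ∷ f) = (toℕ y + ε Fin.zero ℕ.≤? toℕ x) ×-dec compatible? (ε ∘ Fin.suc) e (y ∷ f)

compatible-last : ∀ {L m} {ε : Fin m → ℕ} {e} (f : Vec (Fin L) (suc m)) → Compatible ε e f → e ≤ toℕ (lookup f (Fin.fromℕ m))
compatible-last {m = zero}  (x ∷ [])    p       = p
compatible-last {m = suc m} (x ∷ y ∷ f) (_ , p) = compatible-last (y ∷ f) p

compatible-step : ∀ {L m} {ε : Fin m → ℕ} {e} (f : Vec (Fin L) (suc m)) → Compatible ε e f →
                  ∀ i → toℕ (lookup f (Fin.suc i)) + ε i ≤ toℕ (lookup f (inject₁ i))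
compatible-step {m = suc m} (x ∷ y ∷ f) (p , _) Fin.zero    = p
compatible-step {m = suc m} (x ∷ y ∷ f) (_ , p) (Fin.suc i) = compatible-step (y ∷ f) p i

compatible⁺ : ∀ {L m} {ε : Fin m → ℕ} {e} (f : Vec (Fin L) (suc m)) →
              (∀ i → toℕ (lookup f (Fin.suc i)) + ε i ≤ toℕ (lookup f (inject₁ i))) →
              e ≤ toℕ (lookup f (Fin.fromℕ m)) → Compatible ε e f
compatible⁺ {m = zero}  (x ∷ [])    step end = end
compatible⁺ {m = suc m} (x ∷ y ∷ f) step end = step Fin.zero , compatible⁺ (y ∷ f) (step ∘ Fin.suc) end

cumulative : (ℕ → ℕ) → ℕ → ℕ
cumulative h zero    = h 0
cumulative h (suc y) = cumulative h y + h (suc y)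

B-cumulative : ∀ n d t → cumulative (B n d) t ≡ B (suc n) d t
B-cumulative n d zero    = refl
B-cumulative n d (suc t) = cong (_+ B n d (suc t)) (B-cumulative n d t)

B-shift : ∀ n d t → B n (suc d) (suc t) ≡ B n d t
B-shift zero    d t       = if-cong (suc d ℕ.≤? suc t) (d ℕ.≤? t) ℕ.≤-pred s≤s
B-shift (suc n) d zero    = trans (cong (_+ B n (suc d) 1) (B-zero n {suc d} {0} (s≤s z≤n))) (B-shift n d 0)
B-shift (suc n) d (suc t) = cong₂ _+_ (B-shift (suc n) d t) (B-shift n d (suc t))

sumOver-restricted : ∀ t y → y ≤ t → (h : ℕ → ℕ) →
  sumOver (List.allFin (suc t)) (λ x → ι (toℕ x ℕ.≤? y) * h (toℕ x)) ≡ cumulative h y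
sumOver-restricted t y y≤t h = trans (sym (sumFin≡sumOver {suc t} (λ x → ι (toℕ x ℕ.≤? y) * h (toℕ x)))) (go t y y≤t h)
  where
  head : ∀ h y → cumulative h (suc y) ≡ h 0 + cumulative (h ∘ suc) y
  head h zero    = refl
  head h (suc y) = trans (cong (_+ h (2 + y)) (head h y)) (ℕ.+-assoc (h 0) _ _)
  go : ∀ t y → y ≤ t → (h : ℕ → ℕ) → sumFin {suc t} (λ x → ι (toℕ x ℕ.≤? y) * h (toℕ x)) ≡ cumulative h y
  go t       zero    _         h = trans (cong₂ _+_ (ℕ.+-identityʳ (h 0)) (sumFin-0 {t})) (ℕ.+-identityʳ (h 0))
  go (suc t) (suc y) (s≤s y≤t) h = trans (cong₂ _+_ (ℕ.+-identityʳ (h 0))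
    (trans (sumFin-cong {suc t} λ x → cong (_* h (suc (toℕ x))) (if-cong (suc (toℕ x) ℕ.≤? suc y) (toℕ x ℕ.≤? y) {1} {0} ℕ.≤-pred s≤s))
      (go t y y≤t (h ∘ suc)))) (sym (head h y))

-- The bound `y` on the first entry carries the induction. Summing over a first entry x ≤ y
-- contributes a factor 1/(1 - z); a required drop lowers the bound for the rest from x to x - 1,
-- which contributes a factor z.
compatible-count : ∀ t m (ε : Fin m → ℕ) e → (∀ i → ε i ≤ 1) → e ≤ 1 → ∀ y → y ≤ t →
  sumOver (words (List.allFin (suc t)) (suc m)) (λ f → ι (toℕ (Vec.head f) ℕ.≤? y) * ι (compatible? ε e f)) ≡
  B (suc m) (sumFin ε + e) y
compatible-count t zero ε e ε≤1 e≤1 y y≤t = trans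
  (sumOver-cartesianProductWith _∷_ (List.allFin (suc t)) ([] ∷ []) _)
  (trans (sumOver-cong (List.allFin (suc t)) λ {x} _ → ℕ.+-identityʳ _)
    (trans (sumOver-restricted t y y≤t (λ x → ι (e ℕ.≤? x))) (B-cumulative 0 e y)))
compatible-count t (suc m) ε e ε≤1 e≤1 y y≤t = trans
  (sumOver-cartesianProductWith _∷_ (List.allFin (suc t)) (words (List.allFin (suc t)) (suc m)) _)
  (trans (sumOver-cong (List.allFin (suc t)) λ {x} _ → trans
      (sumOver-* (ι (toℕ x ℕ.≤? y)) (words (List.allFin (suc t)) (suc m)) (λ f → ι (compatible? ε e (x ∷ f))))
      (cong (ι (toℕ x ℕ.≤? y) *_) (trans (sumOver-cong (words (List.allFin (suc t)) (suc m)) (λ {f} _ → uncons x f)) (tails x))))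
    (trans (sumOver-restricted t y y≤t (B (suc m) (ε Fin.zero + sumFin (ε ∘ Fin.suc) + e))) (B-cumulative (suc m) _ y)))
  where
  ε₀ = ε Fin.zero
  d = sumFin (ε ∘ Fin.suc) + e
  uncons : ∀ x (f : Vec (Fin (suc t)) (suc m)) → ι (compatible? ε e (x ∷ f)) ≡
           ι (toℕ (Vec.head f) + ε₀ ℕ.≤? toℕ x) * ι (compatible? (ε ∘ Fin.suc) e f)
  uncons x (y ∷ f) with does (toℕ y + ε₀ ℕ.≤? toℕ x) | does (compatible? (ε ∘ Fin.suc) e (y ∷ f))
  ... | true  | true  = refl
  ... | true  | false = refl
  ... | false | _     = refl
  tails : ∀ x → sumOver (words (List.allFin (suc t)) (suc m))
            (λ f → ι (toℕ (Vec.head f) + ε₀ ℕ.≤? toℕ x) * ι (compatible? (ε ∘ Fin.suc) e f)) ≡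
          B (suc m) (ε₀ + sumFin (ε ∘ Fin.suc) + e) (toℕ x)
  tails x = by-case ε₀ (ε≤1 Fin.zero) (toℕ x) (ℕ.≤-pred (Fin.toℕ<n x))
    where
    by-case : ∀ a → a ≤ 1 → ∀ x → x ≤ t → sumOver (words (List.allFin (suc t)) (suc m))
            (λ f → ι (toℕ (Vec.head f) + a ℕ.≤? x) * ι (compatible? (ε ∘ Fin.suc) e f)) ≡
            B (suc m) (a + sumFin (ε ∘ Fin.suc) + e) x
    by-case zero a≤1 x x≤t = trans
      (sumOver-cong (words (List.allFin (suc t)) (suc m)) λ {f} _ → cong (λ k → ι (k ℕ.≤? x) * ι (compatible? (ε ∘ Fin.suc) e f))
        (ℕ.+-identityʳ (toℕ (Vec.head f))))
      (compatible-count t m (ε ∘ Fin.suc) e (ε≤1 ∘ Fin.suc) e≤1 x x≤t)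
    by-case (suc zero) a≤1 zero x≤t = trans
      (sumOver-cong (words (List.allFin (suc t)) (suc m)) λ {f} _ → cong (_* ι (compatible? (ε ∘ Fin.suc) e f))
        (if-no (toℕ (Vec.head f) + 1 ℕ.≤? 0) (λ p → ℕ.<⇒≱ (subst (0 <_) (ℕ.+-comm 1 (toℕ (Vec.head f))) (s≤s z≤n)) p)))
      (trans (sumOver-* 0 (words (List.allFin (suc t)) (suc m)) (λ _ → 0)) (sym (B-zero (suc m) {suc d} {0} (s≤s z≤n))))
    by-case (suc zero) a≤1 (suc x) x≤t = trans
      (sumOver-cong (words (List.allFin (suc t)) (suc m)) λ {f} _ → cong (_* ι (compatible? (ε ∘ Fin.suc) e f))
        (if-cong (toℕ (Vec.head f) + 1 ℕ.≤? suc x) (toℕ (Vec.head f) ℕ.≤? x)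
          (λ p → ℕ.≤-pred (subst (_≤ suc x) (ℕ.+-comm (toℕ (Vec.head f)) 1) p))
          (λ p → subst (_≤ suc x) (ℕ.+-comm 1 (toℕ (Vec.head f))) (s≤s p))))
      (trans (compatible-count t m (ε ∘ Fin.suc) e (ε≤1 ∘ Fin.suc) e≤1 x (ℕ.<⇒≤ x≤t)) (sym (B-shift (suc m) d x)))
    by-case (suc (suc a)) (s≤s ()) x x≤t

compatible-total : ∀ t m (ε : Fin m → ℕ) e → (∀ i → ε i ≤ 1) → e ≤ 1 →
  sumOver (words (List.allFin (suc t)) (suc m)) (λ f → ι (compatible? ε e f)) ≡ B (suc m) (sumFin ε + e) t
compatible-total t m ε e ε≤1 e≤1 = trans
  (sumOver-cong (words (List.allFin (suc t)) (suc m)) λ {f} _ → sym (trans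
    (cong (_* ι (compatible? ε e f)) (if-yes (toℕ (Vec.head f) ℕ.≤? t) (ℕ.≤-pred (Fin.toℕ<n (Vec.head f)))))
    (ℕ.*-identityˡ _)))
  (compatible-count t m ε e ε≤1 e≤1 t ℕ.≤-refl)

-- Colored permutations with a labelling, as words

-- The label f = ⌈x / r⌉ in x = r f - c.
level : (r : ℕ) .{{_ : NonZero r}} → ℕ → ℕ
level r zero    = 0
level r (suc x) = suc (x / r)

colour<r : (r : ℕ) .{{_ : NonZero r}} → ∀ x → colour r x < r
colour<r r zero    = ℕ.>-nonZero⁻¹ r
colour<r r (suc x) = ℕ.≤-<-trans (ℕ.m∸n≤m (r ∸ 1) (x % r)) (ℕ.≤-reflexive (ℕ.suc-pred r))

+-colour : (r : ℕ) .{{_ : NonZero r}} → ∀ x → x + colour r x ≡ r * level r x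
+-colour r zero    = sym (ℕ.*-zeroʳ r)
+-colour r (suc x) = begin
  suc x + (r ∸ 1 ∸ x % r)                        ≡⟨ cong (λ y → suc y + (r ∸ 1 ∸ x % r)) (m≡m%n+[m/n]*n x r) ⟩
  suc (x % r + x / r * r) + (r ∸ 1 ∸ x % r)      ≡⟨ Nat.solve 3 (λ a b c → Nat.con 1 Nat.:+ (a Nat.:+ b) Nat.:+ c Nat.:= b Nat.:+ (Nat.con 1 Nat.:+ (a Nat.:+ c))) refl
                                                      (x % r) (x / r * r) (r ∸ 1 ∸ x % r) ⟩
  x / r * r + suc (x % r + (r ∸ 1 ∸ x % r))      ≡⟨ cong (λ y → x / r * r + suc y) (ℕ.m+[n∸m]≡n
                                                      (ℕ.≤-pred (ℕ.<-≤-trans (m%n<n x r) (ℕ.≤-reflexive (sym (ℕ.suc-pred r)))))) ⟩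
  x / r * r + suc (r ∸ 1)                        ≡⟨ cong (x / r * r +_) (ℕ.suc-pred r) ⟩
  x / r * r + r                                  ≡⟨ ℕ.+-comm (x / r * r) r ⟩
  suc (x / r) * r                                ≡⟨ ℕ.*-comm (suc (x / r)) r ⟩
  r * suc (x / r)                                ∎
  where open ≡-Reasoning

-- From c < r follows r f = x + c < x + r ≤ r (f′ + 1).
level-≤ : (r : ℕ) {x c f f′ : ℕ} → x + c ≡ r * f → c < r → x ≤ r * f′ → f ≤ f′
level-≤ r {x} {c} {f} {f′} eq c<r x≤ = ℕ.≤-pred (ℕ.*-cancelˡ-< r f (suc f′) (subst₂ _<_ eq
  (trans (ℕ.+-comm (r * f′) r) (sym (ℕ.*-suc r f′))) (ℕ.+-mono-≤-< x≤ c<r)))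

level-unique : (r : ℕ) {x c c′ f f′ : ℕ} → x + c ≡ r * f → c < r → x + c′ ≡ r * f′ → c′ < r → f ≡ f′ × c ≡ c′
level-unique r {x} {c} {c′} eq c<r eq′ c′<r = f≡f′ , ℕ.+-cancelˡ-≡ x c c′ (trans eq (trans (cong (r *_) f≡f′) (sym eq′)))
  where
  f≡f′ = ℕ.≤-antisym (level-≤ r eq c<r (subst (x ≤_) eq′ (ℕ.m≤m+n x c′))) (level-≤ r eq′ c′<r (subst (x ≤_) eq (ℕ.m≤m+n x c)))

above-letters : ∀ {K n} k (w : Vec (Fin K) n) → above k (letters w) ≡ sumFin λ q → ι (k ℕ.≤? toℕ (lookup w q))
above-letters k []      = refl
above-letters k (x ∷ w) = cong (ι (k ℕ.≤? toℕ x) +_) (above-letters k w)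

module _ {K n : ℕ} (w : Vec (Fin K) n) where
  letterAt : Fin n → ℕ
  letterAt p = toℕ (lookup w p)

  smallerLeft largerRight : Fin n → ℕ
  smallerLeft p = sumFin λ q → ι (toℕ q ℕ.<? toℕ p) * ι (letterAt q ℕ.<? letterAt p)
  largerRight p = sumFin λ q → ι (toℕ p ℕ.<? toℕ q) * ι (letterAt p ℕ.<? letterAt q)

-- The letters of `L` lie to the left of every position of `w`, so they only enlarge the number of
-- smaller letters on the left.
wordFexc≡sumFin : (r : ℕ) .{{_ : NonZero r}} → ∀ {K n} L (w : Vec (Fin K) n) → wordFexc r L (letters w) ≡
  sumFin λ p → excess r (letterAt w p) (below (letterAt w p) L + smallerLeft w p) (largerRight w p)
wordFexc≡sumFin r L []              = refl
wordFexc≡sumFin r L (_∷_ {n = n} x w) = cong₂ _+_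
  (cong₂ (excess r (toℕ x)) (sym (trans (cong (below (toℕ x) L +_) (sumFin-0 {n})) (ℕ.+-identityʳ _)))
    (trans (above-letters (suc (toℕ x)) w) (sumFin-cong λ q → sym (ℕ.*-identityˡ (ι (toℕ x ℕ.<? letterAt w q))))))
  (trans (wordFexc≡sumFin r (toℕ x ∷ L) w) (sumFin-cong λ p → cong (λ i → excess r (letterAt w p) i (largerRight w p))
    (trans (cong (_+ smallerLeft w p) (ℕ.+-comm (ι (toℕ x ℕ.<? letterAt w p)) (below (letterAt w p) L)))
      (trans (ℕ.+-assoc (below (letterAt w p) L) _ _) (cong (λ i → below (letterAt w p) L + (i + smallerLeft w p))
        (sym (ℕ.*-identityˡ (ι (toℕ x ℕ.<? letterAt w p)))))))))

excess≡ : (r : ℕ) .{{_ : NonZero r}} → ∀ {x i j c} {P : Set} (P? : Dec P) → colour r x ≡ c → (j < i ⇔ P) →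
          excess r x i j ≡ r * ι (P? ×-dec (c ℕ.≟ 0)) + c
excess≡ r {x} {i} {j} {c} P? refl j<i⇔P with does (c ℕ.≟ 0) | proof (c ℕ.≟ 0)
... | true | ofʸ c≡0 = trans (case P?) (sym (trans (cong (r * ι (P? ×-dec yes c≡0) +_) c≡0) (ℕ.+-identityʳ _)))
  where
  case : (P? : Dec _) → (if does (j ℕ.<? i) then r else c) ≡ r * ι (P? ×-dec yes c≡0)
  case (yes p) = trans (if-yes (j ℕ.<? i) (Equivalence.from j<i⇔P p)) (sym (ℕ.*-identityʳ r))
  case (no ¬p) = trans (if-no (j ℕ.<? i) (¬p ∘ Equivalence.to j<i⇔P)) (trans c≡0 (sym (ℕ.*-zeroʳ r)))
... | false | ofⁿ c≢0 = trans same (sym (trans (cong (λ k → r * k + c) (never P?)) (cong (_+ c) (ℕ.*-zeroʳ r))))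
  where
  same : (if does (j ℕ.<? i) then c else c) ≡ c
  same with does (j ℕ.<? i)
  ... | true  = refl
  ... | false = refl
  never : (P? : Dec _) → ι (P? ×-dec no c≢0) ≡ 0
  never (yes _) = refl
  never (no  _) = refl

adjacent⇒ordered : ∀ {m} (R : Fin (suc m) → Fin (suc m) → Set) → (∀ {i j k} → R i j → R j k → R i k) →
  (∀ i → R (inject₁ i) (Fin.suc i)) → ∀ {i j} → i Fin.< j → R i j
adjacent⇒ordered {suc m} R R-trans adj {Fin.zero} {Fin.suc Fin.zero} _ = adj Fin.zero
adjacent⇒ordered {suc m} R R-trans adj {Fin.zero} {Fin.suc (Fin.suc j)} _ = R-trans (adj Fin.zero)
  (adjacent⇒ordered (λ i j → R (Fin.suc i) (Fin.suc j)) R-trans (adj ∘ Fin.suc) {Fin.zero} {Fin.suc j} (s≤s z≤n))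
adjacent⇒ordered {suc m} R R-trans adj {Fin.suc i} {Fin.suc j} (s≤s i<j) =
  adjacent⇒ordered (λ i j → R (Fin.suc i) (Fin.suc j)) R-trans (adj ∘ Fin.suc) i<j

backward-induction : ∀ {m} (P : Fin (suc m) → Set) → P (Fin.fromℕ m) → (∀ i → P (Fin.suc i) → P (inject₁ i)) → ∀ i → P i
backward-induction {zero}  P end step Fin.zero = end
backward-induction {suc m} P end step Fin.zero    = step Fin.zero (backward-induction (P ∘ Fin.suc) end (step ∘ Fin.suc) Fin.zero)
backward-induction {suc m} P end step (Fin.suc i) = backward-induction (P ∘ Fin.suc) end (step ∘ Fin.suc) i

last≡lookup : ∀ {A : Set} {m} (v : Vec A (suc m)) → Vec.last v ≡ lookup v (Fin.fromℕ m)
last≡lookup {m = zero}  (x ∷ [])    = refl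
last≡lookup {m = suc m} (x ∷ y ∷ v) = last≡lookup (y ∷ v)

inject₁<suc : ∀ {m} (i : Fin m) → inject₁ i Fin.< Fin.suc i
inject₁<suc i = s≤s (ℕ.≤-reflexive (Fin.toℕ-inject₁ i))

ι≤1 : {P : Set} (d : Dec P) → ι d ≤ 1
ι≤1 (yes _) = ℕ.≤-refl
ι≤1 (no  _) = z≤n

words-complete : ∀ {L n} (v : Vec (Fin L) n) → v ∈ words (List.allFin L) n
words-complete []      = here refl
words-complete (x ∷ v) = ∈-cartesianProductWith⁺ _∷_ (∈-allFin x) (words-complete v)

words-unique : ∀ L n → List.Unique (words (List.allFin L) n)
words-unique L zero    = [] ListAllPairs.∷ ListAllPairs.[]
words-unique L (suc n) = Unique.cartesianProductWith⁺ _∷_ (λ { refl → refl , refl }) (Unique.allFin⁺ L) (words-unique L n)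

module Labelled (r t m : ℕ) .{{_ : NonZero r}} where

  n K : ℕ
  n = suc m
  K = suc (r * t)

  Colored Labelling Word : Set
  Colored   = Vec (Fin n) n × Vec (Fin r) n
  Labelling = Vec (Fin (suc t)) n
  Word      = Vec (Fin K) n

  strict : Colored → Fin m → ℕ
  strict π i = ι (descent? π (inject₁ i) (Fin.suc i))

  end : Colored → ℕ
  end (_ , c) = ι (1 ℕ.≤? lastColor c)

  depth : Colored → ℕ
  depth π = des π + end π

  Valid : Colored → Labelling → Set
  Valid π f = Compatible (strict π) (end π) f

  -- The equation is additive instead of using a truncated difference r f - c; it thereby entails c
  -- ≤ r f.
  Encodes : Colored × Labelling → Word → Set
  Encodes ((σ , c) , f) w = ∀ i → letterAt w (lookup σ i) + toℕ (lookup c i) ≡ r * toℕ (lookup f i)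

  module _ {σ : Vec (Fin n) n} {c : Vec (Fin r) n} {f : Labelling} (σ! : VecUnique.Unique σ) where

    label col : Fin n → ℕ
    label i = toℕ (lookup f i)
    col i = toℕ (lookup c i)

    σ-injective : ∀ {i j} → lookup σ i ≡ lookup σ j → i ≡ j
    σ-injective {i} {j} = VecUnique.lookup-injective σ! i j

    level-dichotomy : Valid (σ , c) f → ∀ i → label (Fin.suc i) < label (inject₁ i) ⊎
      (lookup f (Fin.suc i) ≡ lookup f (inject₁ i) × ¬ Descent (σ , c) (inject₁ i) (Fin.suc i))
    level-dichotomy valid i with compatible-step f valid i | descent? (σ , c) (inject₁ i) (Fin.suc i)
    ... | step | yes d = inj₁ (subst (_≤ label (inject₁ i))
      (trans (cong (label (Fin.suc i) +_) (if-yes (descent? (σ , c) (inject₁ i) (Fin.suc i)) d)) (ℕ.+-comm _ 1)) step)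
    ... | step | no ¬d with ℕ.m≤n⇒m<n∨m≡n (subst (_≤ label (inject₁ i))
      (trans (cong (label (Fin.suc i) +_) (if-no (descent? (σ , c) (inject₁ i) (Fin.suc i)) ¬d)) (ℕ.+-identityʳ _)) step)
    ...   | inj₁ less = inj₁ less
    ...   | inj₂ eq   = inj₂ (Fin.toℕ-injective eq , ¬d)

    -- Otherwise r f - c would be negative. The end condition gives the claim at the last position.
    -- Going left, either the label drops strictly and is positive anyway, or labels agree without a
    -- descent; then colours weakly increase, so a positive colour persists at the next position and
    -- its positive label is shared.
    positive-level : Valid (σ , c) f → ∀ i → 0 < col i → 0 < label i
    positive-level valid = backward-induction _
      (λ 0<c → subst (_≤ label (Fin.fromℕ m))
        (if-yes (1 ℕ.≤? lastColor c) (subst (λ k → 0 < toℕ k) (sym (last≡lookup c)) 0<c)) (compatible-last f valid))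
      λ i ih 0<c → case-of (level-dichotomy valid i) ih 0<c
      where
      case-of : ∀ {i} → label (Fin.suc i) < label (inject₁ i) ⊎
        (lookup f (Fin.suc i) ≡ lookup f (inject₁ i) × ¬ Descent (σ , c) (inject₁ i) (Fin.suc i)) →
        (0 < col (Fin.suc i) → 0 < label (Fin.suc i)) →
        0 < col (inject₁ i) → 0 < label (inject₁ i)
      case-of (inj₁ less)      ih 0<c = ℕ.≤-<-trans z≤n less
      case-of (inj₂ (eq , ¬d)) ih 0<c = subst (λ k → 0 < toℕ k) eq (ih (ℕ.<-≤-trans 0<c (ℕ.≮⇒≥ (¬d ∘ inj₁))))

    colour≤level : Valid (σ , c) f → ∀ i → col i ≤ r * label i
    colour≤level valid i with col i ℕ.≟ 0
    ... | yes c≡0 = subst (_≤ r * label i) (sym c≡0) z≤n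
    ... | no  c≢0 = ℕ.≤-trans (ℕ.<⇒≤ (Fin.toℕ<n (lookup c i)))
      (ℕ.≤-trans (ℕ.≤-reflexive (sym (ℕ.*-identityʳ r))) (ℕ.*-monoʳ-≤ r (positive-level valid i (ℕ.n≢0⇒n>0 c≢0))))

    encode : Valid (σ , c) f → ∃ λ w → Encodes ((σ , c) , f) w
    encode valid = w , λ i → trans (cong (_+ col i) (letter i)) (ℕ.m∸n+n≡m (colour≤level valid i))
      where
      index : ∀ p → ∃ λ i → lookup σ i ≡ p
      index = injective⇒surjective (lookup σ) σ-injective
      x : Fin n → ℕ
      x i = r * label i ∸ col i
      x<K : ∀ i → x i < K
      x<K i = s≤s (ℕ.≤-trans (ℕ.m∸n≤m _ (col i)) (ℕ.*-monoʳ-≤ r (ℕ.≤-pred (Fin.toℕ<n (lookup f i)))))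
      w : Word
      w = Vec.tabulate λ p → Fin.fromℕ< (x<K (proj₁ (index p)))
      letter : ∀ i → letterAt w (lookup σ i) ≡ x i
      letter i = trans (cong toℕ (lookup∘tabulate (λ p → Fin.fromℕ< (x<K (proj₁ (index p)))) (lookup σ i))) (trans (Fin.toℕ-fromℕ< (x<K (proj₁ (index (lookup σ i)))))
        (cong x (σ-injective (proj₂ (index (lookup σ i))))))

    module _ {w : Word} (encodes : Encodes ((σ , c) , f) w) where

      open Standardization (letterAt w)

      letter : Fin n → ℕ
      letter i = letterAt w (lookup σ i)

      -- A drop of the label outweighs the colours, which are below r. At equal labels a non-descent
      -- means a smaller colour, hence a larger letter, or equal colours and increasing positions.
      -- So σ is the standardization of the encoded word and can be recovered from it.
      sorted : Valid (σ , c) f → ∀ {i j} → i Fin.< j → lookup σ i ≺ lookup σ j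
      sorted valid = adjacent⇒ordered (λ i j → lookup σ i ≺ lookup σ j) ≺-trans adjacent
        where
        adjacent : ∀ i → lookup σ (inject₁ i) ≺ lookup σ (Fin.suc i)
        adjacent i with level-dichotomy valid i
        ... | inj₁ less = inj₁ (ℕ.+-cancelʳ-< (col (inject₁ i)) _ _ (begin-strict
          letter (Fin.suc i) + col (inject₁ i)
            <⟨ ℕ.+-mono-≤-< (subst (letter (Fin.suc i) ≤_) (encodes (Fin.suc i)) (ℕ.m≤m+n _ _)) (Fin.toℕ<n (lookup c (inject₁ i))) ⟩
          r * label (Fin.suc i) + r
            ≡⟨ trans (ℕ.+-comm _ r) (sym (ℕ.*-suc r _)) ⟩
          r * suc (label (Fin.suc i))
            ≤⟨ ℕ.*-monoʳ-≤ r less ⟩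
          r * label (inject₁ i)
            ≡⟨ encodes (inject₁ i) ⟨
          letter (inject₁ i) + col (inject₁ i) ∎))
          where open ℕ.≤-Reasoning
        ... | inj₂ (eq , ¬d) = by-colour (ℕ.m≤n⇒m<n∨m≡n (ℕ.≮⇒≥ (¬d ∘ inj₁)))
          where
          balance : letter (Fin.suc i) + col (Fin.suc i) ≡ letter (inject₁ i) + col (inject₁ i)
          balance = trans (encodes (Fin.suc i)) (trans (cong (λ k → r * toℕ k) eq) (sym (encodes (inject₁ i))))
          by-colour : col (inject₁ i) < col (Fin.suc i) ⊎ col (inject₁ i) ≡ col (Fin.suc i) →
                      lookup σ (inject₁ i) ≺ lookup σ (Fin.suc i)
          by-colour (inj₁ c<c) = inj₁ (ℕ.+-cancelʳ-< (col (Fin.suc i)) _ _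
            (subst (_< letter (inject₁ i) + col (Fin.suc i)) (sym balance) (ℕ.+-monoʳ-< (letter (inject₁ i)) c<c)))
          by-colour (inj₂ c≡c) = inj₂
            ( sym (ℕ.+-cancelʳ-≡ (col (Fin.suc i)) _ _ (trans balance (cong (letter (inject₁ i) +_) c≡c)))
            , ℕ.≤∧≢⇒< (ℕ.≮⇒≥ (λ σ<σ → ¬d (inj₂ (Fin.toℕ-injective c≡c , σ<σ))))
                (λ σ≡σ → ℕ.<⇒≢ (inject₁<suc i) (cong toℕ (σ-injective (Fin.toℕ-injective σ≡σ)))))

      colour≡ : ∀ i → colour r (letter i) ≡ col i
      colour≡ i = proj₂ (level-unique r (+-colour r (letter i)) (colour<r r (letter i)) (encodes i) (Fin.toℕ<n (lookup c i)))

      level≡ : ∀ i → level r (letter i) ≡ label i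
      level≡ i = proj₁ (level-unique r (+-colour r (letter i)) (colour<r r (letter i)) (encodes i) (Fin.toℕ<n (lookup c i)))

      wordFexc≡fexc : (∀ {i j} → i Fin.< j → lookup σ i ≺ lookup σ j) → wordFexc r [] (letters w) ≡ fexc (σ , c)
      wordFexc≡fexc σ-sorted = begin
        wordFexc r [] (letters w)
          ≡⟨ wordFexc≡sumFin r [] w ⟩
        sumFin (λ p → excess r (letterAt w p) (smallerLeft w p) (largerRight w p))
          ≡⟨ sumFin-permute (lookup σ) σ-injective (λ p → excess r (letterAt w p) (smallerLeft w p) (largerRight w p)) ⟩
        sumFin (λ i → excess r (letter i) (smallerLeft w (lookup σ i)) (largerRight w (lookup σ i)))
          ≡⟨ sumFin-cong (λ i → excess≡ r {letter i} (i Fin.<? lookup σ i) (colour≡ i) (Sorted.excedance⇔ (lookup σ) σ-injective σ-sorted i)) ⟩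
        sumFin (λ i → r * exceeds i + col i)
          ≡⟨ trans (sumFin-+ {n} (λ i → r * exceeds i) col) (cong (_+ sumFin col) (sumFin-* {n} r exceeds)) ⟩
        r * sumFin exceeds + sumFin col
          ≡⟨ cong₂ (λ a b → r * a + b)
               (count≡sumFin (λ i → (i Fin.<? lookup σ i) ×-dec (col i ℕ.≟ 0)) id)
               (trans (vec-sum≡sumFin (Vec.map toℕ c)) (sumFin-cong λ i → lookup-map i toℕ c)) ⟨
        fexc (σ , c) ∎
        where
        open ≡-Reasoning
        exceeds : Fin n → ℕ
        exceeds i = ι ((i Fin.<? lookup σ i) ×-dec (col i ℕ.≟ 0))

      sorted⇒valid : (∀ {i j} → i Fin.< j → lookup σ i ≺ lookup σ j) → Valid (σ , c) f
      sorted⇒valid σ-sorted = compatible⁺ f step last-step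
        where
        weakly : ∀ {p q} → p ≺ q → letterAt w q ≤ letterAt w p
        weakly (inj₁ q<p)      = ℕ.<⇒≤ q<p
        weakly (inj₂ (eq , _)) = ℕ.≤-reflexive (sym eq)
        step : ∀ i → label (Fin.suc i) + strict (σ , c) i ≤ label (inject₁ i)
        step i with descent? (σ , c) (inject₁ i) (Fin.suc i)
        ... | no ¬d = subst (_≤ label (inject₁ i))
          (sym (trans (cong (label (Fin.suc i) +_) (if-no (descent? (σ , c) (inject₁ i) (Fin.suc i)) ¬d)) (ℕ.+-identityʳ _)))
          (level-≤ r (encodes (Fin.suc i)) (Fin.toℕ<n (lookup c (Fin.suc i)))
            (ℕ.≤-trans (weakly (σ-sorted (inject₁<suc i))) (subst (letter (inject₁ i) ≤_) (encodes (inject₁ i)) (ℕ.m≤m+n _ _))))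
        ... | yes d = subst (_≤ label (inject₁ i))
          (sym (trans (cong (label (Fin.suc i) +_) (if-yes (descent? (σ , c) (inject₁ i) (Fin.suc i)) d)) (ℕ.+-comm _ 1)))
          (ℕ.≤∧≢⇒< (level-≤ r (encodes (Fin.suc i)) (Fin.toℕ<n (lookup c (Fin.suc i)))
            (ℕ.≤-trans (weakly (σ-sorted (inject₁<suc i))) (subst (letter (inject₁ i) ≤_) (encodes (inject₁ i)) (ℕ.m≤m+n _ _))))
            -- At a descent, equal labels would put `σ (i + 1)` before `σ i` in the order `_≺_`.
            (λ eq → absurd d (trans (encodes (Fin.suc i)) (trans (cong (r *_) eq) (sym (encodes (inject₁ i))))) (σ-sorted (inject₁<suc i))))
          where
          absurd : Descent (σ , c) (inject₁ i) (Fin.suc i) →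
            letter (Fin.suc i) + col (Fin.suc i) ≡ letter (inject₁ i) + col (inject₁ i) →
            ¬ lookup σ (inject₁ i) ≺ lookup σ (Fin.suc i)
          absurd (inj₁ c<c) balance p = ℕ.<⇒≢ (ℕ.+-mono-≤-< (weakly p) c<c) balance
          absurd (inj₂ (c≡c , _)) balance (inj₁ g<g) = ℕ.<⇒≢ (ℕ.+-mono-<-≤ g<g (ℕ.≤-reflexive (cong toℕ (sym c≡c)))) balance
          absurd (inj₂ (_ , σ<σ)) balance (inj₂ (_ , σ<σ′)) = ℕ.<-asym σ<σ σ<σ′
        last-step : end (σ , c) ≤ label (Fin.fromℕ m)
        last-step with 1 ℕ.≤? lastColor c
        ... | no 1≰ = subst (_≤ label (Fin.fromℕ m)) (sym (if-no (1 ℕ.≤? lastColor c) 1≰)) z≤n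
        ... | yes 1≤ = subst (_≤ label (Fin.fromℕ m)) (sym (if-yes (1 ℕ.≤? lastColor c) 1≤)) (ℕ.n≢0⇒n>0 λ f≡0 →
          ℕ.<⇒≱ (subst (λ k → 0 < toℕ k) (last≡lookup c) 1≤)
            (ℕ.≤-trans (ℕ.m≤n+m _ _) (ℕ.≤-reflexive (trans (encodes (Fin.fromℕ m)) (trans (cong (r *_) f≡0) (ℕ.*-zeroʳ r))))))

  decode : ∀ w → ∃ λ π → ∃ λ f → VecUnique.Unique (proj₁ π) × Valid π f × Encodes (π , f) w × fexc π ≡ wordFexc r [] (letters w)
  decode w = (σ , c) , f , σ! , sorted⇒valid {c = c} {f} σ! {w} encodes σ-sorted , encodes , sym (wordFexc≡fexc {c = c} {f} σ! {w} encodes σ-sorted)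
    where
    open Standardization (letterAt w)
    s : Fin n → Fin n
    s = proj₁ sorting
    rank-s : ∀ i → rank (s i) ≡ toℕ i
    rank-s = proj₂ sorting
    level≤t : ∀ p → level r (letterAt w p) < suc t
    level≤t p = s≤s (level-≤ r (+-colour r (letterAt w p)) (colour<r r (letterAt w p)) (ℕ.≤-pred (Fin.toℕ<n (lookup w p))))
    σ : Vec (Fin n) n
    σ = Vec.tabulate s
    c : Vec (Fin r) n
    c = Vec.tabulate λ i → Fin.fromℕ< (colour<r r (letterAt w (s i)))
    f : Labelling
    f = Vec.tabulate λ i → Fin.fromℕ< (level≤t (s i))
    σ! : VecUnique.Unique σ
    σ! = VecUnique.tabulate⁺ λ {i} {j} eq → Fin.toℕ-injective (trans (sym (rank-s i)) (trans (cong rank eq) (rank-s j)))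
    σ≡ : ∀ i → lookup σ i ≡ s i
    σ≡ = lookup∘tabulate s
    encodes : Encodes ((σ , c) , f) w
    encodes i = trans (cong₂ _+_ (cong (letterAt w) (σ≡ i))
        (trans (cong toℕ (lookup∘tabulate (λ i → Fin.fromℕ< (colour<r r (letterAt w (s i)))) i)) (Fin.toℕ-fromℕ< (colour<r r (letterAt w (s i))))))
      (trans (+-colour r (letterAt w (s i))) (cong (r *_) (sym
        (trans (cong toℕ (lookup∘tabulate (λ i → Fin.fromℕ< (level≤t (s i))) i)) (Fin.toℕ-fromℕ< (level≤t (s i)))))))
    σ-sorted : ∀ {i j} → i Fin.< j → lookup σ i ≺ lookup σ j
    σ-sorted {i} {j} i<j = subst₂ _≺_ (sym (σ≡ i)) (sym (σ≡ j))
      (rank-cancel (subst₂ _<_ (sym (rank-s i)) (sym (rank-s j)) i<j))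

  encodes-functional : ∀ {σ c f w w′} → VecUnique.Unique σ → Encodes ((σ , c) , f) w → Encodes ((σ , c) , f) w′ → w ≡ w′
  encodes-functional {σ} {c} {f} {w} {w′} σ! enc enc′ = trans (sym (tabulate∘lookup w)) (trans (tabulate-cong same) (tabulate∘lookup w′))
    where
    same : ∀ p → lookup w p ≡ lookup w′ p
    same p with injective⇒surjective (lookup σ) (λ {i} {j} → VecUnique.lookup-injective σ! i j) p
    ... | i , refl = Fin.toℕ-injective (ℕ.+-cancelʳ-≡ (toℕ (lookup c i)) _ _ (trans (enc i) (sym (enc′ i))))

  -- Both permutations invert `rank`, which depends on `w` alone; colours and labels are then read
  -- off the letters.
  encodes-injective : ∀ {σ σ′ c c′ f f′ w} → VecUnique.Unique σ → VecUnique.Unique σ′ → Valid (σ , c) f → Valid (σ′ , c′) f′ →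
    Encodes ((σ , c) , f) w → Encodes ((σ′ , c′) , f′) w → _≡_ {A = Colored × Labelling} ((σ , c) , f) ((σ′ , c′) , f′)
  encodes-injective {σ} {σ′} {c} {c′} {f} {f′} {w} σ! σ′! v v′ enc enc′ =
    cong₂ _,_ (cong₂ _,_ (ext σ≡σ′) (ext c≡c′)) (ext f≡f′)
    where
    open Standardization (letterAt w)
    ext : ∀ {A : Set} {k} {xs ys : Vec A k} → (∀ i → lookup xs i ≡ lookup ys i) → xs ≡ ys
    ext {xs = xs} {ys} eq = trans (sym (tabulate∘lookup xs)) (trans (tabulate-cong eq) (tabulate∘lookup ys))
    σ≡σ′ : ∀ i → lookup σ i ≡ lookup σ′ i
    σ≡σ′ i = rank-injective (trans (Sorted.rank-σ (lookup σ) (σ-injective {c = c} {f} σ!) (sorted {c = c} {f} σ! {w} enc v) i)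
      (sym (Sorted.rank-σ (lookup σ′) (σ-injective {c = c′} {f′} σ′!) (sorted {c = c′} {f′} σ′! {w} enc′ v′) i)))
    c≡c′ : ∀ i → lookup c i ≡ lookup c′ i
    c≡c′ i = Fin.toℕ-injective (trans (sym (colour≡ {c = c} {f} σ! {w} enc i)) (trans (cong (colour r ∘ letterAt w) (σ≡σ′ i)) (colour≡ {c = c′} {f′} σ′! {w} enc′ i)))
    f≡f′ : ∀ i → lookup f i ≡ lookup f′ i
    f≡f′ i = Fin.toℕ-injective (trans (sym (level≡ {c = c} {f} σ! {w} enc i)) (trans (cong (level r ∘ letterAt w) (σ≡σ′ i)) (level≡ {c = c′} {f′} σ′! {w} enc′ i)))

  labellings : List Labelling
  labellings = words (List.allFin (suc t)) n

  colored-∈⁻ : ∀ {e σ c} → (σ , c) ∈ coloredPermutationsWithFexc r n e → VecUnique.Unique σ × fexc (σ , c) ≡ e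
  colored-∈⁻ {e} π∈ =
    let π∈′ , fexc≡ = ∈-filter⁻ (λ π → fexc π ℕ.≟ e) π∈
        σ∈ , _ = ∈-cartesianProduct⁻ (permutations n) (words (List.allFin r) n) π∈′
    in proj₂ (∈-filter⁻ _ {xs = words (List.allFin n) n} σ∈) , fexc≡

  colored-∈⁺ : ∀ {e σ c} → VecUnique.Unique σ → fexc (σ , c) ≡ e → (σ , c) ∈ coloredPermutationsWithFexc r n e
  colored-∈⁺ {e} {σ} {c} σ! fexc≡ = ∈-filter⁺ (λ π → fexc π ℕ.≟ e)
    (∈-cartesianProduct⁺ (∈-filter⁺ _ (words-complete σ) σ!) (words-complete c)) fexc≡

  colored-unique : ∀ e → List.Unique (coloredPermutationsWithFexc r n e)
  colored-unique e = Unique.filter⁺ _ (Unique.cartesianProduct⁺ (Unique.filter⁺ _ (words-unique n n)) (words-unique r n))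

  depth-count : ∀ π → B n (depth π) t ≡ sumOver labellings (λ f → ι (compatible? (strict π) (end π) f))
  depth-count π = sym (trans (compatible-total t m (strict π) (end π) (λ i → ι≤1 (descent? π (inject₁ i) (Fin.suc i))) (ι≤1 (1 ℕ.≤? lastColor (proj₂ π))))
    (cong (λ k → B n (k + end π) t) (sym (count≡sumFin (λ i → descent? π (inject₁ i) (Fin.suc i)) id))))

  -- Double counting of the pairs of a coloured permutation and a valid labelling: for a fixed
  -- permutation they number `B n (depth π) t`, and encoding matches them with words.
  labelled-count : ∀ e → sumOver (coloredPermutationsWithFexc r n e) (λ π → B n (depth π) t) ≡
                   sumOver (words (List.allFin K) n) (λ w → ι (wordFexc r [] (letters w) ℕ.≟ e))
  labelled-count e = begin
    sumOver CP (λ π → B n (depth π) t)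
      ≡⟨ sumOver-cong CP (λ {π} _ → depth-count π) ⟩
    sumOver CP (λ π → sumOver labellings λ f → ι (valid? (π , f)))
      ≡⟨ sumOver-cartesianProductWith _,_ CP labellings (λ p → ι (valid? p)) ⟨
    sumOver pairs (λ p → ι (valid? p))
      ≡⟨ sumOver-cong pairs (λ {p} _ → ℕ.*-identityʳ (ι (valid? p))) ⟨
    sumOver pairs (λ p → ι (valid? p) * 1)
      ≡⟨ sumOver-filter valid? pairs (λ _ → 1) ⟨
    sumOver (List.filter valid? pairs) (λ _ → 1)
      ≡⟨ sumOver-bijection Encodes (λ _ → 1) (λ _ → 1) (List.filter valid? pairs) (List.filter fexc? W)
           (Unique.filter⁺ valid? (Unique.cartesianProduct⁺ (colored-unique e) (words-unique (suc t) n)))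
           (Unique.filter⁺ fexc? (words-unique K n))
           to from
           functional
           (λ {_} {_} {w} → injective {w = w})
           (λ _ _ _ → refl) ⟩
    sumOver (List.filter fexc? W) (λ _ → 1)
      ≡⟨ sumOver-filter fexc? W (λ _ → 1) ⟩
    sumOver W (λ w → ι (fexc? w) * 1)
      ≡⟨ sumOver-cong W (λ {w} _ → ℕ.*-identityʳ (ι (fexc? w))) ⟩
    sumOver W (λ w → ι (fexc? w)) ∎
    where
    open ≡-Reasoning
    CP : List Colored
    CP = coloredPermutationsWithFexc r n e
    pairs : List (Colored × Labelling)
    pairs = List.cartesianProduct CP labellings
    W : List Word
    W = words (List.allFin K) n
    valid? : ∀ p → Dec (Valid (proj₁ p) (proj₂ p))
    valid? (π , f) = compatible? (strict π) (end π) f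
    fexc? : ∀ (w : Word) → Dec (wordFexc r [] (letters w) ≡ e)
    fexc? w = wordFexc r [] (letters w) ℕ.≟ e
    member : ∀ {σ c f} → ((σ , c) , f) ∈ List.filter valid? pairs → VecUnique.Unique σ × Valid (σ , c) f × fexc (σ , c) ≡ e
    member p∈ =
      let p∈′ , valid = ∈-filter⁻ valid? p∈
          σ! , fexc≡ = colored-∈⁻ (proj₁ (∈-cartesianProduct⁻ CP labellings p∈′))
      in σ! , valid , fexc≡
    functional : ∀ {p w w′} → p ∈ List.filter valid? pairs → Encodes p w → Encodes p w′ → w ≡ w′
    functional {(σ , c) , f} {w} {w′} p∈ = encodes-functional {c = c} {f} {w} {w′} (proj₁ (member p∈))
    injective : ∀ {p p′ w} → p ∈ List.filter valid? pairs → p′ ∈ List.filter valid? pairs → Encodes p w → Encodes p′ w → p ≡ p′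
    injective {w = w} p∈ p′∈ = encodes-injective {w = w} (proj₁ (member p∈)) (proj₁ (member p′∈))
      (proj₁ (proj₂ (member p∈))) (proj₁ (proj₂ (member p′∈)))
    to : ∀ {p} → p ∈ List.filter valid? pairs → ∃ λ w → w ∈ List.filter fexc? W × Encodes p w
    to {(σ , c) , f} p∈ =
      let σ! , valid , fexc≡ = member p∈
          w , enc = encode {c = c} {f} σ! valid
      in w , ∈-filter⁺ fexc? (words-complete w) (trans (wordFexc≡fexc {c = c} {f} σ! {w} enc (sorted {c = c} {f} σ! {w} enc valid)) fexc≡) , enc
    from : ∀ {w} → w ∈ List.filter fexc? W → ∃ λ p → p ∈ List.filter valid? pairs × Encodes p w
    from {w} w∈ =
      let π , f , σ! , valid , enc , fexc≡ = decode w
      in (π , f) , ∈-filter⁺ valid? (∈-cartesianProduct⁺ (colored-∈⁺ σ! (trans fexc≡ (proj₂ (∈-filter⁻ fexc? {xs = W} w∈)))) (words-complete f)) valid , enc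

-- Real inequalities between rationals and integers

½-pos : ∀ {ε} → 0ℚ ℚ.< ε → 0ℚ ℚ.< ℚ.½ ℚ.* ε
½-pos {ε} 0<ε = subst (ℚ._< ℚ.½ ℚ.* ε) (ℚ.*-zeroʳ ℚ.½) (ℚ.*-monoʳ-<-pos ℚ.½ 0<ε)

½+½ : ∀ ε → ℚ.½ ℚ.* ε ℚ.+ ℚ.½ ℚ.* ε ≡ ε
½+½ ε = trans (sym (ℚ.*-distribʳ-+ ε ℚ.½ ℚ.½)) (ℚ.*-identityˡ ε)

p≤p+ε : ∀ p {ε} → 0ℚ ℚ.< ε → p ℚ.≤ p ℚ.+ ε
p≤p+ε p {ε} 0<ε = subst (ℚ._≤ p ℚ.+ ε) (ℚ.+-identityʳ p) (ℚ.+-monoʳ-≤ p (ℚ.<⇒≤ 0<ε))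

p≤∣p∣ : ∀ p → p ℚ.≤ ℚ.∣ p ∣
p≤∣p∣ p with ℚ.≤-total 0ℚ p
... | inj₁ 0≤p = ℚ.≤-reflexive (sym (ℚ.0≤p⇒∣p∣≡p 0≤p))
... | inj₂ p≤0 = ℚ.≤-trans p≤0 (ℚ.0≤∣p∣ p)

pointwise⇒≤ᴿ : ∀ {x y} → (∀ m → seq x m ℚ.≤ seq y m) → x ≤ᴿ y
pointwise⇒≤ᴿ {x} {y} h ε 0<ε = 0 , λ m _ → ℚ.≤-trans (h m) (p≤p+ε (seq y m) 0<ε)

pointwise⇒≈ᴿ : ∀ {x y} → (∀ m → seq x m ≡ seq y m) → x ≈ᴿ y
pointwise⇒≈ᴿ {x} {y} h ε 0<ε = 0 , λ m _ → subst (ℚ._≤ ε)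
  (sym (cong ℚ.∣_∣ (trans (cong (ℚ._- seq y m) (h m)) (ℚ.+-inverseʳ (seq y m))))) (ℚ.<⇒≤ 0<ε)

≤ᴿ-trans : ∀ {x y z} → x ≤ᴿ y → y ≤ᴿ z → x ≤ᴿ z
≤ᴿ-trans {x} {y} {z} p q ε 0<ε with p _ (½-pos 0<ε) | q _ (½-pos 0<ε)
... | M , f | N , g = M ℕ.⊔ N , λ m b → ℚ.≤-trans (f m (ℕ.m⊔n≤o⇒m≤o M N b))
  (ℚ.≤-trans (ℚ.+-monoˡ-≤ (ℚ.½ ℚ.* ε) (g m (ℕ.m⊔n≤o⇒n≤o M N b)))
    (ℚ.≤-reflexive (trans (ℚ.+-assoc (seq z m) _ _) (cong (seq z m ℚ.+_) (½+½ ε)))))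

≈ᴿ⇒≤ᴿ : ∀ {x y} → x ≈ᴿ y → x ≤ᴿ y
≈ᴿ⇒≤ᴿ {x} {y} p ε 0<ε with p ε 0<ε
... | N , f = N , λ m b → ℚ.≤-trans (ℚ.≤-reflexive (solve 2 (λ x y → x := y :+ (x :- y)) refl (seq x m) (seq y m)))
  (ℚ.+-monoʳ-≤ (seq y m) (ℚ.≤-trans (p≤∣p∣ _) (f m b)))

≈ᴿ⇒≥ᴿ : ∀ {x y} → x ≈ᴿ y → y ≤ᴿ x
≈ᴿ⇒≥ᴿ {x} {y} p ε 0<ε with p ε 0<ε
... | N , f = N , λ m b → ℚ.≤-trans (ℚ.≤-reflexive (solve 2 (λ x y → y := x :- (x :- y)) refl (seq x m) (seq y m)))
  (ℚ.+-monoʳ-≤ (seq x m) (ℚ.≤-trans (p≤∣p∣ (ℚ.- (seq x m ℚ.- seq y m)))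
    (ℚ.≤-trans (ℚ.≤-reflexive (ℚ.∣-p∣≡∣p∣ (seq x m ℚ.- seq y m))) (f m b))))

+ᴿ-mono-≤ᴿ : ∀ {x x′ y y′} → x ≤ᴿ x′ → y ≤ᴿ y′ → x +ᴿ y ≤ᴿ x′ +ᴿ y′
+ᴿ-mono-≤ᴿ {x} {x′} {y} {y′} p q ε 0<ε with p _ (½-pos 0<ε) | q _ (½-pos 0<ε)
... | M , f | N , g = M ℕ.⊔ N , λ m b → ℚ.≤-trans
  (ℚ.+-mono-≤ (f m (ℕ.m⊔n≤o⇒m≤o M N b)) (g m (ℕ.m⊔n≤o⇒n≤o M N b)))
  (ℚ.≤-reflexive (trans (solve 3 (λ a b h → (a :+ h) :+ (b :+ h) := a :+ b :+ (h :+ h)) refl (seq x′ m) (seq y′ m) (ℚ.½ ℚ.* ε))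
    (cong (seq x′ m ℚ.+ seq y′ m ℚ.+_) (½+½ ε))))

≤ᴿ-refl : ∀ {x} → x ≤ᴿ x
≤ᴿ-refl {x} = pointwise⇒≤ᴿ {x} {x} λ m → ℚ.≤-refl

·ᴿ-mono-≤ᴿ : ∀ t {x y} → x ≤ᴿ y → t ·ᴿ x ≤ᴿ t ·ᴿ y
·ᴿ-mono-≤ᴿ zero            p = ≤ᴿ-refl {fromℕᴿ 0}
·ᴿ-mono-≤ᴿ (suc t) {x} {y} p = +ᴿ-mono-≤ᴿ {x} {y} {t ·ᴿ x} {t ·ᴿ y} p (·ᴿ-mono-≤ᴿ t {x} {y} p)

seq-·ᴿ : ∀ t x m → seq (t ·ᴿ x) m ≡ fromℕ t ℚ.* seq x m
seq-·ᴿ zero    x m = sym (ℚ.*-zeroˡ (seq x m))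
seq-·ᴿ (suc t) x m = trans (cong (seq x m ℚ.+_) (seq-·ᴿ t x m))
  (trans (solve 2 (λ t x → x :+ t :* x := (con 1ℚ :+ t) :* x) refl (fromℕ t) (seq x m)) (cong (ℚ._* seq x m) (sym (fromℕ-suc t))))

sumᴿ-mono-≤ᴿ : ∀ {n} {x y : Vector ℝ n} → (∀ i → x i ≤ᴿ y i) → sumᴿ x ≤ᴿ sumᴿ y
sumᴿ-mono-≤ᴿ {zero}          p = ≤ᴿ-refl {fromℕᴿ 0}
sumᴿ-mono-≤ᴿ {suc n} {x} {y} p = +ᴿ-mono-≤ᴿ {x Fin.zero} {y Fin.zero} {sumᴿ (x ∘ Fin.suc)} {sumᴿ (y ∘ Fin.suc)}
  (p Fin.zero) (sumᴿ-mono-≤ᴿ {n} {x ∘ Fin.suc} {y ∘ Fin.suc} (p ∘ Fin.suc))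

seq-sumᴿ-·ᴿ : ∀ {n} t (x : Vector ℝ n) m → seq (sumᴿ λ i → t ·ᴿ x i) m ≡ fromℕ t ℚ.* seq (sumᴿ x) m
seq-sumᴿ-·ᴿ {zero}  t x m = sym (ℚ.*-zeroʳ (fromℕ t))
seq-sumᴿ-·ᴿ {suc n} t x m = trans (cong₂ ℚ._+_ (seq-·ᴿ t (x Fin.zero) m) (seq-sumᴿ-·ᴿ t (x ∘ Fin.suc) m))
  (sym (ℚ.*-distribˡ-+ (fromℕ t) (seq (x Fin.zero) m) _))

sumℤ : ∀ {n} → Vec ℤ n → ℤ
sumℤ []      = ℤ.+ 0
sumℤ (a ∷ v) = a ℤ.+ sumℤ v

seq-sumᴿ-fromℤᴿ : ∀ {n} (v : Vec ℤ n) m → seq (sumᴿ λ i → fromℤᴿ (lookup v i)) m ≡ fromℤ (sumℤ v)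
seq-sumᴿ-fromℤᴿ []      m = refl
seq-sumᴿ-fromℤᴿ (a ∷ v) m = trans (cong (fromℤ a ℚ.+_) (seq-sumᴿ-fromℤᴿ v m)) (sym (fromℤ-+ a (sumℤ v)))

≤-from-ε : ∀ {p q} → (∀ ε → 0ℚ ℚ.< ε → p ℚ.≤ q ℚ.+ ε) → p ℚ.≤ q
≤-from-ε {p} {q} h with p ℚ.≤? q
... | yes p≤q = p≤q
... | no  p≰q = contradiction (h (ℚ.½ ℚ.* (p ℚ.- q)) (½-pos 0<d)) (λ p≤ → ℚ.<-irrefl refl (ℚ.≤-<-trans p≤ q+<p))
  where
  d = p ℚ.- q
  0<d : 0ℚ ℚ.< d
  0<d = subst (ℚ._< d) (ℚ.+-inverseʳ q) (ℚ.+-monoˡ-< (ℚ.- q) (ℚ.≰⇒> p≰q))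
  q+<p : q ℚ.+ ℚ.½ ℚ.* d ℚ.< p
  q+<p = ℚ.<-≤-trans (ℚ.+-monoʳ-< q (subst (ℚ._< d) (ℚ.+-identityʳ (ℚ.½ ℚ.* d))
      (subst (ℚ.½ ℚ.* d ℚ.+ 0ℚ ℚ.<_) (½+½ d) (ℚ.+-monoʳ-< (ℚ.½ ℚ.* d) (½-pos 0<d)))))
    (ℚ.≤-reflexive (solve 2 (λ p q → q :+ (p :- q) := p) refl p q))

fromℚᴿ-cancel-≤ : ∀ {p q} → fromℚᴿ p ≤ᴿ fromℚᴿ q → p ℚ.≤ q
fromℚᴿ-cancel-≤ h = ≤-from-ε λ ε 0<ε → let N , f = h ε 0<ε in f N ℕ.≤-refl

-- Half of the gap in the strict inequality absorbs the error allowed in the weak one.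
≤ᴿ-<ᴿ-cancel : ∀ {p q x} → fromℚᴿ p ≤ᴿ x → x <ᴿ fromℚᴿ q → p ℚ.< q
≤ᴿ-<ᴿ-cancel {p} {q} {x} p≤x (ε , 0<ε , N , f) with p≤x _ (½-pos 0<ε)
... | M , g = ℚ.<-≤-trans (ℚ.≤-<-trans (g m (ℕ.m≤m⊔n M N)) (ℚ.+-monoʳ-< (seq x m) ½ε<ε)) (f m (ℕ.m≤n⊔m M N))
  where
  m = M ℕ.⊔ N
  ½ε<ε : ℚ.½ ℚ.* ε ℚ.< ε
  ½ε<ε = subst (ℚ._< ε) (ℚ.+-identityʳ (ℚ.½ ℚ.* ε))
    (subst (ℚ.½ ℚ.* ε ℚ.+ 0ℚ ℚ.<_) (½+½ ε) (ℚ.+-monoʳ-< (ℚ.½ ℚ.* ε) (½-pos 0<ε)))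

fromℕ-positive : ∀ t .{{_ : NonZero t}} → ℚ.Positive (fromℕ t)
fromℕ-positive t = ℚ.positive (fromℕ-mono-< (ℕ.>-nonZero⁻¹ t))

·ᴿ-mono-<ᴿ : ∀ t .{{_ : NonZero t}} {x q} → x <ᴿ fromℚᴿ q → t ·ᴿ x <ᴿ fromℚᴿ (fromℕ t ℚ.* q)
·ᴿ-mono-<ᴿ t {x} {q} (ε , 0<ε , N , f) = fromℕ t ℚ.* ε
  , subst (ℚ._< fromℕ t ℚ.* ε) (ℚ.*-zeroʳ (fromℕ t)) (ℚ.*-monoʳ-<-pos (fromℕ t) 0<ε) , N , λ m b →
  ℚ.≤-trans (ℚ.≤-reflexive (trans (cong (ℚ._+ fromℕ t ℚ.* ε) (seq-·ᴿ t x m)) (sym (ℚ.*-distribˡ-+ (fromℕ t) (seq x m) ε))))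
    (ℚ.*-monoˡ-≤-nonNeg (fromℕ t) {{ℚ.pos⇒nonNeg (fromℕ t)}} (f m b))
  where instance _ = fromℕ-positive t

-- Lattice points of dilated multi-hypersimplices

-- Membership in the dilate after multiplication by t, so that only integers are compared.
record LatticeConditions (r n k t : ℕ) (v : Vec ℤ n) : Set where
  field
    nonneg  : ∀ i → ℤ.+ 0 ℤ.≤ lookup v i
    bounded : ∀ i → lookup v i ℤ.≤ ℤ.+ (r * t)
    lower   : ℤ.+ t ℤ.* (ℤ.+ k ℤ.- ℤ.+ 1) ℤ.≤ sumℤ v
    upper<  : k < r * n → sumℤ v ℤ.< ℤ.+ (t * k)
    upper≤  : k ≡ r * n → sumℤ v ℤ.≤ ℤ.+ (t * k)

module _ (r n k t : ℕ) .{{_ : NonZero t}} (v : Vec ℤ n) where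
  private instance _ = fromℕ-positive t

  -- The inequalities for `x` are multiplied by t and carried over to `v` along `v≈tx`; between
  -- constant sequences they reduce to inequalities of rationals and hence of integers.
  lattice⇒conditions : LatticePoint (dilate t (MultiHypersimplex r n k)) v → LatticeConditions r n k t v
  lattice⇒conditions (x , inside , v≈tx) = record
    { nonneg  = λ i → fromℤ-cancel-≤ (fromℚᴿ-cancel-≤ (≤ᴿ-trans {fromℕᴿ 0} {t ·ᴿ x i} {fromℤᴿ (lookup v i)}
        (≤ᴿ-trans {fromℕᴿ 0} {t ·ᴿ fromℕᴿ 0} {t ·ᴿ x i}
          (pointwise⇒≤ᴿ {fromℕᴿ 0} {t ·ᴿ fromℕᴿ 0} λ m → ℚ.≤-reflexive (sym (trans (seq-·ᴿ t (fromℕᴿ 0) m) (ℚ.*-zeroʳ (fromℕ t)))))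
          (·ᴿ-mono-≤ᴿ t {fromℕᴿ 0} {x i} (nonneg i)))
        (≈ᴿ⇒≥ᴿ {fromℤᴿ (lookup v i)} {t ·ᴿ x i} (v≈tx i))))
    ; bounded = λ i → fromℤ-cancel-≤ (fromℚᴿ-cancel-≤ (≤ᴿ-trans {fromℤᴿ (lookup v i)} {t ·ᴿ x i} {fromℕᴿ (r * t)}
        (≈ᴿ⇒≤ᴿ {fromℤᴿ (lookup v i)} {t ·ᴿ x i} (v≈tx i))
        (≤ᴿ-trans {t ·ᴿ x i} {t ·ᴿ fromℕᴿ r} {fromℕᴿ (r * t)} (·ᴿ-mono-≤ᴿ t {x i} {fromℕᴿ r} (bounded i))
          (pointwise⇒≤ᴿ {t ·ᴿ fromℕᴿ r} {fromℕᴿ (r * t)} λ m → ℚ.≤-reflexive (trans (seq-·ᴿ t (fromℕᴿ r) m)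
            (trans (sym (fromℕ-* t r)) (cong fromℕ (ℕ.*-comm t r))))))))
    ; lower   = fromℤ-cancel-≤ (subst (ℚ._≤ fromℤ (sumℤ v)) (sym (fromℤ-* (ℤ.+ t) (ℤ.+ k ℤ.- ℤ.+ 1)))
        (fromℚᴿ-cancel-≤ {fromℕ t ℚ.* fromℤ k-1} {fromℤ (sumℤ v)} (≤ᴿ-trans {fromℚᴿ (fromℕ t ℚ.* fromℤ k-1)} {t ·ᴿ sumᴿ x} {fromℤᴿ (sumℤ v)}
          (≤ᴿ-trans {fromℚᴿ (fromℕ t ℚ.* fromℤ k-1)} {t ·ᴿ fromℤᴿ k-1} {t ·ᴿ sumᴿ x}
            (pointwise⇒≤ᴿ {fromℚᴿ (fromℕ t ℚ.* fromℤ k-1)} {t ·ᴿ fromℤᴿ k-1} λ m → ℚ.≤-reflexive (sym (seq-·ᴿ t (fromℤᴿ k-1) m)))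
            (·ᴿ-mono-≤ᴿ t {fromℤᴿ k-1} {sumᴿ x} lower))
          t·sum≤sumℤ)))
    ; upper<  = λ k<rn → fromℤ-cancel-< (subst (fromℤ (sumℤ v) ℚ.<_) (sym (fromℕ-* t k))
        (≤ᴿ-<ᴿ-cancel {fromℤ (sumℤ v)} {fromℕ t ℚ.* fromℕ k} {t ·ᴿ sumᴿ x} sumℤ≤t·sum
          (·ᴿ-mono-<ᴿ t {sumᴿ x} {fromℕ k} (upper< k<rn))))
    ; upper≤  = λ k≡rn → fromℤ-cancel-≤ (subst (fromℤ (sumℤ v) ℚ.≤_) (sym (fromℕ-* t k))
        (fromℚᴿ-cancel-≤ {fromℤ (sumℤ v)} {fromℕ t ℚ.* fromℕ k} (≤ᴿ-trans {fromℤᴿ (sumℤ v)} {t ·ᴿ sumᴿ x} {fromℚᴿ (fromℕ t ℚ.* fromℕ k)} sumℤ≤t·sum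
          (≤ᴿ-trans {t ·ᴿ sumᴿ x} {t ·ᴿ fromℕᴿ k} {fromℚᴿ (fromℕ t ℚ.* fromℕ k)} (·ᴿ-mono-≤ᴿ t {sumᴿ x} {fromℕᴿ k} (upper≤ k≡rn))
            (pointwise⇒≤ᴿ {t ·ᴿ fromℕᴿ k} {fromℚᴿ (fromℕ t ℚ.* fromℕ k)} λ m → ℚ.≤-reflexive (seq-·ᴿ t (fromℕᴿ k) m)))))) }
    where
    open MultiHypersimplex inside
    k-1 : ℤ
    k-1 = ℤ.+ k ℤ.- ℤ.+ 1
    tx v′ : Vector ℝ n
    tx i = t ·ᴿ x i
    v′ i = fromℤᴿ (lookup v i)
    t·sum≡ : ∀ m → seq (t ·ᴿ sumᴿ x) m ≡ seq (sumᴿ tx) m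
    t·sum≡ m = trans (seq-·ᴿ t (sumᴿ x) m) (sym (seq-sumᴿ-·ᴿ t x m))
    t·sum≤sumℤ : t ·ᴿ sumᴿ x ≤ᴿ fromℤᴿ (sumℤ v)
    t·sum≤sumℤ = ≤ᴿ-trans {t ·ᴿ sumᴿ x} {sumᴿ tx} {fromℤᴿ (sumℤ v)}
      (pointwise⇒≤ᴿ {t ·ᴿ sumᴿ x} {sumᴿ tx} (ℚ.≤-reflexive ∘ t·sum≡))
      (≤ᴿ-trans {sumᴿ tx} {sumᴿ v′} {fromℤᴿ (sumℤ v)} (sumᴿ-mono-≤ᴿ {n} {tx} {v′} λ i → ≈ᴿ⇒≥ᴿ {v′ i} {tx i} (v≈tx i))
        (pointwise⇒≤ᴿ {sumᴿ v′} {fromℤᴿ (sumℤ v)} (ℚ.≤-reflexive ∘ seq-sumᴿ-fromℤᴿ v)))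
    sumℤ≤t·sum : fromℤᴿ (sumℤ v) ≤ᴿ t ·ᴿ sumᴿ x
    sumℤ≤t·sum = ≤ᴿ-trans {fromℤᴿ (sumℤ v)} {sumᴿ tx} {t ·ᴿ sumᴿ x}
      (≤ᴿ-trans {fromℤᴿ (sumℤ v)} {sumᴿ v′} {sumᴿ tx}
        (pointwise⇒≤ᴿ {fromℤᴿ (sumℤ v)} {sumᴿ v′} (ℚ.≤-reflexive ∘ sym ∘ seq-sumᴿ-fromℤᴿ v))
        (sumᴿ-mono-≤ᴿ {n} {v′} {tx} λ i → ≈ᴿ⇒≤ᴿ {v′ i} {tx i} (v≈tx i)))
      (pointwise⇒≤ᴿ {sumᴿ tx} {t ·ᴿ sumᴿ x} (ℚ.≤-reflexive ∘ sym ∘ t·sum≡))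

  conditions⇒lattice : LatticeConditions r n k t v → LatticePoint (dilate t (MultiHypersimplex r n k)) v
  conditions⇒lattice conditions = x , record
    { nonneg  = λ i → pointwise⇒≤ᴿ {fromℕᴿ 0} {x i} λ m → ℚ.*-cancelˡ-≤-pos (fromℕ t) (subst₂ ℚ._≤_ (sym (ℚ.*-zeroʳ (fromℕ t))) (sym (t*x i)) (fromℤ-mono-≤ (nonneg i)))
    ; bounded = λ i → pointwise⇒≤ᴿ {x i} {fromℕᴿ r} λ m → ℚ.*-cancelˡ-≤-pos (fromℕ t) (subst₂ ℚ._≤_ (sym (t*x i))
        (trans (cong fromℕ (ℕ.*-comm r t)) (fromℕ-* t r)) (fromℤ-mono-≤ (bounded i)))
    ; lower   = pointwise⇒≤ᴿ {fromℤᴿ (ℤ.+ k ℤ.- ℤ.+ 1)} {sumᴿ x} λ m → ℚ.*-cancelˡ-≤-pos (fromℕ t) (subst₂ ℚ._≤_ (fromℤ-* (ℤ.+ t) (ℤ.+ k ℤ.- ℤ.+ 1)) (sym (t*sum m)) (fromℤ-mono-≤ lower))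
    -- The witness v/t consists of constant sequences, so the gap at index 0 serves at every index.
    ; upper<  = λ k<rn → gap , positive-gap k<rn , 0 , λ m _ → ℚ.≤-reflexive (trans (cong (ℚ._+ gap) (sum-constant m))
        (solve 2 (λ s k → s :+ (k :- s) := k) refl (seq (sumᴿ x) 0) (fromℕ k)))
    ; upper≤  = λ k≡rn → pointwise⇒≤ᴿ {sumᴿ x} {fromℕᴿ k} λ m → ℚ.*-cancelˡ-≤-pos (fromℕ t) (subst₂ ℚ._≤_ (sym (t*sum m)) (fromℕ-* t k) (fromℤ-mono-≤ (upper≤ k≡rn)))
    } , λ i → pointwise⇒≈ᴿ {fromℤᴿ (lookup v i)} {t ·ᴿ x i} λ m → sym (trans (seq-·ᴿ t (x i) m) (t*x i))
    where
    open LatticeConditions conditions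
    x : Vector ℝ n
    x i = fromℚᴿ (lookup v i ℚ./ t)
    t*x : ∀ i → fromℕ t ℚ.* (lookup v i ℚ./ t) ≡ fromℤ (lookup v i)
    t*x i = /-cancel (lookup v i) t
    t*sum : ∀ m → fromℕ t ℚ.* seq (sumᴿ x) m ≡ fromℤ (sumℤ v)
    t*sum m = go v
      where
      go : ∀ {n} (v : Vec ℤ n) → fromℕ t ℚ.* seq (sumᴿ λ i → fromℚᴿ (lookup v i ℚ./ t)) m ≡ fromℤ (sumℤ v)
      go []      = ℚ.*-zeroʳ (fromℕ t)
      go (a ∷ v) = trans (ℚ.*-distribˡ-+ (fromℕ t) (a ℚ./ t) _) (trans (cong₂ ℚ._+_ (/-cancel a t) (go v)) (sym (fromℤ-+ a (sumℤ v))))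
    sum-constant : ∀ m → seq (sumᴿ x) m ≡ seq (sumᴿ x) 0
    sum-constant m = go n x (λ i → refl)
      where
      go : ∀ n (x : Vector ℝ n) → (∀ i → seq (x i) m ≡ seq (x i) 0) → seq (sumᴿ x) m ≡ seq (sumᴿ x) 0
      go zero    x eq = refl
      go (suc n) x eq = cong₂ ℚ._+_ (eq Fin.zero) (go n (x ∘ Fin.suc) (eq ∘ Fin.suc))
    gap : ℚ
    gap = fromℕ k ℚ.- seq (sumᴿ x) 0
    positive-gap : k < r * n → 0ℚ ℚ.< gap
    positive-gap k<rn = subst (ℚ._< gap) (ℚ.+-inverseʳ (seq (sumᴿ x) 0)) (ℚ.+-monoˡ-< (ℚ.- seq (sumᴿ x) 0)
      (ℚ.*-cancelˡ-<-nonNeg (fromℕ t) {{ℚ.pos⇒nonNeg (fromℕ t)}} (subst₂ ℚ._<_ (sym (t*sum 0)) (fromℕ-* t k) (fromℤ-mono-< (upper< k<rn)))))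

-- ⌈ fdes / r ⌉ counts the descents, including one at the end if cₙ > 0

module _ where
  open import Data.Rational.Unnormalised as ℚᵘ using (mkℚᵘ)
  import Data.Rational.Unnormalised.Properties as ℚᵘ
  open import Data.Integer.DivMod using (div-pos-is-/ℕ; [n/ℕd]*d≤n; n<s[n/ℕd]*d)

  fromℤ-neg : ∀ z → fromℤ (ℤ.- z) ≡ ℚ.- fromℤ z
  fromℤ-neg z = ℚ.toℚᵘ-injective (ℚᵘ.≃-trans (toℚᵘ-fromℤ (ℤ.- z))
    (ℚᵘ.≃-sym (ℚᵘ.≃-trans (ℚ.toℚᵘ-homo‿- (fromℤ z)) (ℚᵘ.-‿cong (toℚᵘ-fromℤ z)))))

  floor-unique : ∀ p z → fromℤ z ℚ.≤ p → p ℚ.< fromℤ (ℤ.suc z) → ℚ.floor p ≡ z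
  floor-unique (ℚ.mkℚ a d c) z z≤p p<1+z = trans (div-pos-is-/ℕ a (suc d)) (ℤ.≤-antisym
      (<suc⇒≤ (ℤ.*-cancelʳ-<-nonNeg {q} {ℤ.suc z} (ℤ.+ suc d) (ℤ.≤-<-trans ([n/ℕd]*d≤n a (suc d)) a<)))
      (<suc⇒≤ (ℤ.*-cancelʳ-<-nonNeg {z} {ℤ.suc q} (ℤ.+ suc d) (ℤ.≤-<-trans ≤a (n<s[n/ℕd]*d a (suc d))))))
    where
    <suc⇒≤ : ∀ {i j} → i ℤ.< ℤ.suc j → i ℤ.≤ j
    <suc⇒≤ {i} {j} i< = subst (i ℤ.≤_) (ℤ.pred-suc j) (ℤ.i<j⇒i≤pred[j] i<)
    q = a ℤ./ℕ suc d
    ≤a : z ℤ.* ℤ.+ suc d ℤ.≤ a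
    ≤a with ℚᵘ.≤-respˡ-≃ (toℚᵘ-fromℤ z) (ℚ.toℚᵘ-mono-≤ z≤p)
    ... | ℚᵘ.*≤* le = subst (z ℤ.* ℤ.+ suc d ℤ.≤_) (ℤ.*-identityʳ a) le
    a< : a ℤ.< ℤ.suc z ℤ.* ℤ.+ suc d
    a< with ℚᵘ.<-respʳ-≃ (toℚᵘ-fromℤ (ℤ.suc z)) (ℚ.toℚᵘ-mono-< p<1+z)
    ... | ℚᵘ.*<* lt = subst (ℤ._< ℤ.suc z ℤ.* ℤ.+ suc d) (ℤ.*-identityʳ a) lt

-- The ceiling is -⌊-p⌋, so this is `floor-unique` reflected at 0; the record pattern makes
-- `ceiling` unfold.
ceiling-unique : ∀ p z → p ℚ.≤ fromℤ z → fromℤ z ℚ.< p ℚ.+ 1ℚ → ℚ.ceiling p ≡ z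
ceiling-unique p@record{} z p≤z z<p+1 = trans (cong ℤ.-_ (floor-unique (ℚ.- p) (ℤ.- z)
    (subst (ℚ._≤ ℚ.- p) (sym (fromℤ-neg z)) (ℚ.neg-antimono-≤ p≤z))
    (subst (ℚ.- p ℚ.<_) (sym (trans (fromℤ-+ (ℤ.+ 1) (ℤ.- z)) (cong (1ℚ ℚ.+_) (fromℤ-neg z))))
      (subst₂ ℚ._<_ (trans (solve 2 (λ p z → z :+ (con (ℚ.- 1ℚ) :* p :+ con (ℚ.- 1ℚ) :* z) := con (ℚ.- 1ℚ) :* p) refl p (fromℤ z)) (negated p))
        (solve 2 (λ p z → p :+ con 1ℚ :+ (con (ℚ.- 1ℚ) :* p :+ con (ℚ.- 1ℚ) :* z) := con 1ℚ :- z) refl p (fromℤ z))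
        (ℚ.+-monoˡ-< ((ℚ.- 1ℚ) ℚ.* p ℚ.+ (ℚ.- 1ℚ) ℚ.* fromℤ z) z<p+1)))))
  (ℤ.neg-involutive z)
  where
  negated : ∀ p → (ℚ.- 1ℚ) ℚ.* p ≡ ℚ.- p
  negated p = trans (sym (ℚ.neg-distribˡ-* 1ℚ p)) (cong ℚ.-_ (ℚ.*-identityˡ p))

⌈/⌉≡ : ∀ a r q .{{_ : NonZero r}} → a ≤ r * q → r * q < a + r → ⌈ a / r ⌉ ≡ q
⌈/⌉≡ a r q a≤rq rq<a+r = cong ℤ.∣_∣ (ceiling-unique (ℤ.+ a ℚ./ r) (ℤ.+ q)
  (ℚ.*-cancelˡ-≤-pos (fromℕ r) (subst₂ ℚ._≤_ (sym (/-cancel (ℤ.+ a) r)) (fromℕ-* r q) (fromℕ-mono-≤ a≤rq)))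
  (ℚ.*-cancelˡ-<-nonNeg (fromℕ r) {{ℚ.pos⇒nonNeg (fromℕ r)}} (subst₂ ℚ._<_ (fromℕ-* r q)
    (trans (fromℕ-+ a r) (sym (trans (ℚ.*-distribˡ-+ (fromℕ r) (ℤ.+ a ℚ./ r) 1ℚ)
      (cong₂ ℚ._+_ (/-cancel (ℤ.+ a) r) (ℚ.*-identityʳ (fromℕ r)))))) (fromℕ-mono-< rq<a+r))))
  where instance _ = fromℕ-positive r

⌈[rq+l]/r⌉≡ : ∀ r q {l} .{{_ : NonZero r}} → l < r → ⌈ (r * q + l) / r ⌉ ≡ q + ι (1 ℕ.≤? l)
⌈[rq+l]/r⌉≡ r q {zero} 0<r = ⌈/⌉≡ (r * q + 0) r (q + 0) (ℕ.≤-reflexive eq) (subst (_< r * q + 0 + r) eq (ℕ.m<m+n _ 0<r))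
  where
  eq : r * q + 0 ≡ r * (q + 0)
  eq = trans (ℕ.+-identityʳ _) (cong (r *_) (sym (ℕ.+-identityʳ q)))
⌈[rq+l]/r⌉≡ r q {suc l} l<r = ⌈/⌉≡ (r * q + suc l) r (q + 1)
  (subst (r * q + suc l ≤_) (sym eq) (ℕ.+-monoʳ-≤ (r * q) (ℕ.<⇒≤ l<r)))
  (subst (_< r * q + suc l + r) (sym eq) (ℕ.+-monoˡ-< r (ℕ.m<m+n (r * q) (s≤s z≤n))))
  where
  eq : r * (q + 1) ≡ r * q + r
  eq = trans (ℕ.*-distribˡ-+ r q 1) (cong (r * q +_) (ℕ.*-identityʳ r))

⌈fdes/r⌉≡depth : (r t m : ℕ) .{{_ : NonZero r}} (π : Vec (Fin (suc m)) (suc m) × Vec (Fin r) (suc m)) →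
                 ⌈ fdes π / r ⌉ ≡ Labelled.depth r t m π
⌈fdes/r⌉≡depth r t m π@(_ , c) = ⌈[rq+l]/r⌉≡ r (des π) (Fin.toℕ<n (Vec.last c))

-- There are at most n - 1 descents and one more at the end; this is the bound that `ehrhart-series`
-- asks for.
depth≤n : (r t m : ℕ) .{{_ : NonZero r}} (π : Vec (Fin (suc m)) (suc m) × Vec (Fin r) (suc m)) → Labelled.depth r t m π ≤ suc m
depth≤n r t m π@(_ , c) = ℕ.≤-trans
  (ℕ.+-mono-≤ (subst₂ _≤_ (sym (count≡sumFin (λ i → descent? π (inject₁ i) (Fin.suc i)) id)) (sumFin-1 {m})
      (sumFin-≤ λ i → ι≤1 (descent? π (inject₁ i) (Fin.suc i)))) (ι≤1 (1 ℕ.≤? lastColor c)))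
  (ℕ.≤-reflexive (ℕ.+-comm m 1))

-- The lattice points as complements v = rt − w of words

module LatticeWords (r n k t : ℕ) .{{_ : NonZero t}} (1≤k : 1 ≤ k) (k≤rn : k ≤ r * n) where

  T : ℕ
  T = r * t

  Word : ℕ → Set
  Word n = Vec (Fin (suc T)) n

  toPoint : ∀ {n} → Word n → Vec ℤ n
  toPoint = Vec.map λ x → ℤ.+ (T ∸ toℕ x)

  cosum : ∀ {n} → Word n → ℕ
  cosum []      = 0
  cosum (x ∷ w) = T ∸ toℕ x + cosum w

  sumℤ-toPoint : ∀ {n} (w : Word n) → sumℤ (toPoint w) ≡ ℤ.+ cosum w
  sumℤ-toPoint []      = refl
  sumℤ-toPoint (x ∷ w) = cong (λ z → (ℤ.+ (T ∸ toℕ x)) ℤ.+ z) (sumℤ-toPoint w)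

  cosum+sum : ∀ {n} (w : Word n) → cosum w + sum (letters w) ≡ n * T
  cosum+sum []      = refl
  cosum+sum {suc n} (x ∷ w) = trans
    (Nat.solve 4 (λ a b c d → a Nat.:+ b Nat.:+ (c Nat.:+ d) Nat.:= a Nat.:+ c Nat.:+ (b Nat.:+ d)) refl
      (T ∸ toℕ x) (cosum w) (toℕ x) (sum (letters w)))
    (cong₂ _+_ (ℕ.m∸n+n≡m (ℕ.≤-pred (Fin.toℕ<n x))) (cosum+sum w))

  lookup-toPoint : ∀ {n} (w : Word n) i → lookup (toPoint w) i ≡ ℤ.+ (T ∸ toℕ (lookup w i))
  lookup-toPoint w i = lookup-map i _ w

  toPoint-injective : ∀ {n} {w w′ : Word n} → toPoint w ≡ toPoint w′ → w ≡ w′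
  toPoint-injective {w = []}    {[]}      eq = refl
  toPoint-injective {w = x ∷ w} {y ∷ w′} eq = cong₂ _∷_
    (Fin.toℕ-injective (ℕ.∸-cancelˡ-≡ (ℕ.≤-pred (Fin.toℕ<n x)) (ℕ.≤-pred (Fin.toℕ<n y)) (ℤ.+-injective (∷-injectiveˡ eq))))
    (toPoint-injective (∷-injectiveʳ eq))

  fromPoint : ∀ {n} (v : Vec ℤ n) → (∀ i → ℤ.+ 0 ℤ.≤ lookup v i) → (∀ i → lookup v i ℤ.≤ ℤ.+ T) → ∃ λ w → toPoint w ≡ v
  fromPoint []      0≤v v≤T = [] , refl
  fromPoint (ℤ.+ a ∷ v) 0≤v v≤T with fromPoint v (0≤v ∘ Fin.suc) (v≤T ∘ Fin.suc) | v≤T Fin.zero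
  ... | w , refl | ℤ.+≤+ a≤T = Fin.fromℕ< (s≤s (ℕ.m∸n≤m T a)) ∷ w , cong (λ b → ℤ.+ b ∷ toPoint w)
    (trans (cong (T ∸_) (Fin.toℕ-fromℕ< (s≤s (ℕ.m∸n≤m T a)))) (ℕ.m∸[m∸n]≡n a≤T))
  fromPoint (ℤ.-[1+ a ] ∷ v) 0≤v v≤T with () ← 0≤v Fin.zero

  e k′ : ℕ
  e = r * n ∸ k
  k′ = k ∸ 1

  slice? : ∀ (w : Word n) → Dec ((sum (letters w) ∸ 1) / t ≡ e)
  slice? w = (sum (letters w) ∸ 1) / t ℕ.≟ e

  balance : ∀ (w : Word n) → cosum w + sum (letters w) ≡ t * k + t * e
  balance w = trans (cosum+sum w) (trans (trans (Nat.solve 3 (λ n r t → n Nat.:* (r Nat.:* t) Nat.:= t Nat.:* (r Nat.:* n)) refl n r t)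
    (cong (t *_) (sym (ℕ.m+[n∸m]≡n k≤rn)))) (ℕ.*-distribˡ-+ t k e))

  tk≡ : t * k ≡ t * k′ + t
  tk≡ = trans (cong (t *_) (sym (ℕ.m∸n+n≡m 1≤k))) (trans (ℕ.*-distribˡ-+ t k′ 1) (cong (t * k′ +_) (ℕ.*-identityʳ t)))

  lowerℤ : ℤ.+ t ℤ.* (ℤ.+ k ℤ.- ℤ.+ 1) ≡ ℤ.+ (t * k′)
  lowerℤ = trans (cong (ℤ.+ t ℤ.*_) (trans (ℤ.m-n≡m⊖n k 1) (ℤ.⊖-≥ 1≤k))) (sym (ℤ.pos-* t k′))

  slice⇒conditions : ∀ (w : Word n) → (sum (letters w) ∸ 1) / t ≡ e → LatticeConditions r n k t (toPoint w)
  slice⇒conditions w M≡ = record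
    { nonneg  = λ i → subst (ℤ.+ 0 ℤ.≤_) (sym (lookup-toPoint w i)) (ℤ.+≤+ z≤n)
    ; bounded = λ i → subst (ℤ._≤ ℤ.+ T) (sym (lookup-toPoint w i)) (ℤ.+≤+ (ℕ.m∸n≤m T (toℕ (lookup w i))))
    ; lower   = subst₂ ℤ._≤_ (sym lowerℤ) (sym (sumℤ-toPoint w)) (ℤ.+≤+ (ℕ.+-cancelʳ-≤ (t + t * e) _ _
        (ℕ.≤-trans (ℕ.≤-reflexive (sym (trans (balance w) (trans (cong (_+ t * e) tk≡) (ℕ.+-assoc (t * k′) t (t * e))))))
          (ℕ.+-monoʳ-≤ (cosum w) M≤))))
    ; upper<  = λ k<rn → subst (ℤ._< ℤ.+ (t * k)) (sym (sumℤ-toPoint w)) (ℤ.+<+ (ℕ.+-cancelʳ-< (t * e) _ _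
        (ℕ.<-≤-trans (ℕ.+-monoʳ-< (cosum w) (te<M k<rn)) (ℕ.≤-reflexive (balance w)))))
    ; upper≤  = λ k≡rn → subst (ℤ._≤ ℤ.+ (t * k)) (sym (sumℤ-toPoint w)) (ℤ.+≤+ (ℕ.+-cancelʳ-≤ (t * e) _ _
        (ℕ.≤-trans (ℕ.+-monoʳ-≤ (cosum w) (ℕ.≤-trans te≤ (ℕ.m∸n≤m M 1))) (ℕ.≤-reflexive (balance w))))) }
    where
    M = sum (letters w)
    te≤ : t * e ≤ M ∸ 1
    te≤ = subst (_≤ M ∸ 1) (trans (cong (_* t) M≡) (ℕ.*-comm e t)) (m/n*n≤m (M ∸ 1) t)
    M≤ : M ≤ t + t * e
    M≤ = ℕ.≤-trans (ℕ.m≤n+m∸n M 1) (ℕ.<-≤-trans (ℕ.≤-reflexive (cong suc (m≡m%n+[m/n]*n (M ∸ 1) t)))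
      (ℕ.+-mono-≤ (m%n<n (M ∸ 1) t) (ℕ.≤-reflexive (trans (cong (_* t) M≡) (ℕ.*-comm e t)))))
    -- For k < rn the product te is at least 1, so M is positive and `M ∸ 1` is a true predecessor.
    te<M : k < r * n → t * e < M
    te<M k<rn = ℕ.≤-<-trans te≤ (pred< M (ℕ.≤-trans (ℕ.≤-trans (ℕ.*-mono-≤ (ℕ.>-nonZero⁻¹ t) (ℕ.m<n⇒0<n∸m k<rn)) te≤) (ℕ.m∸n≤m M 1)))
      where
      pred< : ∀ M → 1 ≤ M → M ∸ 1 < M
      pred< (suc M) _ = ℕ.≤-refl

  conditions⇒slice : ∀ (w : Word n) → LatticeConditions r n k t (toPoint w) → (sum (letters w) ∸ 1) / t ≡ e
  conditions⇒slice w conditions = ℕ.≤-antisym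
    (ℕ.≤-pred (m<n*o⇒m/o<n {o = t} (ℕ.<-≤-trans (pred< M M≤) (ℕ.≤-reflexive (cong (t +_) (ℕ.*-comm t e))))))
    (ℕ.≤-trans (ℕ.≤-reflexive (sym (m*n/n≡m e t))) (/-monoˡ-≤ t (te≤ (ℕ.m≤n⇒m<n∨m≡n k≤rn))))
    where
    open LatticeConditions conditions
    M = sum (letters w)
    M≤ : M ≤ t + t * e
    M≤ = ℕ.+-cancelˡ-≤ (t * k′) _ _ (ℕ.≤-trans (ℕ.+-monoˡ-≤ M (ℤ.drop‿+≤+ (subst₂ ℤ._≤_ lowerℤ (sumℤ-toPoint w) lower)))
      (ℕ.≤-reflexive (trans (balance w) (trans (cong (_+ t * e) tk≡) (ℕ.+-assoc (t * k′) t (t * e))))))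
    pred< : ∀ M → M ≤ t + t * e → M ∸ 1 < t + t * e
    pred< zero    _  = ℕ.≤-trans (ℕ.>-nonZero⁻¹ t) (ℕ.m≤m+n t (t * e))
    pred< (suc M) M< = M<
    -- In the closed case e = 0 leaves nothing to show; in the half-open case the strict bound te <
    -- M gives room for the predecessor.
    te≤ : k < r * n ⊎ k ≡ r * n → e * t ≤ M ∸ 1
    te≤ (inj₂ k≡rn) = subst (λ z → z * t ≤ M ∸ 1) (sym (ℕ.m≤n⇒m∸n≡0 (ℕ.≤-reflexive (sym k≡rn)))) z≤n
    te≤ (inj₁ k<rn) = subst (_≤ M ∸ 1) (ℕ.*-comm t e) (ℕ.≤-pred (subst (t * e <_) (sym (ℕ.m+[n∸m]≡n (ℕ.≤-trans (s≤s z≤n) te<M))) te<M))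
      where
      te<M : t * e < M
      te<M = ℕ.+-cancelˡ-< (t * k) _ _ (subst (_< t * k + M) (balance w) (ℕ.+-monoˡ-< M (ℤ.drop‿+<+ (subst (ℤ._< ℤ.+ (t * k)) (sumℤ-toPoint w) (upper< k<rn)))))

  lattice-cardinality : HasCardinality (LatticePoint (dilate t (MultiHypersimplex r n k)))
    (sumOver (words (List.allFin (suc T)) n) (λ w → ι (slice? w)))
  lattice-cardinality = record
    { elements = List.map toPoint slices
    ; unique   = Unique.map⁺ toPoint-injective (Unique.filter⁺ slice? (words-unique (suc T) n))
    ; correct  = λ v → mk⇔
        (λ v∈ → let w , w∈ , v≡ = ∈-map⁻ toPoint v∈ in subst (LatticePoint (dilate t (MultiHypersimplex r n k))) (sym v≡)
          (conditions⇒lattice r n k t (toPoint w) (slice⇒conditions w (proj₂ (∈-filter⁻ slice? {xs = words (List.allFin (suc T)) n} w∈)))))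
        (λ inside → let conditions = lattice⇒conditions r n k t v inside
                        w , ≡v = fromPoint v (LatticeConditions.nonneg conditions) (LatticeConditions.bounded conditions)
          in subst (_∈ List.map toPoint slices) ≡v (∈-map⁺ toPoint (∈-filter⁺ slice? (words-complete w)
               (conditions⇒slice w (subst (LatticeConditions r n k t) (sym ≡v) conditions)))))
    ; size     = trans (length-map toPoint slices) (trans (length≡sumOver slices) (trans (sumOver-filter slice? (words (List.allFin (suc T)) n) (λ _ → 1))
        (sumOver-cong (words (List.allFin (suc T)) n) λ {w} _ → ℕ.*-identityʳ (ι (slice? w))))) }
    where
    slices : List (Word n)
    slices = List.filter slice? (words (List.allFin (suc T)) n)

theorem4p6 : (r n k : ℕ) .{{_ : NonZero r}} .{{_ : NonZero n}} → 1 ≤ k → k ≤ r * n →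
    (∃ λ E → IsEhrhartPolynomial (MultiHypersimplex r n k) E) ×
    (∀ E → IsEhrhartPolynomial (MultiHypersimplex r n k) E →
    E* n E ≈ˢ sumˢ (coloredPermutationsWithFexc r n (r * n ∸ k)) (λ π → z^ ⌈ fdes π / r ⌉))
theorem4p6 r n@(suc m) k 1≤k k≤rn = ehrhart-series (MultiHypersimplex r n k) CP (λ π → ⌈ fdes π / r ⌉)
  (λ π _ → subst (_≤ n) (sym (⌈fdes/r⌉≡depth r 1 m π)) (depth≤n r 1 m π))
  λ { t@(suc t′) _ → subst (HasCardinality (LatticePoint (dilate t (MultiHypersimplex r n k)))) (count t)
        (LatticeWords.lattice-cardinality r n k t 1≤k k≤rn) }
  where
  CP : List (Vec (Fin n) n × Vec (Fin r) n)
  CP = coloredPermutationsWithFexc r n (r * n ∸ k)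
  count : ∀ t .{{_ : NonZero t}} → sumOver (words (List.allFin (suc (r * t))) n) (λ w → ι ((sum (letters w) ∸ 1) / t ℕ.≟ r * n ∸ k)) ≡
          sumOver CP (λ π → B n ⌈ fdes π / r ⌉ t)
  count t = trans (sym (words-equidistributed r t n (r * n ∸ k)))
    (trans (sym (Labelled.labelled-count r t m (r * n ∸ k)))
      (sumOver-cong CP λ {π} _ → cong (λ d → B n d t) (sym (⌈fdes/r⌉≡depth r t m π))))
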